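{- Let $d\ge 2$. For every $c>0$ there exists a constant $\delta=\delta(c)>0$ such that asymptotically almost surely (as $n\to\infty$) every minimal core subcomplex $K$ of $Y\in Y_d(n,\frac{c}{n})$ with $f_d(K)\le \delta n^d$ contains the boundary of a $(d+1)$-simplex.
   Context: $\Delta_{n-1}$ denotes the $(n-1)$-dimensional simplex on vertex set $[n]$. $Y_d(n,p)$ is the probability space of complexes $\Delta_{n-1}^{(d-1)}\subset Y\subset\Delta_{n-1}^{(d)}$ in which each $d$-simplex is included independently with probability $p$. Here a subcomplex $K$ of $Y$ is determined by a set of $d$-simplices of $Y$ (its $d$-simplices), and consists of these $d$-simplices together with all their faces; $f_d(K)$ is its number of $d$-simplices. Such a complex is a core if every $(d-1)$-face of it is contained in at least two of its $d$-simplices. A core is a minimal core if none of its proper subcomplexes (in the same sense, with nonempty set of $d$-simplices) is a core. -}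

module Defs where

open import Algebra.Bundles.Raw using (RawRing)
import Algebra.Definitions.RawSemiring as RawSemiringDefs
open import Data.Fin using (Fin)
open import Data.Fin.Subset as Subset
  using (Subset; inside; outside; _∈_; _⊆_; _⊂_; Nonempty; ∁; ∣_∣)
open import Data.Integer using (+_)
open import Data.List using (List; []; _∷_; _++_; map; filter; foldr; length; lookup)
open import Data.Nat as ℕ using (ℕ; zero; suc)
import Data.Nat.Properties as ℕ
open import Data.Product using (Σ; Σ-syntax; ∃; ∃-syntax; _×_; _,_; proj₁; proj₂)
open import Data.Rational as ℚ using (ℚ; 0ℚ; 1ℚ)
import Data.Rational.Properties as ℚ
open import Data.Rational.Solver using (module +-*-Solver)
import Data.Vec as Vec
open import Level using (0ℓ)
open import Relation.Binary.PropositionalEquality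
open import Relation.Nullary using (¬_)
open import Relation.Unary using (Pred; Decidable)

------------------------------------------------------------------------
-- Real numbers: Cauchy sequences of rationals, with pointwise operations

Eventually : Pred ℕ 0ℓ → Set
Eventually P = ∃[ N ] (∀ k → N ℕ.≤ k → P k)

IsCauchy : (ℕ → ℚ) → Set
IsCauchy x = ∀ q → 0ℚ ℚ.< q →
  ∃[ N ] (∀ j k → N ℕ.≤ j → N ℕ.≤ k → ℚ.∣ x j ℚ.- x k ∣ ℚ.≤ q)

record ℝ : Set where
  constructor mkℝ
  field
    seq    : ℕ → ℚ
    cauchy : IsCauchy seq

open ℝ public

private abstract
  half : ∀ q → 0ℚ ℚ.< q → 0ℚ ℚ.< q ℚ.* ℚ.½
  half q 0<q = ℚ.*-monoˡ-<-pos ℚ.½ 0<q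

  half+half : ∀ q → q ℚ.* ℚ.½ ℚ.+ q ℚ.* ℚ.½ ≡ q
  half+half q = trans (sym (ℚ.*-distribˡ-+ q ℚ.½ ℚ.½)) (ℚ.*-identityʳ q)

  const-cauchy : ∀ q → IsCauchy (λ _ → q)
  const-cauchy q ε 0<ε = 0 , λ _ _ _ _ →
    subst (λ z → ℚ.∣ z ∣ ℚ.≤ ε) (sym (ℚ.+-inverseʳ q)) (ℚ.<⇒≤ 0<ε)

  +-cauchy : ∀ {x y} → IsCauchy x → IsCauchy y → IsCauchy (λ k → x k ℚ.+ y k)
  +-cauchy {x} {y} cx cy q 0<q with cx _ (half q 0<q) | cy _ (half q 0<q)
  ... | M , hM | N , hN = M ℕ.⊔ N , λ j k j≥ k≥ → begin
      ℚ.∣ (x j ℚ.+ y j) ℚ.- (x k ℚ.+ y k) ∣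
        ≡⟨ cong ℚ.∣_∣ (regroup (x j) (y j) (x k) (y k)) ⟩
      ℚ.∣ (x j ℚ.- x k) ℚ.+ (y j ℚ.- y k) ∣
        ≤⟨ ℚ.∣p+q∣≤∣p∣+∣q∣ (x j ℚ.- x k) (y j ℚ.- y k) ⟩
      ℚ.∣ x j ℚ.- x k ∣ ℚ.+ ℚ.∣ y j ℚ.- y k ∣
        ≤⟨ ℚ.+-mono-≤
             (hM j k (ℕ.m⊔n≤o⇒m≤o M N j≥) (ℕ.m⊔n≤o⇒m≤o M N k≥))
             (hN j k (ℕ.m⊔n≤o⇒n≤o M N j≥) (ℕ.m⊔n≤o⇒n≤o M N k≥)) ⟩
      q ℚ.* ℚ.½ ℚ.+ q ℚ.* ℚ.½
        ≡⟨ half+half q ⟩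
      q ∎
    where
    open ℚ.≤-Reasoning
    regroup : ∀ a b c d → (a ℚ.+ b) ℚ.- (c ℚ.+ d) ≡ (a ℚ.- c) ℚ.+ (b ℚ.- d)
    regroup = solve 4 (λ a b c d → (a :+ b) :- (c :+ d) := (a :- c) :+ (b :- d)) refl
      where open +-*-Solver

  neg-cauchy : ∀ {x} → IsCauchy x → IsCauchy (λ k → ℚ.- x k)
  neg-cauchy {x} cx q 0<q with cx q 0<q
  ... | N , h = N , λ j k j≥ k≥ →
    subst (ℚ._≤ q)
      (trans (sym (ℚ.∣-p∣≡∣p∣ (x j ℚ.- x k))) (cong ℚ.∣_∣ (ℚ.neg-distrib-+ (x j) (ℚ.- x k))))
      (h j k j≥ k≥)

  bounded : ∀ {x} → IsCauchy x →
    ∃[ B ] ((0ℚ ℚ.< B) × Eventually (λ k → ℚ.∣ x k ∣ ℚ.≤ B))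
  bounded {x} cx with cx 1ℚ (ℚ.positive⁻¹ 1ℚ)
  ... | N , h = 1ℚ ℚ.+ ℚ.∣ x N ∣
      , ℚ.<-≤-trans (ℚ.positive⁻¹ 1ℚ) (ℚ.+-monoʳ-≤ 1ℚ (ℚ.0≤∣p∣ (x N)))
      , N , λ k k≥ → begin
      ℚ.∣ x k ∣                              ≡⟨ cong ℚ.∣_∣ (split (x k) (x N)) ⟩
      ℚ.∣ (x k ℚ.- x N) ℚ.+ x N ∣            ≤⟨ ℚ.∣p+q∣≤∣p∣+∣q∣ (x k ℚ.- x N) (x N) ⟩
      ℚ.∣ x k ℚ.- x N ∣ ℚ.+ ℚ.∣ x N ∣        ≤⟨ ℚ.+-monoˡ-≤ ℚ.∣ x N ∣ (h k N k≥ ℕ.≤-refl) ⟩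
      1ℚ ℚ.+ ℚ.∣ x N ∣                       ∎
    where
    open ℚ.≤-Reasoning
    split : ∀ a b → a ≡ (a ℚ.- b) ℚ.+ b
    split = solve 2 (λ a b → a := (a :- b) :+ b) refl
      where open +-*-Solver

  ∣*∣-mono : ∀ s t {u v} → 0ℚ ℚ.< v →
    ℚ.∣ s ∣ ℚ.≤ u → ℚ.∣ t ∣ ℚ.≤ v → ℚ.∣ s ℚ.* t ∣ ℚ.≤ u ℚ.* v
  ∣*∣-mono s t {u} {v} 0<v s≤u t≤v = begin
    ℚ.∣ s ℚ.* t ∣          ≡⟨ ℚ.∣p*q∣≡∣p∣*∣q∣ s t ⟩
    ℚ.∣ s ∣ ℚ.* ℚ.∣ t ∣    ≤⟨ ℚ.*-monoˡ-≤-nonNeg ℚ.∣ s ∣ {{ℚ.∣-∣-nonNeg s}} t≤v ⟩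
    ℚ.∣ s ∣ ℚ.* v          ≤⟨ ℚ.*-monoʳ-≤-nonNeg v {{ℚ.nonNegative (ℚ.<⇒≤ 0<v)}} s≤u ⟩
    u ℚ.* v                ∎
    where open ℚ.≤-Reasoning

  quotient : ∀ q s → 0ℚ ℚ.< q → 0ℚ ℚ.< s → ∃[ r ] ((0ℚ ℚ.< r) × (s ℚ.* r ≡ q))
  quotient q s 0<q 0<s = q ℚ.* i , 0<qi , trans (ℚ.*-comm s (q ℚ.* i))
    (trans (ℚ.*-assoc q i s)
      (trans (cong (q ℚ.*_) (ℚ.*-inverseˡ s {{s≢0}})) (ℚ.*-identityʳ q)))
    where
    s≢0 : ℚ.NonZero s
    s≢0 = ℚ.pos⇒nonZero s {{ℚ.positive 0<s}}
    i : ℚ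
    i = (ℚ.1/ s) {{s≢0}}
    0<qi : 0ℚ ℚ.< q ℚ.* i
    0<qi = ℚ.positive⁻¹ (q ℚ.* i)
      {{ℚ.pos*pos⇒pos q {{ℚ.positive 0<q}} i {{ℚ.1/pos⇒pos s {{ℚ.positive 0<s}}}}}}

  *-regroup : ∀ a b c d →
    a ℚ.* b ℚ.- c ℚ.* d ≡ a ℚ.* (b ℚ.- d) ℚ.+ (a ℚ.- c) ℚ.* d
  *-regroup = solve 4 (λ a b c d → a :* b :- c :* d := a :* (b :- d) :+ (a :- c) :* d) refl
    where open +-*-Solver

  *-estimate : ∀ a b c d A B r → 0ℚ ℚ.< r → 0ℚ ℚ.< B →
    ℚ.∣ a ∣ ℚ.≤ A → ℚ.∣ d ∣ ℚ.≤ B → ℚ.∣ a ℚ.- c ∣ ℚ.≤ r → ℚ.∣ b ℚ.- d ∣ ℚ.≤ r →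
    ℚ.∣ a ℚ.* b ℚ.- c ℚ.* d ∣ ℚ.≤ (A ℚ.+ B) ℚ.* r
  *-estimate a b c d A B r 0<r 0<B a≤A d≤B ac≤r bd≤r =
    subst₂ ℚ._≤_ (cong ℚ.∣_∣ (sym (*-regroup a b c d)))
      (trans (cong (ℚ._+_ (A ℚ.* r)) (ℚ.*-comm r B)) (sym (ℚ.*-distribʳ-+ r A B)))
      (ℚ.≤-trans (ℚ.∣p+q∣≤∣p∣+∣q∣ u v)
        (ℚ.+-mono-≤ {ℚ.∣ u ∣} {A ℚ.* r} {ℚ.∣ v ∣} {r ℚ.* B}
          (∣*∣-mono a (b ℚ.- d) {A} {r} 0<r a≤A bd≤r)
          (∣*∣-mono (a ℚ.- c) d {r} {B} 0<B ac≤r d≤B)))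
    where
    u v : ℚ
    u = a ℚ.* (b ℚ.- d)
    v = (a ℚ.- c) ℚ.* d

  *-cauchy : ∀ {x y} → IsCauchy x → IsCauchy y → IsCauchy (λ k → x k ℚ.* y k)
  *-cauchy {x} {y} cx cy q 0<q =
    let A , 0<A , K , hA  = bounded {x} cx
        B , 0<B , L , hB  = bounded {y} cy
        r , 0<r , [A+B]r≡q = quotient q (A ℚ.+ B) 0<q (ℚ.+-mono-< {0ℚ} {A} {0ℚ} {B} 0<A 0<B)
        M , hM = cx r 0<r
        N , hN = cy r 0<r
    in (K ℕ.⊔ L) ℕ.⊔ (M ℕ.⊔ N) , λ j k j≥ k≥ →
      let j≥KL = ℕ.m⊔n≤o⇒m≤o (K ℕ.⊔ L) (M ℕ.⊔ N) j≥
          k≥KL = ℕ.m⊔n≤o⇒m≤o (K ℕ.⊔ L) (M ℕ.⊔ N) k≥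
          j≥MN = ℕ.m⊔n≤o⇒n≤o (K ℕ.⊔ L) (M ℕ.⊔ N) j≥
          k≥MN = ℕ.m⊔n≤o⇒n≤o (K ℕ.⊔ L) (M ℕ.⊔ N) k≥
      in subst (λ z → ℚ.∣ x j ℚ.* y j ℚ.- x k ℚ.* y k ∣ ℚ.≤ z) [A+B]r≡q
        (*-estimate (x j) (y j) (x k) (y k) A B r 0<r 0<B
          (hA j (ℕ.m⊔n≤o⇒m≤o K L j≥KL))
          (hB k (ℕ.m⊔n≤o⇒n≤o K L k≥KL))
          (hM j k (ℕ.m⊔n≤o⇒m≤o M N j≥MN) (ℕ.m⊔n≤o⇒m≤o M N k≥MN))
          (hN j k (ℕ.m⊔n≤o⇒n≤o M N j≥MN) (ℕ.m⊔n≤o⇒n≤o M N k≥MN)))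

infixl 7 _*_
infixl 6 _+_ _-_
infix  8 -_
infix  4 _≈_ _<_ _≤_

fromℚ : ℚ → ℝ
fromℚ q = mkℝ (λ _ → q) (const-cauchy q)

fromℕ : ℕ → ℝ
fromℕ n = fromℚ (+ n ℚ./ 1)

0ℝ 1ℝ : ℝ
0ℝ = fromℚ 0ℚ
1ℝ = fromℚ 1ℚ

_+_ _*_ : ℝ → ℝ → ℝ
x + y = mkℝ (λ k → seq x k ℚ.+ seq y k) (+-cauchy {seq x} {seq y} (cauchy x) (cauchy y))
x * y = mkℝ (λ k → seq x k ℚ.* seq y k) (*-cauchy {seq x} {seq y} (cauchy x) (cauchy y))

-_ : ℝ → ℝ
- x = mkℝ (λ k → ℚ.- seq x k) (neg-cauchy {seq x} (cauchy x))

_-_ : ℝ → ℝ → ℝ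
x - y = x + (- y)

_≈_ _<_ _≤_ : ℝ → ℝ → Set
x ≈ y = ∀ q → 0ℚ ℚ.< q → Eventually (λ k → ℚ.∣ seq x k ℚ.- seq y k ∣ ℚ.≤ q)
x < y = ∃[ q ] ((0ℚ ℚ.< q) × Eventually (λ k → seq x k ℚ.+ q ℚ.≤ seq y k))
x ≤ y = ∀ q → 0ℚ ℚ.< q → Eventually (λ k → seq x k ℚ.≤ seq y k ℚ.+ q)

ℝ-rawRing : RawRing 0ℓ 0ℓ
ℝ-rawRing = record
  { Carrier = ℝ ; _≈_ = _≈_ ; _+_ = _+_ ; _*_ = _*_ ; -_ = -_ ; 0# = 0ℝ ; 1# = 1ℝ }

open RawSemiringDefs (RawRing.rawSemiring ℝ-rawRing) public using (_^_)

infixl 7 _/ₙ_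
_/ₙ_ : ℝ → (n : ℕ) .{{_ : ℕ.NonZero n}} → ℝ
x /ₙ n = x * fromℚ (+ 1 ℚ./ n)

sum : List ℝ → ℝ
sum = foldr _+_ 0ℝ

Tendsto : ((n : ℕ) .{{_ : ℕ.NonZero n}} → ℝ) → ℝ → Set
Tendsto a l = ∀ ε → 0ℝ < ε →
  ∃[ N ] (∀ n .{{_ : ℕ.NonZero n}} → N ℕ.≤ n → (l - ε < a n) × (a n < l + ε))

------------------------------------------------------------------------
-- Complexes determined by their d-simplices

allSubsets : ∀ n → List (Subset n)
allSubsets zero    = Vec.[] ∷ []
allSubsets (suc n) =
  map (outside Vec.∷_) (allSubsets n) ++ map (inside Vec.∷_) (allSubsets n)

module _ (d n : ℕ) where

  -- The d-simplices on the vertex set Fin n, each listed exactly once.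
  simplices : List (Subset n)
  simplices = filter (λ σ → ∣ σ ∣ ℕ.≟ suc d) (allSubsets n)

  -- A set of d-simplices, as a set of positions in `simplices`.  It encodes
  -- both a complex Y with full (d-1)-skeleton (by the d-simplices added to that
  -- skeleton) and a subcomplex K of Y (its d-simplices and all their faces);
  -- K is then a subcomplex of Y exactly when K ⊆ Y, and ∣ K ∣ is f_d(K).
  Complex : Set
  Complex = Subset (length simplices)

  simplex : Fin (length simplices) → Subset n
  simplex = lookup simplices

  -- The faces of the complex K generated by its d-simplices.
  IsFace : Complex → Pred (Subset n) 0ℓ
  IsFace K τ = ∃[ i ] ((i ∈ K) × (τ ⊆ simplex i))

  -- Nonemptiness is part of the definition: the empty set of d-simplices would
  -- otherwise vacuously be a core and be the only minimal one.
  IsCore : Pred Complex 0ℓ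
  IsCore K = Nonempty K ×
    (∀ τ → ∣ τ ∣ ≡ d → IsFace K τ →
      ∃[ i ] ∃[ j ] ((i ≢ j) × (i ∈ K) × (j ∈ K) × (τ ⊆ simplex i) × (τ ⊆ simplex j)))

  IsMinimalCore : Pred Complex 0ℓ
  IsMinimalCore K = IsCore K × (∀ K′ → K′ ⊂ K → ¬ IsCore K′)

  -- ρ is a (d+1)-simplex and its boundary consists of its proper faces.
  ContainsSimplexBoundary : Pred Complex 0ℓ
  ContainsSimplexBoundary K =
    ∃[ ρ ] ((∣ ρ ∣ ≡ suc (suc d)) × (∀ τ → τ ⊂ ρ → IsFace K τ))

  ----------------------------------------------------------------------
  -- The random complex Y_d(n,p)

  weight : ℝ → Complex → ℝ
  weight p Y = p ^ ∣ Y ∣ * (1ℝ - p) ^ ∣ ∁ Y ∣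

  Pr : (p : ℝ) {E : Pred Complex 0ℓ} → Decidable E → ℝ
  Pr p E? = sum (map (weight p) (filter E? (allSubsets (length simplices))))

-- Constructively, an event of a finite probability space is a decidable
-- predicate, so an asymptotically almost sure property is one that is decidable
-- and whose probability, which does not depend on the decision procedure,
-- tends to 1.
AAS : (d : ℕ) → ((n : ℕ) .{{_ : ℕ.NonZero n}} → ℝ) →
      (∀ n → Pred (Complex d n) 0ℓ) → Set
AAS d p E = Σ[ E? ∈ (∀ n → Decidable (E n)) ] Tendsto (λ n → Pr d n (p n) (E? n)) 1ℝ

{-# OPTIONS --safe #-}

-- A union bound over an exploration.  Let S be a proper part of a minimal core K.  Some
-- (d-1)-face τ is free in S, that is, it lies in exactly one simplex of S, and K has a
-- further simplex τ ∪ {v}.  Hence the probability that Y contains one of the cores in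
-- question extending S is at most p^|S| w(S) for every weight w that is at least 1 on
-- these cores and satisfies ∑_v p w(S ∪ {τ ∪ {v}}) ≤ w(S).  The weight decreases
-- exponentially in a potential, essentially the number of free faces, which vanishes on
-- cores and grows in every step in which v is not one of a few special vertices.
--
-- For cores with O(log n) simplices the special vertices are those of S.  Such a step adds
-- no vertex, and it is paid for by a factor of order n/polylog(n) in w, which is available
-- because a core without the boundary of a (d+1)-simplex has fewer vertices than
-- d-simplices.
--
-- For larger cores call a set of fewer than d vertices heavy if a fixed proportion of its
-- extensions by one vertex are heavy, starting from the (d-1)-faces of K.  The family of
-- heavy sets is so small that it can be guessed in advance, and v is special if it turns a
-- light subset of τ into a heavy one.  The choice of δ makes the empty set light, and the
-- (d-1)-faces with two heavy subsets in general position, whose steps gain nothing by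
-- themselves, are rare enough to be counted in the potential.

module Submission where

open import Data.Empty using (⊥-elim)
open import Data.Fin as Fin using (Fin; zero; suc; toℕ)
open import Data.Fin.Subset
  using (Subset; inside; outside; _∈_; _∉_; _⊆_; _⊂_; ∣_∣; Nonempty; ⊥; ⊤; ∁)
open import Data.Fin.Subset.Properties
open import Data.List using (List; []; _∷_; _++_; map; filter; length; lookup; tabulate)
open import Data.Product using (∃; ∃-syntax; Σ-syntax; _×_; _,_; proj₁; proj₂)
open import Data.Sum using (_⊎_; inj₁; inj₂; [_,_]′)
open import Data.Vec as Vec using (Vec; []; _∷_; _[_]≔_; here; there)
open import Function using (_∘_; id)
open import Level using (0ℓ)
open import Relation.Binary.PropositionalEquality
open import Relation.Nullary
open import Relation.Nullary.Decidable
  using (_×-dec_; _⊎-dec_; _→-dec_; ¬?; decidable-stable; map′; toWitness)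
open import Relation.Unary using (Pred; Decidable)

-- One step of the exploration has about n choices at price p each, so it multiplies the expected
-- count by a constant that may exceed 1, and about n^d first simplices are expected. The constants
-- are beaten because the potential ends small: ordinary steps raise it, so up to its final value
-- there are boundedly many of them per special step, and special steps have far fewer than n
-- choices. The first simplices are paid for differently. A large core gains a fixed factor per
-- simplex and has more than (d+1) log n of them. A small core relies on having strictly fewer
-- vertices than simplices. The boundary of a (d+1)-simplex, with d+2 of each, shows that strictness
-- is the point: its expected number stays bounded away from 0. In a large `S` every vertex may be
-- old, so being old no longer singles out few vertices. What must stay rare is that the new simplex
-- shares further (d-1)-faces with `S` or comes closer to doing so, and heavy sets measure this
-- closeness. They are defined from `K` and not from `S`, so that they stay fixed during the
-- exploration and `S ⊆ K` bounds the special vertices at every stage.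

-- Counting by sums of indicators over finite types

module Counting where

  open import Defs using (allSubsets)
  open import Data.Bool using (Bool; true; false; if_then_else_)
  import Data.Bool.Properties as Bool
  import Data.Fin.Properties as Fin
  open import Data.Nat
  open import Data.Nat.Properties
  open import Data.Nat.Solver using (module +-*-Solver)
  import Data.Vec.Properties as Vec
  open import Relation.Binary using (DecidableEquality)

  𝟙 : {P : Set} → Dec P → ℕ
  𝟙 P? = if does P? then 1 else 0

  𝟙-yes : {P : Set} (P? : Dec P) → P → 𝟙 P? ≡ 1
  𝟙-yes (yes _) _ = refl
  𝟙-yes (no ¬p) p = ⊥-elim (¬p p)

  𝟙-no : {P : Set} (P? : Dec P) → ¬ P → 𝟙 P? ≡ 0
  𝟙-no (yes p) ¬p = ⊥-elim (¬p p)
  𝟙-no (no _)  _  = refl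

  𝟙≤ : {P : Set} (P? : Dec P) {m : ℕ} → (P → 1 ≤ m) → 𝟙 P? ≤ m
  𝟙≤ (yes p) h = h p
  𝟙≤ (no _)  _ = z≤n

  𝟙≤1 : {P : Set} (P? : Dec P) → 𝟙 P? ≤ 1
  𝟙≤1 P? = 𝟙≤ P? λ _ → ≤-refl

  1≤𝟙 : {P : Set} (P? : Dec P) → P → 1 ≤ 𝟙 P?
  1≤𝟙 P? p = ≤-reflexive (sym (𝟙-yes P? p))

  𝟙⁻ : {P : Set} (P? : Dec P) → 1 ≤ 𝟙 P? → P
  𝟙⁻ (yes p) _ = p

  𝟙-mono : {P Q : Set} (P? : Dec P) (Q? : Dec Q) → (P → Q) → 𝟙 P? ≤ 𝟙 Q?
  𝟙-mono P? Q? f = 𝟙≤ P? λ p → 1≤𝟙 Q? (f p)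

  𝟙-cong : {P Q : Set} (P? : Dec P) (Q? : Dec Q) → (P → Q) → (Q → P) → 𝟙 P? ≡ 𝟙 Q?
  𝟙-cong P? Q? f g = ≤-antisym (𝟙-mono P? Q? f) (𝟙-mono Q? P? g)

  𝟙-× : {P Q : Set} (P? : Dec P) (Q? : Dec Q) → 𝟙 (P? ×-dec Q?) ≡ 𝟙 P? * 𝟙 Q?
  𝟙-× (yes _) (yes _) = refl
  𝟙-× (yes _) (no _)  = refl
  𝟙-× (no _)  _       = refl

  ∑ᴸ : {A : Set} → List A → (A → ℕ) → ℕ
  ∑ᴸ []       f = 0
  ∑ᴸ (x ∷ xs) f = f x + ∑ᴸ xs f

  ∑ᴸ-mono : {A : Set} (xs : List A) {f g : A → ℕ} → (∀ x → f x ≤ g x) → ∑ᴸ xs f ≤ ∑ᴸ xs g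
  ∑ᴸ-mono []       h = z≤n
  ∑ᴸ-mono (x ∷ xs) h = +-mono-≤ (h x) (∑ᴸ-mono xs h)

  ∑ᴸ-+ : {A : Set} (xs : List A) (f g : A → ℕ) → ∑ᴸ xs (λ x → f x + g x) ≡ ∑ᴸ xs f + ∑ᴸ xs g
  ∑ᴸ-+ []       f g = refl
  ∑ᴸ-+ (x ∷ xs) f g rewrite ∑ᴸ-+ xs f g =
    solve 4 (λ a b c d → (a :+ b) :+ (c :+ d) := (a :+ c) :+ (b :+ d)) refl
      (f x) (g x) (∑ᴸ xs f) (∑ᴸ xs g)
    where open +-*-Solver

  ∑ᴸ-* : ∀ {A : Set} (xs : List A) c (f : A → ℕ) → ∑ᴸ xs (λ x → c * f x) ≡ c * ∑ᴸ xs f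
  ∑ᴸ-* []       c f = sym (*-zeroʳ c)
  ∑ᴸ-* (x ∷ xs) c f rewrite ∑ᴸ-* xs c f = sym (*-distribˡ-+ c (f x) _)

  ∑ᴸ-zero : {A : Set} (xs : List A) → ∑ᴸ xs (λ _ → 0) ≡ 0
  ∑ᴸ-zero []       = refl
  ∑ᴸ-zero (_ ∷ xs) = ∑ᴸ-zero xs

  ∑ᴸ-swap : {A B : Set} (xs : List A) (ys : List B) (f : A → B → ℕ) →
    ∑ᴸ xs (λ x → ∑ᴸ ys (f x)) ≡ ∑ᴸ ys (λ y → ∑ᴸ xs (λ x → f x y))
  ∑ᴸ-swap []       ys f = sym (∑ᴸ-zero ys)
  ∑ᴸ-swap (x ∷ xs) ys f rewrite ∑ᴸ-swap xs ys f = sym (∑ᴸ-+ ys (f x) _)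

  ∑ᴸ-pos : {A : Set} (xs : List A) {f : A → ℕ} → 1 ≤ ∑ᴸ xs f → ∃[ x ] 1 ≤ f x
  ∑ᴸ-pos (x ∷ xs) {f} h with f x in eq
  ... | zero  = ∑ᴸ-pos xs h
  ... | suc _ = x , subst (1 ≤_) (sym eq) (s≤s z≤n)

  ∑ᴸ-++ : {A : Set} (xs ys : List A) (f : A → ℕ) → ∑ᴸ (xs ++ ys) f ≡ ∑ᴸ xs f + ∑ᴸ ys f
  ∑ᴸ-++ []       ys f = refl
  ∑ᴸ-++ (x ∷ xs) ys f rewrite ∑ᴸ-++ xs ys f = sym (+-assoc (f x) _ _)

  ∑ᴸ-map : {A B : Set} (g : A → B) (xs : List A) (f : B → ℕ) → ∑ᴸ (map g xs) f ≡ ∑ᴸ xs (f ∘ g)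
  ∑ᴸ-map g []       f = refl
  ∑ᴸ-map g (x ∷ xs) f = cong (f (g x) +_) (∑ᴸ-map g xs f)

  record Finite (A : Set) : Set where
    field
      elems     : List A
      _==_      : DecidableEquality A
      count-one : ∀ a → ∑ᴸ elems (λ x → 𝟙 (x == a)) ≡ 1

  open Finite {{...}} public

  ∑ : {A : Set} {{_ : Finite A}} → (A → ℕ) → ℕ
  ∑ f = ∑ᴸ elems f

  # : {A : Set} {{_ : Finite A}} {P : Pred A _} → Decidable P → ℕ
  # P? = ∑ (λ x → 𝟙 (P? x))

  module _ {A : Set} {{_ : Finite A}} where

    ∑-mono : {f g : A → ℕ} → (∀ x → f x ≤ g x) → ∑ f ≤ ∑ g
    ∑-mono = ∑ᴸ-mono elems

    ∑-cong : {f g : A → ℕ} → (∀ x → f x ≡ g x) → ∑ f ≡ ∑ g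
    ∑-cong h = ≤-antisym (∑-mono (≤-reflexive ∘ h)) (∑-mono (≤-reflexive ∘ sym ∘ h))

    ∑-+ : (f g : A → ℕ) → ∑ (λ x → f x + g x) ≡ ∑ f + ∑ g
    ∑-+ = ∑ᴸ-+ elems

    ∑-* : ∀ c (f : A → ℕ) → ∑ (λ x → c * f x) ≡ c * ∑ f
    ∑-* = ∑ᴸ-* elems

    ∑-zero : ∑ (λ (_ : A) → 0) ≡ 0
    ∑-zero = ∑ᴸ-zero elems

    ∑-swap : {B : Set} {{_ : Finite B}} (f : A → B → ℕ) →
      ∑ (λ x → ∑ (f x)) ≡ ∑ (λ y → ∑ (λ x → f x y))
    ∑-swap = ∑ᴸ-swap elems elems

    ∑-δ : ∀ a (f : A → ℕ) → ∑ (λ x → 𝟙 (x == a) * f x) ≡ f a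
    ∑-δ a f = begin
      ∑ (λ x → 𝟙 (x == a) * f x) ≡⟨ ∑-cong pointwise ⟩
      ∑ (λ x → f a * 𝟙 (x == a)) ≡⟨ ∑-* (f a) _ ⟩
      f a * ∑ (λ x → 𝟙 (x == a)) ≡⟨ cong (f a *_) (count-one a) ⟩
      f a * 1                    ≡⟨ *-identityʳ (f a) ⟩
      f a                        ∎
      where
      open ≡-Reasoning
      pointwise : ∀ x → 𝟙 (x == a) * f x ≡ f a * 𝟙 (x == a)
      pointwise x with x == a
      ... | yes refl = *-comm 1 (f x)
      ... | no _     = sym (*-zeroʳ (f a))

    ≤∑ : ∀ a (f : A → ℕ) → f a ≤ ∑ f
    ≤∑ a f = ≤-trans (≤-reflexive (sym (∑-δ a f)))
      (∑-mono λ x → ≤-trans (*-monoˡ-≤ (f x) (𝟙≤1 (x == a))) (≤-reflexive (*-identityˡ (f x))))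

    ∑-pos : {f : A → ℕ} → 1 ≤ ∑ f → ∃[ x ] 1 ≤ f x
    ∑-pos = ∑ᴸ-pos elems

    module _ {P : Pred A 0ℓ} (P? : Decidable P) where

      #-pos : ∀ {a} → P a → 1 ≤ # P?
      #-pos {a} p = ≤-trans (1≤𝟙 (P? a) p) (≤∑ a _)

      abstract
        exists? : Dec (∃ P)
        exists? with 1 ≤? # P?
        ... | yes h = let x , q = ∑-pos h in yes (x , 𝟙⁻ (P? x) q)
        ... | no h  = no λ (_ , p) → h (#-pos p)

      #-zero : (∀ x → ¬ P x) → # P? ≡ 0
      #-zero h = trans (∑-cong λ x → 𝟙-no (P? x) (h x)) ∑-zero

      #-unique : (∀ x y → P x → P y → x ≡ y) → # P? ≤ 1
      #-unique h with exists?
      ... | no ∄        = ≤-trans (≤-reflexive (#-zero λ x p → ∄ (x , p))) z≤n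
      ... | yes (a , p) = ≤-trans (∑-mono λ x → 𝟙-mono (P? x) (x == a) λ q → h x a q p)
                            (≤-reflexive (count-one a))

      #-mono : {Q : Pred A _} (Q? : Decidable Q) → (∀ x → P x → Q x) → # P? ≤ # Q?
      #-mono Q? h = ∑-mono λ x → 𝟙-mono (P? x) (Q? x) (h x)

      #-insert : {Q : Pred A _} (Q? : Decidable Q) (a : A) →
        (∀ x → P x → Q x) → Q a → ¬ P a → suc (# P?) ≤ # Q?
      #-insert Q? a h q ¬p = begin
        1 + # P?                            ≡⟨ cong (_+ # P?) (sym (count-one a)) ⟩
        ∑ (λ x → 𝟙 (x == a)) + # P?         ≡⟨ sym (∑-+ _ _) ⟩
        ∑ (λ x → 𝟙 (x == a) + 𝟙 (P? x))     ≤⟨ ∑-mono pointwise ⟩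
        # Q?                                ∎
        where
        open ≤-Reasoning
        pointwise : ∀ x → 𝟙 (x == a) + 𝟙 (P? x) ≤ 𝟙 (Q? x)
        pointwise x with x == a
        ... | yes refl = ≤-trans (≤-reflexive (cong suc (𝟙-no (P? x) ¬p))) (1≤𝟙 (Q? x) q)
        ... | no _     = 𝟙-mono (P? x) (Q? x) (h x)

  -- Double counting of the pairs `(x , g x)`: every `x` with `P` contributes a pair, and
  -- injectivity leaves at most one pair over each `y`.
  #-inj : {A B : Set} {{_ : Finite A}} {{_ : Finite B}} {P : Pred A _} {Q : Pred B _}
    (P? : Decidable P) (Q? : Decidable Q) (g : A → B) → (∀ x → P x → Q (g x)) →
    (∀ x y → P x → P y → g x ≡ g y → x ≡ y) → # P? ≤ # Q?
  #-inj P? Q? g h inj = begin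
    # P?                                         ≤⟨ ∑-mono (λ x → 𝟙≤ (P? x) λ p →
                                                      #-pos (λ y → R? x y) {g x} (p , refl)) ⟩
    ∑ (λ x → ∑ (λ y → 𝟙 (R? x y)))               ≡⟨ ∑-swap (λ x y → 𝟙 (R? x y)) ⟩
    ∑ (λ y → ∑ (λ x → 𝟙 (R? x y)))               ≤⟨ ∑-mono fibre ⟩
    # Q?                                         ∎
    where
    open ≤-Reasoning
    R? : ∀ x y → Dec (_ × g x ≡ y)
    R? x y = P? x ×-dec (g x == y)
    fibre : ∀ y → ∑ (λ x → 𝟙 (R? x y)) ≤ 𝟙 (Q? y)
    fibre y with Q? y
    ... | yes _ = #-unique (λ x → R? x y)
                    λ x x′ (p , e) (p′ , e′) → inj x x′ p p′ (trans e (sym e′))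
    ... | no ¬q = ≤-reflexive (#-zero (λ x → R? x y) λ { x (p , refl) → ¬q (h x p) })

  ∑ᴸ-tabulate : ∀ {A : Set} n (g : Fin n → A) (f : A → ℕ) →
    ∑ᴸ (tabulate g) f ≡ ∑ᴸ (tabulate id) (f ∘ g)
  ∑ᴸ-tabulate zero    g f = refl
  ∑ᴸ-tabulate (suc n) g f = cong (f (g zero) +_)
    (trans (∑ᴸ-tabulate n (g ∘ suc) f) (sym (∑ᴸ-tabulate n suc (f ∘ g))))

  instance
    finite-Fin : ∀ {n} → Finite (Fin n)
    finite-Fin {n} = record
      { elems = tabulate id ; _==_ = Fin._≟_ ; count-one = go n }
      where
      go : ∀ n (a : Fin n) → ∑ᴸ (tabulate id) (λ x → 𝟙 (x Fin.≟ a)) ≡ 1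
      go (suc n) zero    = cong suc (trans (∑ᴸ-tabulate n suc _) (∑ᴸ-zero (tabulate {n = n} id)))
      go (suc n) (suc a) = trans (∑ᴸ-tabulate n suc _)
        (trans (≤-antisym (∑ᴸ-mono (tabulate {n = n} id) λ x → 𝟙-mono (suc x Fin.≟ suc a)
            (x Fin.≟ a) Fin.suc-injective)
                          (∑ᴸ-mono (tabulate {n = n} id) λ x → 𝟙-mono (x Fin.≟ a)
                              (suc x Fin.≟ suc a) (cong suc)))
          (go n a))

  _≟ˢ_ : ∀ {n} → DecidableEquality (Subset n)
  _≟ˢ_ = Vec.≡-dec Bool._≟_

  ∑ᴸ-allSubsets : ∀ n (f : Subset (suc n) → ℕ) →
    ∑ᴸ (allSubsets (suc n)) f
      ≡ ∑ᴸ (allSubsets n) (f ∘ (outside ∷_)) + ∑ᴸ (allSubsets n) (f ∘ (inside ∷_))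
  ∑ᴸ-allSubsets n f = trans (∑ᴸ-++ (map (outside ∷_) (allSubsets n)) _ f)
    (cong₂ _+_ (∑ᴸ-map (outside ∷_) (allSubsets n) f) (∑ᴸ-map (inside ∷_) (allSubsets n) f))

  instance
    finite-Subset : ∀ {n} → Finite (Subset n)
    finite-Subset {n} = record
      { elems = allSubsets n ; _==_ = _≟ˢ_ ; count-one = go n }
      where
      here-eq : ∀ {n} b (a : Subset n) → ∑ᴸ (allSubsets n) (λ x → 𝟙 ((b ∷ x) ≟ˢ (b ∷ a)))
                  ≡ ∑ᴸ (allSubsets n) (λ x → 𝟙 (x ≟ˢ a))
      here-eq {n} b a = ≤-antisym
        (∑ᴸ-mono (allSubsets n) λ x → 𝟙-mono ((b ∷ x) ≟ˢ (b ∷ a)) (x ≟ˢ a) Vec.∷-injectiveʳ)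
        (∑ᴸ-mono (allSubsets n) λ x → 𝟙-mono (x ≟ˢ a) ((b ∷ x) ≟ˢ (b ∷ a)) (cong (b ∷_)))
      there-eq : ∀ {n} b c (a : Subset n) → b ≢ c →
        ∑ᴸ (allSubsets n) (λ x → 𝟙 ((b ∷ x) ≟ˢ (c ∷ a))) ≡ 0
      there-eq {n} b c a b≢c = n≤0⇒n≡0 (≤-trans
        (∑ᴸ-mono (allSubsets n) λ x → 𝟙≤ ((b ∷ x) ≟ˢ (c ∷ a)) {0} λ e → ⊥-elim
            (b≢c (Vec.∷-injectiveˡ e)))
        (≤-reflexive (∑ᴸ-zero (allSubsets n))))
      go : ∀ n (a : Subset n) → ∑ᴸ (allSubsets n) (λ x → 𝟙 (x ≟ˢ a)) ≡ 1
      go zero []             = refl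
      go (suc n) (false ∷ a) = trans (∑ᴸ-allSubsets n _)
        (cong₂ _+_ (trans (here-eq false a) (go n a)) (there-eq true false a λ ()))
      go (suc n) (true ∷ a)  = trans (∑ᴸ-allSubsets n _)
        (cong₂ _+_ (there-eq false true a λ ()) (trans (here-eq true a) (go n a)))

  infixl 6 _⊕_ _⊖_

  _⊕_ _⊖_ : ∀ {n} → Subset n → Fin n → Subset n
  p ⊕ v = p [ v ]≔ inside
  p ⊖ v = p [ v ]≔ outside

  module _ {n : ℕ} {p : Subset n} where

    v∈p⊕v : ∀ {v} → v ∈ p ⊕ v
    v∈p⊕v {v} = Vec.[]≔-updates p v

    p⊆p⊕v : ∀ {v} → p ⊆ p ⊕ v
    p⊆p⊕v {v} {u} u∈p with u Fin.≟ v
    ... | yes refl = v∈p⊕v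
    ... | no u≢v   = Vec.[]≔-minimal p u v u≢v u∈p

    ∈⊕⁻ : ∀ {u v} → u ∈ p ⊕ v → u ≡ v ⊎ u ∈ p
    ∈⊕⁻ {u} {v} h with u Fin.≟ v
    ... | yes u≡v = inj₁ u≡v
    ... | no u≢v  = inj₂ (subst (u ∈_) (trans (Vec.[]≔-idempotent p v) (Vec.[]≔-lookup p v))
                      (Vec.[]≔-minimal (p ⊕ v) u v u≢v h))

    v∉p⊖v : ∀ {v} → v ∉ p ⊖ v
    v∉p⊖v {v} h with trans (sym (Vec.[]=⇒lookup h)) (Vec.[]=⇒lookup (Vec.[]≔-updates {x = outside} p v))
    ... | ()

    p⊖v⊆p : ∀ {v} → p ⊖ v ⊆ p
    p⊖v⊆p {v} {u} h with u Fin.≟ v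
    ... | yes refl = ⊥-elim (v∉p⊖v h)
    ... | no u≢v   = subst (u ∈_) (trans (Vec.[]≔-idempotent p v) (Vec.[]≔-lookup p v))
                      (Vec.[]≔-minimal (p ⊖ v) u v u≢v h)

    ∈⊖⁺ : ∀ {u v} → u ∈ p → u ≢ v → u ∈ p ⊖ v
    ∈⊖⁺ {u} {v} h u≢v = Vec.[]≔-minimal p u v u≢v h

    ∈⊖⇒≢ : ∀ {u v} → u ∈ p ⊖ v → u ≢ v
    ∈⊖⇒≢ h refl = v∉p⊖v h

  ∣p⊕v∣ : ∀ {n} {p : Subset n} {v} → v ∉ p → ∣ p ⊕ v ∣ ≡ suc ∣ p ∣
  ∣p⊕v∣ {p = true ∷ p}  {zero}  h = ⊥-elim (h here)
  ∣p⊕v∣ {p = false ∷ p} {zero}  h = refl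
  ∣p⊕v∣ {p = true ∷ p}  {suc v} h = cong suc (∣p⊕v∣ (h ∘ there))
  ∣p⊕v∣ {p = false ∷ p} {suc v} h = ∣p⊕v∣ (h ∘ there)

  ∣p⊖v∣ : ∀ {n} {p : Subset n} {v} → v ∈ p → suc ∣ p ⊖ v ∣ ≡ ∣ p ∣
  ∣p⊖v∣ {p = true ∷ p}  {zero}  here      = refl
  ∣p⊖v∣ {p = true ∷ p}  {suc v} (there h) = cong suc (∣p⊖v∣ h)
  ∣p⊖v∣ {p = false ∷ p} {suc v} (there h) = ∣p⊖v∣ h

  ⊆-size : ∀ {n} {p q : Subset n} → p ⊆ q → ∣ q ∣ ≤ ∣ p ∣ → p ≡ q
  ⊆-size {p = p} {q} p⊆q q≤p with exists? (λ v → (v ∈? q) ×-dec ¬? (v ∈? p))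
  ... | yes (v , h) = ⊥-elim (≤⇒≯ q≤p (p⊂q⇒∣p∣<∣q∣ (p⊆q , v , h)))
  ... | no ∄        = ⊆-antisym p⊆q λ {v} v∈q → decidable-stable (v ∈? p) λ v∉p → ∄ (v , v∈q , v∉p)

  p⊖v⊕v : ∀ {n} {p : Subset n} {v} → v ∈ p → (p ⊖ v) ⊕ v ≡ p
  p⊖v⊕v {p = p} {v} h = trans (Vec.[]≔-idempotent p v)
    (trans (cong (p [ v ]≔_) (sym (Vec.[]=⇒lookup h))) (Vec.[]≔-lookup p v))

  p⊕v⊖v : ∀ {n} {p : Subset n} {v} → v ∉ p → (p ⊕ v) ⊖ v ≡ p
  p⊕v⊖v {p = p} {v} h = trans (Vec.[]≔-idempotent p v)
    (trans (cong (p [ v ]≔_) (sym lookup≡)) (Vec.[]≔-lookup p v))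
    where
    lookup≡ : Vec.lookup p v ≡ outside
    lookup≡ with Vec.lookup p v in eq
    ... | true  = ⊥-elim (h (Vec.lookup⇒[]= v p eq))
    ... | false = refl

  ∣p∣≡# : ∀ {n} (p : Subset n) → ∣ p ∣ ≡ # (λ v → v ∈? p)
  ∣p∣≡# []              = refl
  ∣p∣≡# {suc n} (b ∷ p) = trans (head b) (cong (𝟙 (zero ∈? (b ∷ p)) +_)
    (trans (∣p∣≡# p) (trans
      (≤-antisym (∑ᴸ-mono (tabulate {n = n} id) λ v → 𝟙-mono (v ∈? p) (suc v ∈? (b ∷ p)) there)
                 (∑ᴸ-mono (tabulate {n = n} id) λ v → 𝟙-mono (suc v ∈? (b ∷ p)) (v ∈? p) λ
                     { (there h) → h }))
      (sym (∑ᴸ-tabulate n suc _)))))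
    where
    head : ∀ b → ∣ b ∷ p ∣ ≡ 𝟙 (zero ∈? (b ∷ p)) + ∣ p ∣
    head true  = refl
    head false = refl

  ∑-allSubsets : ∀ {n} (f : Subset (suc n) → ℕ) → ∑ f ≡ ∑ (f ∘ (outside ∷_)) + ∑ (f ∘ (inside ∷_))
  ∑-allSubsets {n} f = ∑ᴸ-allSubsets n f

-- Vertex degrees in cores and the boundary of a (d+1)-simplex

module Cores where

  open Counting
  open import Defs using (allSubsets; simplices; simplex)
  open import Data.List.Membership.Propositional using () renaming (_∈_ to _∈ᴸ_)
  import Data.List.Membership.Propositional.Properties as ∈ᴸ
  import Data.List.Relation.Unary.Any as Any
  open import Data.List.Relation.Unary.Any.Properties using (lookup-index)
  open import Data.List.Relation.Unary.Unique.Propositional using (Unique)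
  import Data.List.Relation.Unary.Unique.Propositional.Properties as Unique
  import Data.List.Relation.Unary.AllPairs as AllPairs
  import Data.List.Relation.Unary.All as All
  open import Data.Nat
  open import Data.Nat.Properties
  import Data.Vec.Properties as Vec

  ∈-allSubsets : ∀ {n} (p : Subset n) → p ∈ᴸ allSubsets n
  ∈-allSubsets []            = Any.here refl
  ∈-allSubsets (outside ∷ p) = ∈ᴸ.∈-++⁺ˡ (∈ᴸ.∈-map⁺ (outside ∷_) (∈-allSubsets p))
  ∈-allSubsets (inside ∷ p)  =
    ∈ᴸ.∈-++⁺ʳ (map (outside ∷_) (allSubsets _)) (∈ᴸ.∈-map⁺ (inside ∷_) (∈-allSubsets p))

  allSubsets-unique : ∀ n → Unique (allSubsets n)
  allSubsets-unique zero    = All.[] AllPairs.∷ AllPairs.[]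
  allSubsets-unique (suc n) = Unique.++⁺
    (Unique.map⁺ Vec.∷-injectiveʳ (allSubsets-unique n))
    (Unique.map⁺ Vec.∷-injectiveʳ (allSubsets-unique n))
    λ (x∈out , x∈in) → disjoint (∈ᴸ.∈-map⁻ _ x∈out) (∈ᴸ.∈-map⁻ _ x∈in)
    where
    disjoint : ∀ {x} → ∃[ p ] (p ∈ᴸ allSubsets n × x ≡ outside ∷ p) →
               ∃[ q ] (q ∈ᴸ allSubsets n × x ≡ inside ∷ q) → _
    disjoint (_ , _ , refl) (_ , _ , ())

  lookup-injective : ∀ {A : Set} {xs : List A} → Unique xs → ∀ i j → lookup xs i ≡ lookup xs j → i ≡ j
  lookup-injective (_ AllPairs.∷ _)  zero    zero    _  = refl
  lookup-injective (_ AllPairs.∷ u)  (suc i) (suc j) eq = cong suc (lookup-injective u i j eq)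
  lookup-injective (x≢ AllPairs.∷ _) zero    (suc j) eq = ⊥-elim (All.lookup x≢ (∈ᴸ.∈-lookup j) eq)
  lookup-injective (x≢ AllPairs.∷ _) (suc i) zero    eq = ⊥-elim
      (All.lookup x≢ (∈ᴸ.∈-lookup i) (sym eq))

  ∣p∣<∣q∣⇒∃ : ∀ {n} {p q : Subset n} → ∣ p ∣ < ∣ q ∣ → ∃[ v ] (v ∈ q × v ∉ p)
  ∣p∣<∣q∣⇒∃ {p = p} {q} p<q with exists? (λ v → (v ∈? q) ×-dec ¬? (v ∈? p))
  ... | yes h = h
  ... | no ∄  = ⊥-elim (<⇒≱ p<q (p⊆q⇒∣p∣≤∣q∣ λ {v} v∈q →
                  decidable-stable (v ∈? p) λ v∉p → ∄ (v , v∈q , v∉p)))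

  third-element : ∀ {n} (p : Subset n) → 3 ≤ ∣ p ∣ → ∀ a b → ∃[ c ] (c ∈ p × c ≢ a × c ≢ b)
  third-element p 3≤ a b
    with exists? (λ c → (c ∈? p) ×-dec (¬? (c Fin.≟ a) ×-dec ¬? (c Fin.≟ b)))
  ... | yes h = h
  ... | no ∄  = ⊥-elim (<⇒≱ 3≤ (begin
    ∣ p ∣                                     ≡⟨ ∣p∣≡# p ⟩
    ∑ (λ c → 𝟙 (c ∈? p))                      ≤⟨ ∑-mono pointwise ⟩
    ∑ (λ c → 𝟙 (c == a) + 𝟙 (c == b))         ≡⟨ ∑-+ (λ c → 𝟙 (c == a)) (λ c → 𝟙 (c == b)) ⟩
    ∑ (λ c → 𝟙 (c == a)) + ∑ (λ c → 𝟙 (c == b)) ≡⟨ cong₂ _+_ (count-one a) (count-one b) ⟩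
    2 ∎))
    where
    open ≤-Reasoning
    pointwise : ∀ c → 𝟙 (c ∈? p) ≤ 𝟙 (c == a) + 𝟙 (c == b)
    pointwise c = 𝟙≤ (c ∈? p) λ c∈ → one-of c∈ (c Fin.≟ a) (c Fin.≟ b)
      where
      one-of : c ∈ p → (a? : Dec (c ≡ a)) (b? : Dec (c ≡ b)) → 1 ≤ 𝟙 a? + 𝟙 b?
      one-of c∈ (yes _)  _        = s≤s z≤n
      one-of c∈ (no _)   (yes _)  = ≤-refl
      one-of c∈ (no c≢a) (no c≢b) = ⊥-elim (∄ (c , c∈ , c≢a , c≢b))

  ⊕-⊆ : ∀ {n} {p q : Subset n} {v} → p ⊆ q → v ∈ q → p ⊕ v ⊆ q
  ⊕-⊆ p⊆q v∈q h with ∈⊕⁻ h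
  ... | inj₁ refl = v∈q
  ... | inj₂ u∈p  = p⊆q u∈p

  suc-size⇒⊕ : ∀ {n} {p q : Subset n} → p ⊆ q → ∣ q ∣ ≡ suc ∣ p ∣ →
    ∃[ v ] (v ∉ p × q ≡ p ⊕ v)
  suc-size⇒⊕ {p = p} {q} p⊆q eq =
    let v , v∈q , v∉p = ∣p∣<∣q∣⇒∃ {p = p} {q} (≤-reflexive (sym eq))
    in v , v∉p , sym (⊆-size (⊕-⊆ p⊆q v∈q) (≤-reflexive (trans eq (sym (∣p⊕v∣ v∉p)))))

  module _ {d n : ℕ} where

    ∣simplex∣ : ∀ i → ∣ simplex d n i ∣ ≡ suc d
    ∣simplex∣ i = proj₂ (∈ᴸ.∈-filter⁻ (λ p → ∣ p ∣ ≟ suc d) {xs = allSubsets n}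
      (∈ᴸ.∈-lookup {xs = simplices d n} i))

    simplex-injective : ∀ {i j} → simplex d n i ≡ simplex d n j → i ≡ j
    simplex-injective {i} {j} = lookup-injective
      (Unique.filter⁺ (λ p → ∣ p ∣ ≟ suc d) (allSubsets-unique n)) i j

    simplex-surjective : ∀ {p} → ∣ p ∣ ≡ suc d → ∃[ i ] simplex d n i ≡ p
    simplex-surjective {p} eq = Any.index p∈ , sym (lookup-index p∈)
      where
      p∈ : p ∈ᴸ simplices d n
      p∈ = ∈ᴸ.∈-filter⁺ (λ p → ∣ p ∣ ≟ suc d) (∈-allSubsets p) eq

  module Simplices (d n N : ℕ) (σ : Fin N → Subset n) (∣simplex∣ : ∀ i → ∣ σ i ∣ ≡ suc d)
    (simplex-injective : ∀ {i j} → σ i ≡ σ j → i ≡ j)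
    (simplex-surjective : ∀ {p} → ∣ p ∣ ≡ suc d → ∃[ i ] σ i ≡ p) where

    Face : Subset N → Pred (Subset n) _
    Face K τ = ∃[ i ] (i ∈ K × τ ⊆ σ i)

    Core : Pred (Subset N) _
    Core K = Nonempty K × (∀ τ → ∣ τ ∣ ≡ d → Face K τ →
      ∃[ i ] ∃[ j ] (i ≢ j × i ∈ K × j ∈ K × τ ⊆ σ i × τ ⊆ σ j))

    MinimalCore : Pred (Subset N) _
    MinimalCore K = Core K × (∀ K′ → K′ ⊂ K → ¬ Core K′)

    Boundary : Pred (Subset N) _
    Boundary K = ∃[ ρ ] (∣ ρ ∣ ≡ suc (suc d) × (∀ τ → τ ⊂ ρ → Face K τ))

    star? : ∀ K v → Decidable (λ i → i ∈ K × v ∈ σ i)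
    star? K v i = (i ∈? K) ×-dec (v ∈? σ i)

    vertex? : ∀ K → Decidable (λ v → ∃[ i ] (i ∈ K × v ∈ σ i))
    vertex? K v = exists? (star? K v)

    vertices : Subset N → ℕ
    vertices K = # (vertex? K)

    ∑-star : ∀ K → ∑ (λ v → # (star? K v)) ≡ suc d * ∣ K ∣
    ∑-star K = begin
      ∑ (λ v → # (star? K v))
        ≡⟨ ∑-swap (λ v i → 𝟙 (star? K v i)) ⟩
      ∑ (λ i → ∑ (λ v → 𝟙 (star? K v i)))
        ≡⟨ ∑-cong (λ i → trans (∑-cong λ v → 𝟙-× (i ∈? K) (v ∈? σ i))
            (∑-* (𝟙 (i ∈? K)) (λ v → 𝟙 (v ∈? σ i)))) ⟩
      ∑ (λ i → 𝟙 (i ∈? K) * # (_∈? σ i))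
        ≡⟨ ∑-cong (λ i → trans (cong (𝟙 (i ∈? K) *_) (trans (sym (∣p∣≡# (σ i))) (∣simplex∣ i)))
                               (*-comm (𝟙 (i ∈? K)) (suc d))) ⟩
      ∑ (λ i → suc d * 𝟙 (i ∈? K))
        ≡⟨ ∑-* (suc d) (λ i → 𝟙 (i ∈? K)) ⟩
      suc d * # (_∈? K)
        ≡⟨ cong (suc d *_) (sym (∣p∣≡# K)) ⟩
      suc d * ∣ K ∣ ∎
      where open ≡-Reasoning

    core-other : ∀ {K} → Core K → ∀ {i τ} → i ∈ K → ∣ τ ∣ ≡ d → τ ⊆ σ i →
      ∃[ j ] (j ∈ K × j ≢ i × τ ⊆ σ j)
    core-other (_ , core) {i} {τ} i∈K ∣τ∣ τ⊆ with core τ ∣τ∣ (i , i∈K , τ⊆)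
    ... | j , k , j≢k , j∈K , k∈K , τ⊆j , τ⊆k with j Fin.≟ i
    ...   | yes refl = k , k∈K , j≢k ∘ sym , τ⊆k
    ...   | no j≢i   = j , j∈K , j≢i , τ⊆j

    -- The facet of `σ i` opposite `u` lies in a second simplex of `K`. Its remaining vertex cannot
    -- belong to `σ i`, since exchanging `u` for such a vertex would give back `σ i`.
    core-neighbour : ∀ {K} → Core K → ∀ {i u} → i ∈ K → u ∈ σ i →
      ∃[ j ] ∃[ z ] (j ∈ K × z ∉ σ i × σ j ≡ (σ i ⊖ u) ⊕ z)
    core-neighbour core {i} {u} i∈K u∈ =
      let ∣τ∣ = suc-injective (trans (∣p⊖v∣ u∈) (∣simplex∣ i))
          j , j∈K , j≢i , τ⊆ = core-other core i∈K ∣τ∣ p⊖v⊆p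
          z , z∉τ , eq = suc-size⇒⊕ τ⊆ (trans (∣simplex∣ j) (cong suc (sym ∣τ∣)))
          z∉ : z ∉ σ i
          z∉ = λ z∈ → j≢i (simplex-injective (sym (⊆-size
            (λ {w} w∈ → case-u w w∈ z∈ z∉τ eq)
            (≤-reflexive (trans (∣simplex∣ j) (sym (∣simplex∣ i)))))))
      in j , z , j∈K , z∉ , eq
      where
      case-u : ∀ {j z} w → w ∈ σ i → z ∈ σ i → z ∉ σ i ⊖ u → σ j ≡ (σ i ⊖ u) ⊕ z → w ∈ σ j
      case-u {j} {z} w w∈ z∈ z∉τ eq with w Fin.≟ u | z Fin.≟ u
      ... | yes refl | yes refl = subst (w ∈_) (sym eq) v∈p⊕v
      ... | no w≢u   | _        = subst (w ∈_) (sym eq) (p⊆p⊕v (∈⊖⁺ w∈ w≢u))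
      ... | _        | no z≢u   = ⊥-elim (z∉τ (∈⊖⁺ z∈ z≢u))

    module Star {K} (core : Core K) {i₀} (i₀∈K : i₀ ∈ K) {v} (v∈ : v ∈ σ i₀) where

      private
        -- Simplices at `v` are indexed by the vertices of `σ i₀`: `v` stands for `i₀` itself, any
        -- other `u` for the neighbour across the facet opposite `u`. For `u ≢ v` that neighbour
        -- omits `u` and keeps the rest of `σ i₀`, which makes the indexing injective.
        Spec : Fin n → Fin N × Fin n → Set
        Spec u (j , z) = (u ≡ v × j ≡ i₀) ⊎ (u ≢ v × j ∈ K × z ∉ σ i₀ × σ j ≡ (σ i₀ ⊖ u) ⊕ z)

        abstract
          pick : ∀ u → ∃[ jz ] (u ∈ σ i₀ → Spec u jz)
          pick u with u Fin.≟ v | u ∈? σ i₀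
          ... | yes u≡v | _      = (i₀ , u) , λ _ → inj₁ (u≡v , refl)
          ... | no _    | no u∉  = (i₀ , u) , λ u∈ → ⊥-elim (u∉ u∈)
          ... | no u≢v  | yes u∈ = let j , z , p = core-neighbour core i₀∈K u∈
                                   in (j , z) , λ _ → inj₂ (u≢v , p)

        g : Fin n → Fin N
        g u = proj₁ (proj₁ (pick u))

        ζ : Fin n → Fin n
        ζ u = proj₂ (proj₁ (pick u))

        spec : ∀ {u} → u ∈ σ i₀ → Spec u (g u , ζ u)
        spec {u} = proj₂ (pick u)

        u∉g : ∀ {u} → u ∈ σ i₀ → u ≢ v → u ∉ σ (g u)
        u∉g u∈ u≢v h with spec u∈
        ... | inj₁ (u≡v , _) = u≢v u≡v
        ... | inj₂ (_ , _ , z∉ , eq) with ∈⊕⁻ (subst (_ ∈_) eq h)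
        ...   | inj₁ u≡ζ = z∉ (subst (_∈ σ i₀) u≡ζ u∈)
        ...   | inj₂ h′   = v∉p⊖v h′

        g∋ : ∀ {u w} → u ∈ σ i₀ → w ∈ σ i₀ → w ≢ u → w ∈ σ (g u)
        g∋ u∈ w∈ w≢u with spec u∈
        ... | inj₁ (_ , g≡i₀)       = subst (λ j → _ ∈ σ j) (sym g≡i₀) w∈
        ... | inj₂ (_ , _ , _ , eq) = subst (_ ∈_) (sym eq) (p⊆p⊕v (∈⊖⁺ w∈ w≢u))

        g-star : ∀ u → u ∈ σ i₀ → g u ∈ K × v ∈ σ (g u)
        g-star u u∈ with spec u∈
        ... | inj₁ (_ , g≡i₀)           =
                subst (_∈ K) (sym g≡i₀) i₀∈K , subst (λ j → v ∈ σ j) (sym g≡i₀) v∈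
        ... | inj₂ (u≢v , g∈K , _ , eq) =
                g∈K , subst (v ∈_) (sym eq) (p⊆p⊕v (∈⊖⁺ v∈ (u≢v ∘ sym)))

        g-injective : ∀ u w → u ∈ σ i₀ → w ∈ σ i₀ → g u ≡ g w → u ≡ w
        g-injective u w u∈ w∈ eq with u Fin.≟ w | u Fin.≟ v
        ... | yes u≡w | _       = u≡w
        ... | no u≢w  | no u≢v  = ⊥-elim (u∉g u∈ u≢v (subst (λ j → u ∈ σ j) (sym eq) (g∋ w∈ u∈ u≢w)))
        ... | no u≢w  | yes u≡v = ⊥-elim (u∉g w∈ (λ w≡v → u≢w (trans u≡v (sym w≡v)))
                                    (subst (λ j → w ∈ σ j) eq (g∋ u∈ w∈ (u≢w ∘ sym))))

        ∣σ∣≡# : # (_∈? σ i₀) ≡ suc d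
        ∣σ∣≡# = trans (sym (∣p∣≡# (σ i₀))) (∣simplex∣ i₀)

      degree≥ : suc d ≤ # (star? K v)
      degree≥ = subst (_≤ # (star? K v)) ∣σ∣≡#
        (#-inj (_∈? σ i₀) (star? K v) g g-star λ u w → g-injective u w)

      private
        extra : ∀ {j} → j ∈ K → v ∈ σ j → (∀ u → u ∈ σ i₀ → g u ≢ j) → suc (suc d) ≤ # (star? K v)
        extra {j} j∈K v∈j g≢j = ≤-trans
          (s≤s (subst (_≤ # star′?) ∣σ∣≡#
            (#-inj (_∈? σ i₀) star′? g (λ u u∈ → g-star u u∈ , g≢j u u∈) λ u w → g-injective u w)))
          (#-insert star′? (star? K v) j (λ _ → proj₁) (j∈K , v∈j) λ (_ , j≢j) → j≢j refl)
          where
          star′? : Decidable (λ i → (i ∈ K × v ∈ σ i) × i ≢ j)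
          star′? i = star? K v i ×-dec ¬? (i Fin.≟ j)

      module _ (few : # (star? K v) ≤ suc d) where

        private
          in-image : ∀ {j} → j ∈ K → v ∈ σ j → ∃[ u ] (u ∈ σ i₀ × g u ≡ j)
          in-image {j} j∈K v∈j with exists? (λ u → (u ∈? σ i₀) ×-dec (g u Fin.≟ j))
          ... | yes h = h
          ... | no ∄  = ⊥-elim (1+n≰n (≤-trans (extra j∈K v∈j λ u u∈ eq → ∄ (u , u∈ , eq)) few))

          -- The face `ρ` of `g u` lies in a second simplex of `K`, which contains `v` and is
          -- therefore some `g x`. It contains `z`, so `x` is not `v`. As `g x` omits `x`, the
          -- vertex `x` is not in `ρ` either, and only `x ≡ w` remains.
          ζ-constant : ∀ {u w} → u ∈ σ i₀ → u ≢ v → w ∈ σ i₀ → w ≢ v → ζ u ≡ ζ w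
          ζ-constant {u} {w} u∈ u≢v w∈ w≢v with u Fin.≟ w | spec u∈
          ... | yes refl | _              = refl
          ... | no _     | inj₁ (u≡v , _) = ⊥-elim (u≢v u≡v)
          ... | no u≢w   | inj₂ (_ , g∈K , z∉ , eq) = done (in-image j∈K (ρ⊆j v∈ρ))
            where
            z = ζ u
            w∈′ : w ∈ σ i₀ ⊖ u
            w∈′ = ∈⊖⁺ w∈ (u≢w ∘ sym)
            ρ : Subset n
            ρ = (σ i₀ ⊖ u ⊖ w) ⊕ z
            v∈ρ : v ∈ ρ
            v∈ρ = p⊆p⊕v (∈⊖⁺ (∈⊖⁺ v∈ (u≢v ∘ sym)) (w≢v ∘ sym))
            ∣ρ∣ : ∣ ρ ∣ ≡ d
            ∣ρ∣ = trans (∣p⊕v∣ (λ h → z∉ (p⊖v⊆p (p⊖v⊆p h))))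
              (trans (∣p⊖v∣ w∈′) (suc-injective (trans (∣p⊖v∣ u∈) (∣simplex∣ i₀))))
            ρ⊆ : ρ ⊆ σ (g u)
            ρ⊆ = subst (ρ ⊆_) (sym eq) (⊕-⊆ (p⊆p⊕v ∘ p⊖v⊆p) v∈p⊕v)
            other = core-other core g∈K ∣ρ∣ ρ⊆
            j = proj₁ other
            j∈K = proj₁ (proj₂ other)
            j≢g = proj₁ (proj₂ (proj₂ other))
            ρ⊆j : ρ ⊆ σ j
            ρ⊆j = proj₂ (proj₂ (proj₂ other))
            done : ∃[ x ] (x ∈ σ i₀ × g x ≡ j) → z ≡ ζ w
            done (x , x∈ , gx≡j) with x Fin.≟ u | x Fin.≟ v | x Fin.≟ w
            ... | yes refl | _ | _ = ⊥-elim (j≢g (sym gx≡j))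
            ... | no _ | yes x≡v | _ with spec x∈
            ...   | inj₁ (_ , gx≡i₀) = ⊥-elim (z∉ (subst (λ k → z ∈ σ k) (trans (sym gx≡j) gx≡i₀) (ρ⊆j v∈p⊕v)))
            ...   | inj₂ (x≢v , _)   = ⊥-elim (x≢v x≡v)
            done (x , x∈ , gx≡j) | no x≢u | no x≢v | no x≢w = ⊥-elim (u∉g x∈ x≢v
              (subst (λ k → x ∈ σ k) (sym gx≡j) (ρ⊆j (p⊆p⊕v (∈⊖⁺ (∈⊖⁺ x∈ x≢u) x≢w)))))
            done (x , x∈ , gx≡j) | no _ | no x≢v | yes refl with spec x∈
            ... | inj₁ (x≡v , _) = ⊥-elim (x≢v x≡v)
            ... | inj₂ (_ , _ , _ , eqx) with ∈⊕⁻ (subst (z ∈_) eqx (subst (λ k → z ∈ σ k) (sym gx≡j) (ρ⊆j v∈p⊕v)))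
            ...   | inj₁ z≡ζ = z≡ζ
            ...   | inj₂ h   = ⊥-elim (z∉ (p⊖v⊆p h))

        -- A vertex of the least possible degree d + 1 has the boundary of a
        -- d-simplex as its link.
        apex : ∀ {u₀} → u₀ ∈ σ i₀ → u₀ ≢ v → ∃[ z ] (z ∉ σ i₀ ×
          (∀ {u} → u ∈ σ i₀ → u ≢ v → ∃[ j ] (j ∈ K × σ j ≡ (σ i₀ ⊖ u) ⊕ z)) ×
          (∀ {j} → j ∈ K → v ∈ σ j → j ≡ i₀ ⊎ z ∈ σ j))
        apex {u₀} u₀∈ u₀≢v = ζ u₀ , z∉ , facets , only
          where
          z∉ : ζ u₀ ∉ σ i₀
          z∉ with spec u₀∈
          ... | inj₁ (u≡v , _)        = ⊥-elim (u₀≢v u≡v)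
          ... | inj₂ (_ , _ , z∉ , _) = z∉
          facets : ∀ {u} → u ∈ σ i₀ → u ≢ v → ∃[ j ] (j ∈ K × σ j ≡ (σ i₀ ⊖ u) ⊕ ζ u₀)
          facets {u} u∈ u≢v with spec u∈
          ... | inj₁ (u≡v , _)           = ⊥-elim (u≢v u≡v)
          ... | inj₂ (_ , g∈K , _ , eq) = g u , g∈K ,
                  trans eq (cong ((σ i₀ ⊖ u) ⊕_) (ζ-constant u∈ u≢v u₀∈ u₀≢v))
          only : ∀ {j} → j ∈ K → v ∈ σ j → j ≡ i₀ ⊎ ζ u₀ ∈ σ j
          only j∈K v∈j with in-image j∈K v∈j
          ... | u , u∈ , gu≡j with spec u∈
          ...   | inj₁ (_ , g≡i₀)         = inj₁ (trans (sym gu≡j) g≡i₀)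
          ...   | inj₂ (u≢v , _ , _ , eq) = inj₂ (subst (λ k → ζ u₀ ∈ σ k) gu≡j
                    (subst (ζ u₀ ∈_) (sym eq)
                      (subst (_∈ _) (ζ-constant u∈ u≢v u₀∈ u₀≢v) v∈p⊕v)))

    -- The link of `v₀` provides an apex `z` and every facet of `σ i₀ ⊕ z` except those opposite `z`
    -- and `v₀`. The first is `σ i₀` itself, the second comes from the link of `v₁`. The two apexes
    -- agree because the facet opposite `u`, found in the link of `v₁`, also contains `v₀`.
    low-degree⇒boundary : ∀ {K} → Core K → ∀ {i₀} → i₀ ∈ K →
      (∀ v → v ∈ σ i₀ → # (star? K v) ≤ suc d) →
      ∀ {v₀ v₁ u} → v₀ ∈ σ i₀ → v₁ ∈ σ i₀ → u ∈ σ i₀ → v₁ ≢ v₀ → u ≢ v₀ → u ≢ v₁ → Boundary K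
    low-degree⇒boundary {K} core {i₀} i₀∈K few {v₀} {v₁} {u} v₀∈ v₁∈ u∈ v₁≢v₀ u≢v₀ u≢v₁
      with Star.apex core i₀∈K v₀∈ (few v₀ v₀∈) u∈ u≢v₀
         | Star.apex core i₀∈K v₁∈ (few v₁ v₁∈) u∈ u≢v₁
    ... | z , z∉ , facets , only | z′ , z′∉ , facets′ , _ =
          ρ , trans (∣p⊕v∣ z∉) (cong suc (∣simplex∣ i₀)) , faces
      where
      z′≡z : z′ ≡ z
      z′≡z with facets′ u∈ u≢v₁
      ... | j , j∈K , eq with only j∈K (subst (v₀ ∈_) (sym eq) (p⊆p⊕v (∈⊖⁺ v₀∈ (u≢v₀ ∘ sym))))
      ...   | inj₁ refl = ⊥-elim (z′∉ (subst (z′ ∈_) (sym eq) v∈p⊕v))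
      ...   | inj₂ z∈j with ∈⊕⁻ (subst (z ∈_) eq z∈j)
      ...     | inj₁ z≡z′ = sym z≡z′
      ...     | inj₂ h    = ⊥-elim (z∉ (p⊖v⊆p h))
      ρ = σ i₀ ⊕ z
      facet : ∀ {w} → w ∈ σ i₀ → ∃[ j ] (j ∈ K × σ j ≡ (σ i₀ ⊖ w) ⊕ z)
      facet {w} w∈ with w Fin.≟ v₀
      ... | no w≢v₀  = facets w∈ w≢v₀
      ... | yes refl = let j , j∈K , eq = facets′ w∈ (v₁≢v₀ ∘ sym)
                       in j , j∈K , trans eq (cong ((σ i₀ ⊖ w) ⊕_) z′≡z)
      faces : ∀ τ → τ ⊂ ρ → Face K τ
      faces τ (τ⊆ρ , w , w∈ρ , w∉τ) with ∈⊕⁻ w∈ρ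
      ... | inj₁ refl = i₀ , i₀∈K , λ {x} x∈τ → [ (λ { refl → ⊥-elim (w∉τ x∈τ) }) , id ]′ (∈⊕⁻ (τ⊆ρ x∈τ))
      ... | inj₂ w∈ with facet w∈
      ...   | j , j∈K , eq = j , j∈K , λ {x} x∈τ → subst (x ∈_) (sym eq)
                ([ (λ { refl → v∈p⊕v }) , (λ x∈ → p⊆p⊕v (∈⊖⁺ x∈ λ { refl → w∉τ x∈τ })) ]′
                    (∈⊕⁻ (τ⊆ρ x∈τ)))

    -- Incidences between vertices and simplices are counted. Every vertex has degree at least d +
    -- 1, and without a boundary some vertex of `σ i₀` has degree at least d + 2, which makes the
    -- inequality strict.
    core-vertices : 2 ≤ d → ∀ {K} → Core K → ¬ Boundary K →
      vertices K < ∣ K ∣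
    core-vertices 2≤d {K} core@((i₀ , i₀∈K) , _) ¬boundary
      with exists? (λ v → (v ∈? σ i₀) ×-dec (suc (suc d) ≤? # (star? K v)))
    -- Here `2 ≤ d` supplies the third vertex of `σ i₀` that identifies the two apexes.
    ... | no ∄ = ⊥-elim (¬boundary
      (let 3≤ = subst (3 ≤_) (sym (∣simplex∣ i₀)) (s≤s 2≤d)
           v₀ , v₀∈ = first
           v₁ , v₁∈ , v₁≢v₀ , _ = third-element (σ i₀) 3≤ v₀ v₀
           u , u∈ , u≢v₀ , u≢v₁ = third-element (σ i₀) 3≤ v₀ v₁
       in low-degree⇒boundary core i₀∈K
            (λ v v∈ → s≤s⁻¹ (≰⇒> λ h → ∄ (v , v∈ , h))) v₀∈ v₁∈ u∈ v₁≢v₀ u≢v₀ u≢v₁))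
      where
      first : ∃[ v ] v ∈ σ i₀
      first = let v , p = ∑-pos {f = λ v → 𝟙 (v ∈? σ i₀)}
                    (subst (1 ≤_) (∣p∣≡# (σ i₀)) (subst (1 ≤_) (sym (∣simplex∣ i₀)) (s≤s z≤n)))
              in v , 𝟙⁻ (v ∈? σ i₀) p
    ... | yes (v* , v*∈ , high) = *-cancelˡ-< (suc d) (vertices K) ∣ K ∣ (begin
      suc (suc d * # (vertex? K))
        ≡⟨ cong₂ _+_ (sym (count-one v*)) (sym (∑-* (suc d) (λ v → 𝟙 (vertex? K v)))) ⟩
      ∑ (λ v → 𝟙 (v == v*)) + ∑ (λ v → suc d * 𝟙 (vertex? K v))
        ≡⟨ sym (∑-+ (λ v → 𝟙 (v == v*)) (λ v → suc d * 𝟙 (vertex? K v))) ⟩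
      ∑ (λ v → 𝟙 (v == v*) + suc d * 𝟙 (vertex? K v))
        ≤⟨ ∑-mono pointwise ⟩
      ∑ (λ v → # (star? K v))
        ≡⟨ ∑-star K ⟩
      suc d * ∣ K ∣ ∎)
      where
      open ≤-Reasoning
      pointwise : ∀ v → 𝟙 (v == v*) + suc d * 𝟙 (vertex? K v) ≤ # (star? K v)
      pointwise v with v == v* | vertex? K v
      ... | yes refl | yes _ = subst (_≤ # (star? K v)) (cong suc (sym (*-identityʳ (suc d)))) high
      ... | yes refl | no ¬v = ⊥-elim (¬v (i₀ , i₀∈K , v*∈))
      ... | no _ | yes (i , i∈K , v∈) = subst (_≤ # (star? K v)) (sym (*-identityʳ (suc d)))
                                          (Star.degree≥ core i∈K v∈)
      ... | no _ | no _ = subst (_≤ # (star? K v)) (sym (*-zeroʳ (suc d))) z≤n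

-- Dyadic bounds and outer probability of a random subset

module OuterProbability where

  open import Data.List.Relation.Unary.Any as Any using (Any; here; there)
  open import Data.Nat as ℕ using (ℕ; zero; suc)
  import Data.Nat.Properties as ℕ
  import Data.Nat.Solver as ℕ
  open import Data.Rational as ℚ using (ℚ; 0ℚ; 1ℚ; ½; _+_; _*_; _-_; -_; _≤_)
  open import Data.Rational.Properties as ℚ
  open import Data.Rational.Solver using (module +-*-Solver)
  open import Algebra.Bundles using (CommutativeRing)
  open import Algebra.Properties.Semiring.Exp (CommutativeRing.semiring +-*-commutativeRing)
    using (_^_; ^-homo-*)

  *-monoˡ : ∀ {r p q} → 0ℚ ≤ r → p ≤ q → r * p ≤ r * q
  *-monoˡ {r} 0≤r = *-monoˡ-≤-nonNeg r {{ℚ.nonNegative 0≤r}}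

  *-monoʳ : ∀ {r p q} → 0ℚ ≤ r → p ≤ q → p * r ≤ q * r
  *-monoʳ {r} 0≤r = *-monoʳ-≤-nonNeg r {{ℚ.nonNegative 0≤r}}

  *-nonNeg : ∀ {p q} → 0ℚ ≤ p → 0ℚ ≤ q → 0ℚ ≤ p * q
  *-nonNeg {p} {q} 0≤p 0≤q = subst (_≤ p * q) (*-zeroʳ p) (*-monoˡ 0≤p 0≤q)

  *-mono : ∀ {p q r s} → 0ℚ ≤ p → 0ℚ ≤ s → p ≤ q → r ≤ s → p * r ≤ q * s
  *-mono 0≤p 0≤s p≤q r≤s = ≤-trans (*-monoˡ 0≤p r≤s) (*-monoʳ 0≤s p≤q)

  +-nonNeg : ∀ {p q} → 0ℚ ≤ p → 0ℚ ≤ q → 0ℚ ≤ p + q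
  +-nonNeg {p} {q} 0≤p 0≤q = subst (_≤ p + q) (+-identityʳ 0ℚ) (+-mono-≤ 0≤p 0≤q)

  0≤1 : 0ℚ ≤ 1ℚ
  0≤1 = nonNegative⁻¹ 1ℚ

  ^-nonNeg : ∀ {q} k → 0ℚ ≤ q → 0ℚ ≤ q ^ k
  ^-nonNeg zero    _   = 0≤1
  ^-nonNeg (suc k) 0≤q = *-nonNeg 0≤q (^-nonNeg k 0≤q)

  p≤q⇒0≤q-p : ∀ {p q} → p ≤ q → 0ℚ ≤ q - p
  p≤q⇒0≤q-p {p} {q} h = subst (_≤ q - p) (+-inverseʳ p) (+-monoˡ-≤ (- p) h)

  2ℚ : ℚ
  2ℚ = 1ℚ + 1ℚ

  -- All weights are powers of two. A separate exponent for the denominator keeps exponents natural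
  -- and turns comparisons of weights into linear inequalities.
  dyadic : ℕ → ℕ → ℚ
  dyadic a b = 2ℚ ^ a * ½ ^ b

  dyadic-nonNeg : ∀ a b → 0ℚ ≤ dyadic a b
  dyadic-nonNeg a b = *-nonNeg (^-nonNeg a (nonNegative⁻¹ 2ℚ)) (^-nonNeg b (nonNegative⁻¹ ½))

  dyadic-* : ∀ a b a′ b′ → dyadic a b * dyadic a′ b′ ≡ dyadic (a ℕ.+ a′) (b ℕ.+ b′)
  dyadic-* a b a′ b′ = trans
    (solve 4 (λ x y z w → (x :* y) :* (z :* w) := (x :* z) :* (y :* w)) refl
      (2ℚ ^ a) (½ ^ b) (2ℚ ^ a′) (½ ^ b′))
    (cong₂ _*_ (sym (^-homo-* 2ℚ a a′)) (sym (^-homo-* ½ b b′)))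
    where open +-*-Solver

  dyadic-diag : ∀ k → dyadic k k ≡ 1ℚ
  dyadic-diag zero    = refl
  dyadic-diag (suc k) = trans (sym (dyadic-* 1 1 k k)) (trans (*-identityˡ (dyadic k k))
      (dyadic-diag k))

  dyadic-shift : ∀ a b k → dyadic (a ℕ.+ k) (b ℕ.+ k) ≡ dyadic a b
  dyadic-shift a b k = trans (sym (dyadic-* a b k k))
    (trans (cong (dyadic a b *_) (dyadic-diag k)) (*-identityʳ (dyadic a b)))

  2^-mono : ∀ {a a′} → a ℕ.≤ a′ → 2ℚ ^ a ≤ 2ℚ ^ a′
  2^-mono {a} {a′} h = subst₂ _≤_ (*-identityʳ (2ℚ ^ a))
      (trans (sym (^-homo-* 2ℚ a (a′ ℕ.∸ a))) (cong (2ℚ ^_) (ℕ.m+[n∸m]≡n h)))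
    (*-monoˡ (^-nonNeg a (nonNegative⁻¹ 2ℚ)) (1≤2^ (a′ ℕ.∸ a)))
    where
    1≤2^ : ∀ k → 1ℚ ≤ 2ℚ ^ k
    1≤2^ zero    = ≤-refl
    1≤2^ (suc k) = ≤-trans (1≤2^ k) (subst (_≤ 2ℚ ^ suc k) (*-identityˡ (2ℚ ^ k))
      (*-monoʳ (^-nonNeg k (nonNegative⁻¹ 2ℚ)) (toWitness {a? = 1ℚ ℚ.≤? 2ℚ} _)))

  dyadic-mono : ∀ {a b a′ b′} → a ℕ.+ b′ ℕ.≤ a′ ℕ.+ b → dyadic a b ≤ dyadic a′ b′
  dyadic-mono {a} {b} {a′} {b′} h = begin
    dyadic a b                       ≡⟨ sym (dyadic-shift a b b′) ⟩
    dyadic (a ℕ.+ b′) (b ℕ.+ b′)     ≤⟨ *-monoʳ (^-nonNeg (b ℕ.+ b′) (nonNegative⁻¹ ½)) (2^-mono h) ⟩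
    dyadic (a′ ℕ.+ b) (b ℕ.+ b′)     ≡⟨ cong (dyadic (a′ ℕ.+ b)) (ℕ.+-comm b b′) ⟩
    dyadic (a′ ℕ.+ b) (b′ ℕ.+ b)     ≡⟨ dyadic-shift a′ b′ b ⟩
    dyadic a′ b′                     ∎
    where open ≤-Reasoning

  dyadic-halves : ∀ a b → dyadic a (suc b) + dyadic a (suc b) ≡ dyadic a b
  dyadic-halves a b = begin
    dyadic a (suc b) + dyadic a (suc b) ≡⟨ solve 3 (λ x y h → x :* (h :* y) :+ x :* (h :* y) :=
        (h :+ h) :* (x :* y)) refl
                                             (2ℚ ^ a) (½ ^ b) ½ ⟩
    (½ + ½) * dyadic a b                ≡⟨ *-identityˡ (dyadic a b) ⟩
    dyadic a b                          ∎
    where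
    open ≡-Reasoning
    open +-*-Solver

  ι : ℕ → ℚ
  ι zero    = 0ℚ
  ι (suc k) = 1ℚ + ι k

  ι-+ : ∀ m k → ι (m ℕ.+ k) ≡ ι m + ι k
  ι-+ zero    k = sym (+-identityˡ (ι k))
  ι-+ (suc m) k = trans (cong (1ℚ +_) (ι-+ m k)) (sym (+-assoc 1ℚ (ι m) (ι k)))

  0≤ι : ∀ k → 0ℚ ≤ ι k
  0≤ι zero    = ≤-refl
  0≤ι (suc k) = +-nonNeg 0≤1 (0≤ι k)

  ι-mono : ∀ {m k} → m ℕ.≤ k → ι m ≤ ι k
  ι-mono {m} {k} h = subst₂ _≤_ (+-identityʳ (ι m)) (trans (sym (ι-+ m (k ℕ.∸ m)))
      (cong ι (ℕ.m+[n∸m]≡n h)))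
    (+-monoʳ-≤ (ι m) (0≤ι (k ℕ.∸ m)))

  ι-2^ : ∀ k → ι (2 ℕ.^ k) ≡ 2ℚ ^ k
  ι-2^ zero    = +-identityʳ 1ℚ
  ι-2^ (suc k) = begin
    ι (2 ℕ.^ k ℕ.+ (2 ℕ.^ k ℕ.+ 0)) ≡⟨ cong (λ m → ι (2 ℕ.^ k ℕ.+ m)) (ℕ.+-identityʳ (2 ℕ.^ k)) ⟩
    ι (2 ℕ.^ k ℕ.+ 2 ℕ.^ k)         ≡⟨ ι-+ (2 ℕ.^ k) (2 ℕ.^ k) ⟩
    ι (2 ℕ.^ k) + ι (2 ℕ.^ k)       ≡⟨ cong₂ _+_ (ι-2^ k) (ι-2^ k) ⟩
    2ℚ ^ k + 2ℚ ^ k                 ≡⟨ solve 1 (λ x → x :+ x := (con 1ℚ :+ con 1ℚ) :* x) refl (2ℚ ^ k) ⟩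
    2ℚ ^ suc k                      ∎
    where
    open ≡-Reasoning
    open +-*-Solver

  ι≤dyadic : ∀ {m k} → m ℕ.≤ 2 ℕ.^ k → ι m ≤ dyadic k 0
  ι≤dyadic {m} {k} h = ≤-trans (ι-mono h) (≤-reflexive (trans (ι-2^ k) (sym (*-identityʳ (2ℚ ^ k)))))

  ∑ℚ : {A : Set} → List A → (A → ℚ) → ℚ
  ∑ℚ []       f = 0ℚ
  ∑ℚ (x ∷ xs) f = f x + ∑ℚ xs f

  ∑ℚ-mono : {A : Set} (xs : List A) {f g : A → ℚ} → (∀ x → f x ≤ g x) → ∑ℚ xs f ≤ ∑ℚ xs g
  ∑ℚ-mono []       h = ≤-refl
  ∑ℚ-mono (x ∷ xs) h = +-mono-≤ (h x) (∑ℚ-mono xs h)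

  ∑ℚ-const : ∀ {A : Set} (xs : List A) c → ∑ℚ xs (λ _ → c) ≡ ι (length xs) * c
  ∑ℚ-const []       c = sym (*-zeroˡ c)
  ∑ℚ-const (_ ∷ xs) c = trans (cong (c +_) (∑ℚ-const xs c))
    (solve 2 (λ c y → c :+ y :* c := (con 1ℚ :+ y) :* c) refl c (ι (length xs)))
    where open +-*-Solver

  ∑ℚ-*ʳ : ∀ {A : Set} (xs : List A) (f : A → ℚ) c → ∑ℚ xs (λ x → f x * c) ≡ ∑ℚ xs f * c
  ∑ℚ-*ʳ []       f c = sym (*-zeroˡ c)
  ∑ℚ-*ʳ (x ∷ xs) f c = trans (cong (f x * c +_) (∑ℚ-*ʳ xs f c)) (sym (*-distribʳ-+ c (f x) (∑ℚ xs f)))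

  ∑ℚ-*ˡ : ∀ {A : Set} (xs : List A) (f : A → ℚ) c → ∑ℚ xs (λ x → c * f x) ≡ c * ∑ℚ xs f
  ∑ℚ-*ˡ []       f c = sym (*-zeroʳ c)
  ∑ℚ-*ˡ (x ∷ xs) f c = trans (cong (c * f x +_) (∑ℚ-*ˡ xs f c)) (sym (*-distribˡ-+ c (f x) (∑ℚ xs f)))

  ∑ℚ-+ : {A : Set} (xs : List A) (f g : A → ℚ) → ∑ℚ xs (λ x → f x + g x) ≡ ∑ℚ xs f + ∑ℚ xs g
  ∑ℚ-+ []       f g = refl
  ∑ℚ-+ (x ∷ xs) f g = trans (cong (f x + g x +_) (∑ℚ-+ xs f g))
    (solve 4 (λ a b c e → (a :+ b) :+ (c :+ e) := (a :+ c) :+ (b :+ e)) refl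
      (f x) (g x) (∑ℚ xs f) (∑ℚ xs g))
    where open +-*-Solver

  ∑ℚ-++ : {A : Set} (xs ys : List A) (f : A → ℚ) → ∑ℚ (xs ++ ys) f ≡ ∑ℚ xs f + ∑ℚ ys f
  ∑ℚ-++ []       ys f = sym (+-identityˡ (∑ℚ ys f))
  ∑ℚ-++ (x ∷ xs) ys f = trans (cong (f x +_) (∑ℚ-++ xs ys f)) (sym (+-assoc (f x) (∑ℚ xs f) (∑ℚ ys f)))

  ∑ℚ-map : {A B : Set} (h : A → B) (xs : List A) (f : B → ℚ) → ∑ℚ (map h xs) f ≡ ∑ℚ xs (f ∘ h)
  ∑ℚ-map h []       f = refl
  ∑ℚ-map h (x ∷ xs) f = cong (f (h x) +_) (∑ℚ-map h xs f)

  sublists : {A : Set} → List A → List (List A)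
  sublists []       = [] ∷ []
  sublists (x ∷ xs) = sublists xs ++ map (x ∷_) (sublists xs)

  -- The sum is (1 + q)^k with q = ½^L and k the length of `xs`. The induction carries the bound 1 +
  -- 2kq, which survives because it never exceeds 2. In effect a sublist can be guessed at a price
  -- of `L` bits per member.
  ∑ℚ-sublists : ∀ {A : Set} (xs : List A) L → 2 ℕ.* length xs ℕ.≤ 2 ℕ.^ L →
    ∑ℚ (sublists xs) (λ ys → ½ ^ (L ℕ.* length ys)) ≤ 2ℚ
  ∑ℚ-sublists xs L h = begin
    ∑ℚ (sublists xs) (λ ys → ½ ^ (L ℕ.* length ys)) ≤⟨ go xs h ⟩
    1ℚ + ι (2 ℕ.* length xs) * q                    ≤⟨ +-monoʳ-≤ 1ℚ (≤1 h) ⟩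
    2ℚ                                              ∎
    where
    open ≤-Reasoning
    open +-*-Solver
    q : ℚ
    q = ½ ^ L
    0≤q : 0ℚ ≤ q
    0≤q = ^-nonNeg L (nonNegative⁻¹ ½)
    ≤1 : ∀ {m} → m ℕ.≤ 2 ℕ.^ L → ι m * q ≤ 1ℚ
    ≤1 m≤ = ≤-trans (*-monoʳ 0≤q (≤-trans (ι-mono m≤) (≤-reflexive (ι-2^ L))))
        (≤-reflexive (dyadic-diag L))
    go : ∀ xs → 2 ℕ.* length xs ℕ.≤ 2 ℕ.^ L →
      ∑ℚ (sublists xs) (λ ys → ½ ^ (L ℕ.* length ys)) ≤ 1ℚ + ι (2 ℕ.* length xs) * q
    go [] _ = ≤-reflexive (trans (+-identityʳ (½ ^ (L ℕ.* 0))) (trans (cong (½ ^_) (ℕ.*-zeroʳ L))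
      (sym (trans (cong (1ℚ +_) (*-zeroˡ q)) (+-identityʳ 1ℚ)))))
    go (x ∷ xs) h = begin
      ∑ℚ (sublists xs ++ map (x ∷_) (sublists xs)) f
        ≡⟨ ∑ℚ-++ (sublists xs) _ f ⟩
      s + ∑ℚ (map (x ∷_) (sublists xs)) f
        ≡⟨ cong (s +_) (∑ℚ-map (x ∷_) (sublists xs) f) ⟩
      s + ∑ℚ (sublists xs) (λ ys → ½ ^ (L ℕ.* suc (length ys)))
        ≤⟨ +-monoʳ-≤ s (∑ℚ-mono (sublists xs) λ ys → ≤-reflexive
             (trans (cong (½ ^_) (ℕ.*-suc L (length ys))) (^-homo-* ½ L (L ℕ.* length ys)))) ⟩
      s + ∑ℚ (sublists xs) (λ ys → q * f ys)
        ≡⟨ cong (s +_) (∑ℚ-*ˡ (sublists xs) f q) ⟩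
      s + q * s
        ≤⟨ +-mono-≤ (go xs h′) (*-monoˡ 0≤q (≤-trans (go xs h′) (+-monoʳ-≤ 1ℚ (≤1 h′)))) ⟩
      (1ℚ + ι k * q) + q * 2ℚ
        ≡⟨ solve 2 (λ y q → (con 1ℚ :+ y :* q) :+ q :* (con 1ℚ :+ con 1ℚ)
             := con 1ℚ :+ (con 1ℚ :+ (con 1ℚ :+ y)) :* q) refl (ι k) q ⟩
      1ℚ + ι (suc (suc k)) * q
        ≡⟨ cong (λ m → 1ℚ + ι m * q) (sym (ℕ.*-suc 2 (length xs))) ⟩
      1ℚ + ι (2 ℕ.* suc (length xs)) * q ∎
      where
      f : List _ → ℚ
      f ys = ½ ^ (L ℕ.* length ys)
      k = 2 ℕ.* length xs
      s = ∑ℚ (sublists xs) f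
      h′ : k ℕ.≤ 2 ℕ.^ L
      h′ = ℕ.≤-trans (ℕ.*-monoʳ-≤ 2 (ℕ.n≤1+n (length xs))) h

  module Probability (p : ℚ) (0≤p : 0ℚ ≤ p) (p≤1 : p ≤ 1ℚ) where

    0≤1-p : 0ℚ ≤ 1ℚ - p
    0≤1-p = p≤q⇒0≤q-p p≤1

    𝔼 : ∀ {N} → (Subset N → ℚ) → ℚ
    𝔼 {zero}  f = f []
    𝔼 {suc N} f = (1ℚ - p) * 𝔼 (f ∘ (outside ∷_)) + p * 𝔼 (f ∘ (inside ∷_))

    𝔼-mono : ∀ {N} {f g : Subset N → ℚ} → (∀ Y → f Y ≤ g Y) → 𝔼 f ≤ 𝔼 g
    𝔼-mono {zero}  h = h []
    𝔼-mono {suc N} h = +-mono-≤ (*-monoˡ 0≤1-p (𝔼-mono (h ∘ (outside ∷_))))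
                                (*-monoˡ 0≤p (𝔼-mono (h ∘ (inside ∷_))))

    𝔼-+ : ∀ {N} (f g : Subset N → ℚ) → 𝔼 (λ Y → f Y + g Y) ≡ 𝔼 f + 𝔼 g
    𝔼-+ {zero}  f g = refl
    𝔼-+ {suc N} f g = trans
      (cong₂ (λ x y → (1ℚ - p) * x + p * y) (𝔼-+ (f ∘ (outside ∷_)) (g ∘ (outside ∷_)))
                                            (𝔼-+ (f ∘ (inside ∷_)) (g ∘ (inside ∷_))))
      (solve 6 (λ r p a b c e → r :* (a :+ b) :+ p :* (c :+ e) := (r :* a :+ p :* c) :+
          (r :* b :+ p :* e)) refl
        (1ℚ - p) p (𝔼 (f ∘ (outside ∷_))) (𝔼 (g ∘ (outside ∷_))) (𝔼 (f ∘ (inside ∷_)))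
            (𝔼 (g ∘ (inside ∷_))))
      where open +-*-Solver

    𝔼-const : ∀ N c → 𝔼 {N} (λ _ → c) ≡ c
    𝔼-const zero    c = refl
    𝔼-const (suc N) c = trans (cong (λ x → (1ℚ - p) * x + p * x) (𝔼-const N c))
      (solve 2 (λ p c → (con 1ℚ :- p) :* c :+ p :* c := c) refl p c)
      where open +-*-Solver

    infix 4 _≼_

    -- E ≼ b bounds the outer probability of E, so that events need not be decidable.
    record _≼_ {N : ℕ} (E : Pred (Subset N) 0ℓ) (b : ℚ) : Set where
      field
        weight    : Subset N → ℚ
        nonNeg    : ∀ Y → 0ℚ ≤ weight Y
        dominates : ∀ {Y} → E Y → 1ℚ ≤ weight Y
        bound     : 𝔼 weight ≤ b

    open _≼_ public

    module _ {N : ℕ} where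

      ≼-weaken : ∀ {E E′ : Pred (Subset N) 0ℓ} {b b′} → (∀ {Y} → E′ Y → E Y) → b ≤ b′ → E ≼ b → E′ ≼ b′
      ≼-weaken E′⊆E b≤b′ c = record
        { weight = weight c ; nonNeg = nonNeg c
        ; dominates = dominates c ∘ E′⊆E ; bound = ≤-trans (bound c) b≤b′ }

      ≼-empty : ∀ {E : Pred (Subset N) 0ℓ} → (∀ {Y} → ¬ E Y) → E ≼ 0ℚ
      ≼-empty h = record
        { weight = λ _ → 0ℚ ; nonNeg = λ _ → ≤-refl
        ; dominates = ⊥-elim ∘ h ; bound = ≤-reflexive (𝔼-const N 0ℚ) }

      ≼-∪ : ∀ {E F G : Pred (Subset N) 0ℓ} {a b} → E ≼ a → F ≼ b →
        (∀ {Y} → G Y → (E Y) ⊎ (F Y)) → G ≼ a + b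
      ≼-∪ c c′ split = record
        { weight = λ Y → weight c Y + weight c′ Y
        ; nonNeg = λ Y → +-nonNeg (nonNeg c Y) (nonNeg c′ Y)
        ; dominates = λ {Y} g → either (split g)
        ; bound = ≤-trans (≤-reflexive (𝔼-+ (weight c) (weight c′))) (+-mono-≤ (bound c) (bound c′)) }
        where
        either : ∀ {Y} → _ ⊎ _ → 1ℚ ≤ weight c Y + weight c′ Y
        either {Y} (inj₁ e) = subst (_≤ weight c Y + weight c′ Y) (+-identityʳ 1ℚ)
            (+-mono-≤ (dominates c e) (nonNeg c′ Y))
        either {Y} (inj₂ f) = subst (_≤ weight c Y + weight c′ Y) (+-identityˡ 1ℚ)
            (+-mono-≤ (nonNeg c Y) (dominates c′ f))

      ≼-⋃ : ∀ {A : Set} (xs : List A) {E : A → Pred (Subset N) 0ℓ} {b : A → ℚ} →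
        (∀ x → E x ≼ b x) → (λ Y → Any (λ x → E x Y) xs) ≼ ∑ℚ xs b
      ≼-⋃ []       h = ≼-empty λ ()
      ≼-⋃ (x ∷ xs) h = ≼-∪ (h x) (≼-⋃ xs h) λ { (here e) → inj₁ e ; (there e) → inj₂ e }

    contains : ∀ {N} → Subset N → Subset N → ℚ
    contains []            []            = 1ℚ
    contains (outside ∷ S) (_ ∷ Y)       = contains S Y
    contains (inside ∷ S)  (outside ∷ Y) = 0ℚ
    contains (inside ∷ S)  (inside ∷ Y)  = contains S Y

    ≼-contains : ∀ {N} (S : Subset N) → (S ⊆_) ≼ p ^ ∣ S ∣
    ≼-contains S = record
      { weight = contains S ; nonNeg = nonNeg′ S
      ; dominates = λ {Y} → dominates′ S Y ; bound = ≤-reflexive (bound′ S) }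
      where
      nonNeg′ : ∀ {N} (S Y : Subset N) → 0ℚ ≤ contains S Y
      nonNeg′ []            []            = 0≤1
      nonNeg′ (outside ∷ S) (_ ∷ Y)       = nonNeg′ S Y
      nonNeg′ (inside ∷ S)  (outside ∷ Y) = ≤-refl
      nonNeg′ (inside ∷ S)  (inside ∷ Y)  = nonNeg′ S Y
      dominates′ : ∀ {N} (S Y : Subset N) → S ⊆ Y → 1ℚ ≤ contains S Y
      dominates′ []            []            _ = ≤-refl
      dominates′ (outside ∷ S) (_ ∷ Y)       h = dominates′ S Y (drop-∷-⊆ h)
      dominates′ (inside ∷ S)  (outside ∷ Y) h with h here
      ... | ()
      dominates′ (inside ∷ S)  (inside ∷ Y)  h = dominates′ S Y (drop-∷-⊆ h)
      bound′ : ∀ {N} (S : Subset N) → 𝔼 (contains S) ≡ p ^ ∣ S ∣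
      bound′ []            = refl
      bound′ (outside ∷ S) = trans
        (solve 2 (λ p x → (con 1ℚ :- p) :* x :+ p :* x := x) refl p (𝔼 (contains S))) (bound′ S)
        where open +-*-Solver
      bound′ {suc N} (inside ∷ S) = trans
        (cong₂ (λ x y → (1ℚ - p) * x + p * y) (𝔼-const N 0ℚ) (bound′ S))
        (trans (cong (_+ p * p ^ ∣ S ∣) (*-zeroʳ (1ℚ - p))) (+-identityˡ (p * p ^ ∣ S ∣)))

-- The union bound over explorations

module Exploring where

  open Counting
  open Cores
  open OuterProbability
  open import Data.List.Properties using (length-tabulate)
  open import Data.List.Relation.Unary.Any as Any using (Any; here; there)
  open import Data.Nat as ℕ using (ℕ; zero; suc)
  import Data.Nat.Properties as ℕ
  import Data.Nat.Solver as ℕ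
  open import Data.Rational as ℚ using (ℚ; 0ℚ; 1ℚ; ½; _+_; _*_; _≤_)
  open import Data.Rational.Properties as ℚ using (+-*-commutativeRing; ≤-trans; ≤-reflexive)
  open import Data.Rational.Solver using (module +-*-Solver)
  open import Algebra.Bundles using (CommutativeRing)
  open import Algebra.Properties.Semiring.Exp (CommutativeRing.semiring +-*-commutativeRing)
    using (_^_)

  ∑ℚ-ι : {A : Set} (xs : List A) (f : A → ℕ) → ∑ℚ xs (ι ∘ f) ≡ ι (∑ᴸ xs f)
  ∑ℚ-ι []       f = refl
  ∑ℚ-ι (x ∷ xs) f = trans (cong (ι (f x) +_) (∑ℚ-ι xs f)) (sym (ι-+ (f x) (∑ᴸ xs f)))

  any-elems : {A : Set} {{_ : Finite A}} {E : A → Set} → ∀ a → E a → Any E elems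
  any-elems {A} {E = E} a e = go elems (ℕ.≤-reflexive (sym (count-one a)))
    where
    go : ∀ xs → 1 ℕ.≤ ∑ᴸ xs (λ x → 𝟙 (x == a)) → Any E xs
    go (x ∷ xs) h with x == a
    ... | yes refl = here e
    ... | no _     = there (go xs h)

  module Exploration (d n N : ℕ) (σ : Fin N → Subset n) (∣simplex∣ : ∀ i → ∣ σ i ∣ ≡ suc d)
    (simplex-injective : ∀ {i j} → σ i ≡ σ j → i ≡ j)
    (simplex-surjective : ∀ {p} → ∣ p ∣ ≡ suc d → ∃[ i ] σ i ≡ p) where

    open Simplices d n N σ ∣simplex∣ simplex-injective simplex-surjective public

    covers? : ∀ S τ → Decidable (λ i → i ∈ S × τ ⊆ σ i)
    covers? S τ i = (i ∈? S) ×-dec (τ ⊆? σ i)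

    degree : Subset N → Subset n → ℕ
    degree S τ = # (covers? S τ)

    Free : Subset N → Subset n → Set
    Free S τ = ∣ τ ∣ ≡ d × degree S τ ≡ 1

    free? : ∀ S → Decidable (Free S)
    free? S τ = (∣ τ ∣ ℕ.≟ d) ×-dec (degree S τ ℕ.≟ 1)

    free-or-core : ∀ S → Nonempty S → ∃ (Free S) ⊎ Core S
    free-or-core S ne with exists? (free? S)
    ... | yes free = inj₁ free
    ... | no ∄     = inj₂ (ne , twice)
      where
      twice : ∀ τ → ∣ τ ∣ ≡ d → Face S τ →
        ∃[ i ] ∃[ j ] (i ≢ j × i ∈ S × j ∈ S × τ ⊆ σ i × τ ⊆ σ j)
      twice τ ∣τ∣ (i , i∈S , τ⊆i) with exists? (λ j → ¬? (i Fin.≟ j) ×-dec covers? S τ j)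
      ... | yes (j , i≢j , j∈S , τ⊆j) = i , j , i≢j , i∈S , j∈S , τ⊆i , τ⊆j
      ... | no alone = ⊥-elim (∄ (τ , ∣τ∣ , ℕ.≤-antisym
              (#-unique (covers? S τ) λ j k c c′ → trans (sym (same c)) (same c′))
              (#-pos (covers? S τ) {i} (i∈S , τ⊆i))))
        where
        same : ∀ {j} → j ∈ S × τ ⊆ σ j → i ≡ j
        same {j} c = decidable-stable (i Fin.≟ j) λ i≢j → alone (j , i≢j , c)

    core-degree : ∀ {K} → Core K → ∀ {τ} → ∣ τ ∣ ≡ d → degree K τ ≢ 1
    core-degree {K} (_ , core) {τ} ∣τ∣ deg≡1 =
      let i , c = ∑-pos (ℕ.≤-reflexive (sym deg≡1))
          i∈K , τ⊆i = 𝟙⁻ (covers? K τ i) c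
          j , k , j≢k , j∈K , k∈K , τ⊆j , τ⊆k = core τ ∣τ∣ (i , i∈K , τ⊆i)
      in ℕ.1+n≰n (subst₂ ℕ._≤_ (cong suc (count-one j)) deg≡1
           (#-insert (_== j) (covers? K τ) k (λ { _ refl → j∈K , τ⊆j }) (k∈K , τ⊆k) (j≢k ∘ sym)))

    minimal-unique : ∀ {K S} → MinimalCore K → Core S → S ⊆ K → S ≡ K
    minimal-unique {K} {S} (_ , minimal) core S⊆K with S ⊂? K
    ... | yes S⊂K = ⊥-elim (minimal S S⊂K core)
    ... | no S⊄K  = ⊆-antisym S⊆K λ {i} i∈K → decidable-stable (i ∈? S) λ i∉S → S⊄K (S⊆K , i , i∈K , i∉S)

    -- The weight of S is 2^(x S) / 2^(y S) and p is at most 2^a / 2^ℓ.  Weighted by p,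
    -- the extensions of S at τ by ordinary vertices and those by special vertices
    -- each weigh at most half as much as S.
    Branching : ℕ → ℕ → Pred (Subset N) 0ℓ → (x y : Subset N → ℕ) → Set₁
    Branching a ℓ Q x y = ∀ S τ → Free S τ → (¬ (∃[ K ] (Q K × S ⊆ K))) ⊎
      Σ[ Special ∈ Pred (Fin n) 0ℓ ] Σ[ special? ∈ Decidable Special ] ∃[ t ]
        ((# special? ℕ.≤ 2 ℕ.^ t) ×
         (∀ v i → v ∉ τ → i ∉ S → σ i ≡ τ ⊕ v →
           (¬ Special v → suc a ℕ.+ x (S ⊕ i) ℕ.+ y S ℕ.≤ x S ℕ.+ y (S ⊕ i)) ×
           (Special v → suc a ℕ.+ t ℕ.+ x (S ⊕ i) ℕ.+ y S ℕ.≤ ℓ ℕ.+ x S ℕ.+ y (S ⊕ i))))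

    module Explore (p : ℚ) (0≤p : 0ℚ ≤ p) (p≤1 : p ≤ 1ℚ) (a ℓ : ℕ) (p≤ : p ≤ dyadic a ℓ)
      (n≤2^ℓ : n ℕ.≤ 2 ℕ.^ ℓ) (Q : Pred (Subset N) 0ℓ) (minimal : ∀ {K} → Q K → MinimalCore K)
      (x y : Subset N → ℕ) (final : ∀ {K} → Q K → y K ℕ.≤ x K)
      (step : Branching a ℓ Q x y)
      where

      open Probability p 0≤p p≤1

      w : Subset N → ℚ
      w S = dyadic (x S) (y S)

      Extends : Subset N → Pred (Subset N) 0ℓ
      Extends S Y = ∃[ K ] (Q K × S ⊆ K × K ⊆ Y)

      0≤p^ : ∀ k → 0ℚ ≤ p ^ k
      0≤p^ k = ^-nonNeg k 0≤p

      -- `fuel` bounds the number of simplices still to be added. If `S` is already a core,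
      -- minimality makes it the only core in question that extends `S`: either its weight is at
      -- least 1, or `final` shows that there is none.
      explore : ∀ fuel S → Nonempty S → N ℕ.≤ ∣ S ∣ ℕ.+ fuel → Extends S ≼ p ^ ∣ S ∣ * w S
      explore fuel S ne N≤ with free-or-core S ne
      explore fuel S ne N≤ | inj₂ core with y S ℕ.≤? x S
      ... | yes y≤x = ≼-weaken {E = λ Y → S ⊆ Y} (λ (K , _ , S⊆K , K⊆Y) → K⊆Y ∘ S⊆K)
            (subst (_≤ p ^ ∣ S ∣ * w S) (ℚ.*-identityʳ (p ^ ∣ S ∣))
              (*-monoˡ (0≤p^ ∣ S ∣) (subst (_≤ w S) (dyadic-diag 0) (dyadic-mono {0} {0} {x S} {y S}
                (ℕ.≤-trans y≤x (ℕ.≤-reflexive (sym (ℕ.+-identityʳ (x S)))))))))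
            (≼-contains S)
      ... | no y≰x  = ≼-weaken id (*-nonNeg (0≤p^ ∣ S ∣) (dyadic-nonNeg (x S) (y S)))
            (≼-empty λ { (K , q , S⊆K , _) → y≰x (subst (λ S → y S ℕ.≤ x S)
              (sym (minimal-unique (minimal q) core S⊆K)) (final q)) })
      explore fuel S ne N≤ | inj₁ (τ , free) with step S τ free
      ... | inj₁ ∄ = ≼-weaken id (*-nonNeg (0≤p^ ∣ S ∣) (dyadic-nonNeg (x S) (y S)))
            (≼-empty λ { (K , q , S⊆K , _) → ∄ (K , q , S⊆K) })
      ... | inj₂ (Special , special? , t , #special≤ , ratios) =
            ≼-weaken {E = λ Y → Any (λ v → Child v Y) elems} branch total (≼-⋃ elems child)
        where
        -- `G` is `w S` divided by twice `2 ^ ℓ` and is charged to each of the n vertices. `H` is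
        -- `w S` divided by twice `2 ^ t` and is charged to each special vertex. Each kind totals at
        -- most half of `w S`.
        G H : ℚ
        G = dyadic (x S) (suc (y S ℕ.+ ℓ))
        H = dyadic (x S) (suc (y S ℕ.+ t))

        Child : Fin n → Pred (Subset N) 0ℓ
        Child v Y = ∃[ K ] (Q K × S ⊆ K × K ⊆ Y × v ∉ τ × ∃[ i ] (i ∉ S × i ∈ K × σ i ≡ τ ⊕ v))

        R : Fin n → ℚ
        R v = G + ι (𝟙 (special? v)) * H

        0≤G : 0ℚ ≤ G
        0≤G = dyadic-nonNeg (x S) (suc (y S ℕ.+ ℓ))

        0≤H : 0ℚ ≤ H
        0≤H = dyadic-nonNeg (x S) (suc (y S ℕ.+ t))

        0≤R : ∀ v → 0ℚ ≤ R v
        0≤R v = +-nonNeg 0≤G (*-nonNeg (0≤ι (𝟙 (special? v))) 0≤H)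

        ratio : ∀ v i → v ∉ τ → i ∉ S → σ i ≡ τ ⊕ v → p * w (S ⊕ i) ≤ R v
        ratio v i v∉τ i∉S eq = ≤-trans (*-monoʳ (dyadic-nonNeg x′ y′) p≤) (≤-trans
          (≤-reflexive (dyadic-* a ℓ x′ y′)) (cases (special? v)))
          where
          x′ = x (S ⊕ i)
          y′ = y (S ⊕ i)
          open ℕ.+-*-Solver
          cases : (s? : Dec (Special v)) → dyadic (a ℕ.+ x′) (ℓ ℕ.+ y′) ≤ G + ι (𝟙 s?) * H
          cases (no ¬s) = ≤-trans
            (dyadic-mono {a ℕ.+ x′} {ℓ ℕ.+ y′} {x S} {suc (y S ℕ.+ ℓ)} (subst₂ ℕ._≤_
              (solve 4 (λ a x y l → con 1 :+ a :+ x :+ y :+ l := a :+ x :+ (con 1 :+ (y :+ l)))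
                  refl a x′ (y S) ℓ)
              (solve 3 (λ x y l → x :+ y :+ l := x :+ (l :+ y)) refl (x S) y′ ℓ)
              (ℕ.+-monoˡ-≤ ℓ (proj₁ (ratios v i v∉τ i∉S eq) ¬s))))
            (≤-reflexive (sym (trans (cong (G +_) (ℚ.*-zeroˡ H)) (ℚ.+-identityʳ G))))
          cases (yes s) = ≤-trans
            (dyadic-mono {a ℕ.+ x′} {ℓ ℕ.+ y′} {x S} {suc (y S ℕ.+ t)} (subst₂ ℕ._≤_
              (solve 4 (λ a x y t → con 1 :+ a :+ t :+ x :+ y := a :+ x :+ (con 1 :+ (y :+ t)))
                  refl a x′ (y S) t)
              (solve 3 (λ x y l → l :+ x :+ y := x :+ (l :+ y)) refl (x S) y′ ℓ)
              (proj₂ (ratios v i v∉τ i∉S eq) s)))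
            (subst (_≤ G + (1ℚ + 0ℚ) * H) (trans (ℚ.+-identityˡ ((1ℚ + 0ℚ) * H)) (ℚ.*-identityˡ H))
              (ℚ.+-monoˡ-≤ ((1ℚ + 0ℚ) * H) 0≤G))

        descend : ∀ fuel i → i ∉ S → N ℕ.≤ ∣ S ∣ ℕ.+ fuel → Extends (S ⊕ i) ≼ p ^ ∣ S ⊕ i ∣ * w (S ⊕ i)
        descend zero i i∉S N≤ = ⊥-elim (ℕ.1+n≰n (ℕ.≤-trans (subst (ℕ._≤ N) (∣p⊕v∣ i∉S) (∣p∣≤n (S ⊕ i)))
          (subst (N ℕ.≤_) (ℕ.+-identityʳ ∣ S ∣) N≤)))
        descend (suc fuel) i i∉S N≤ = explore fuel (S ⊕ i) (i , v∈p⊕v)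
          (subst (N ℕ.≤_) (trans (ℕ.+-suc ∣ S ∣ fuel) (cong (ℕ._+ fuel) (sym (∣p⊕v∣ i∉S)))) N≤)

        child : ∀ v → Child v ≼ p ^ ∣ S ∣ * R v
        child v with v ∈? τ | exists? (λ i → ¬? (i ∈? S) ×-dec (σ i ≟ˢ (τ ⊕ v)))
        ... | yes v∈τ | _ = ≼-weaken id (*-nonNeg (0≤p^ ∣ S ∣) (0≤R v))
              (≼-empty λ (_ , _ , _ , _ , v∉τ , _) → v∉τ v∈τ)
        ... | no _ | no ∄ = ≼-weaken id (*-nonNeg (0≤p^ ∣ S ∣) (0≤R v))
              (≼-empty λ (_ , _ , _ , _ , _ , i , i∉S , _ , eq) → ∄ (i , i∉S , eq))
        ... | no v∉τ | yes (i , i∉S , eq) = ≼-weaken {E = Extends (S ⊕ i)}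
              (λ (K , q , S⊆K , K⊆Y , _ , j , _ , j∈K , eq′) →
                K , q , ⊕-⊆ S⊆K (subst (_∈ K) (simplex-injective (trans eq′ (sym eq))) j∈K) , K⊆Y)
              (subst (_≤ p ^ ∣ S ∣ * R v)
                (trans (solve 3 (λ p q w → q :* (p :* w) := (p :* q) :* w) refl p (p ^ ∣ S ∣)
                    (w (S ⊕ i)))
                  (cong (λ k → p ^ k * w (S ⊕ i)) (sym (∣p⊕v∣ i∉S))))
                (*-monoˡ (0≤p^ ∣ S ∣) (ratio v i v∉τ i∉S eq)))
              (descend fuel i i∉S N≤)
          where open +-*-Solver

        branch : ∀ {Y} → Extends S Y → Any (λ v → Child v Y) elems
        branch {Y} (K , q , S⊆K , K⊆Y) =
          let ∣τ∣ , deg≡1 = free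
              i , c = ∑-pos (ℕ.≤-reflexive (sym deg≡1))
              i∈S , τ⊆i = 𝟙⁻ (covers? S τ i) c
              j , j∈K , j≢i , τ⊆j = core-other (proj₁ (minimal q)) (S⊆K i∈S) ∣τ∣ τ⊆i
              v , v∉τ , eq = suc-size⇒⊕ τ⊆j (trans (∣simplex∣ j) (cong suc (sym ∣τ∣)))
              j∉S : j ∉ S
              j∉S = λ j∈S → ℕ.1+n≰n (subst₂ ℕ._≤_ (cong suc (count-one i)) deg≡1
                (#-insert (_== i) (covers? S τ) j (λ { _ refl → i∈S , τ⊆i }) (j∈S , τ⊆j) j≢i))
          in any-elems v (K , q , S⊆K , K⊆Y , v∉τ , j , j∉S , j∈K , eq)

        total : ∑ℚ elems (λ v → p ^ ∣ S ∣ * R v) ≤ p ^ ∣ S ∣ * w S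
        total = begin
          ∑ℚ elems (λ v → p ^ ∣ S ∣ * R v)
            ≡⟨ ∑ℚ-*ˡ elems R (p ^ ∣ S ∣) ⟩
          p ^ ∣ S ∣ * ∑ℚ elems R
            ≡⟨ cong (p ^ ∣ S ∣ *_) (∑ℚ-+ elems (λ _ → G) (λ v → ι (𝟙 (special? v)) * H)) ⟩
          p ^ ∣ S ∣ * (∑ℚ (elems {Fin n}) (λ _ → G) + ∑ℚ elems (λ v → ι (𝟙 (special? v)) * H))
            ≡⟨ cong (p ^ ∣ S ∣ *_) (cong₂ _+_
                 (trans (∑ℚ-const (elems {Fin n}) G) (cong (λ k → ι k * G)
                     (length-tabulate {n = n} id)))
                 (trans (∑ℚ-*ʳ elems (λ v → ι (𝟙 (special? v))) H)
                     (cong (_* H) (∑ℚ-ι elems (λ v → 𝟙 (special? v)))))) ⟩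
          p ^ ∣ S ∣ * (ι n * G + ι (# special?) * H)
            ≤⟨ *-monoˡ (0≤p^ ∣ S ∣) (ℚ.+-mono-≤ (half ℓ n≤2^ℓ) (half t #special≤)) ⟩
          p ^ ∣ S ∣ * (dyadic (x S) (suc (y S)) + dyadic (x S) (suc (y S)))
            ≡⟨ cong (p ^ ∣ S ∣ *_) (dyadic-halves (x S) (y S)) ⟩
          p ^ ∣ S ∣ * w S ∎
          where
          open ℚ.≤-Reasoning
          half : ∀ {m} k → m ℕ.≤ 2 ℕ.^ k → ι m * dyadic (x S) (suc (y S ℕ.+ k)) ≤ dyadic (x S)
              (suc (y S))
          half k m≤ = ≤-trans (*-monoʳ (dyadic-nonNeg (x S) (suc (y S ℕ.+ k))) (ι≤dyadic {k = k} m≤))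
            (≤-reflexive (trans (dyadic-* k 0 (x S) (suc (y S ℕ.+ k)))
              (trans (cong (λ z → dyadic z (suc (y S ℕ.+ k))) (ℕ.+-comm k (x S)))
                  (dyadic-shift (x S) (suc (y S)) k))))

      Occurs : Pred (Subset N) 0ℓ
      Occurs Y = ∃[ K ] (Q K × K ⊆ Y)

      -- The exploration pays only for steps after the first simplex. The up to `2 ^ k` choices of
      -- that simplex and the accuracy `e` must come from the starting weights, which is what the
      -- inequality on `⊥ ⊕ i` provides.
      occurs : ∀ k e → N ℕ.≤ 2 ℕ.^ k → (∀ i → a ℕ.+ x (⊥ ⊕ i) ℕ.+ k ℕ.+ e ℕ.≤ ℓ ℕ.+ y (⊥ ⊕ i)) →
        Occurs ≼ ½ ^ e
      occurs k e N≤ initial = ≼-weaken {E = λ Y → Any (λ i → Extends (⊥ ⊕ i) Y) elems} first total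
          (≼-⋃ elems λ i → explore N (⊥ ⊕ i) (i , v∈p⊕v) (ℕ.m≤n+m N _))
        where
        open ℚ.≤-Reasoning
        first : ∀ {Y} → Occurs Y → Any (λ i → Extends (⊥ ⊕ i) Y) elems
        first (K , q , K⊆Y) = let i , i∈K = proj₁ (proj₁ (minimal q))
          in any-elems i (K , q , ⊕-⊆ (⊆-min K) i∈K , K⊆Y)
        each : ∀ i → p ^ ∣ ⊥ ⊕ i ∣ * w (⊥ ⊕ i) ≤ dyadic 0 (k ℕ.+ e)
        each i = begin
          p ^ ∣ ⊥ ⊕ i ∣ * w (⊥ ⊕ i)
            ≡⟨ cong (λ m → p ^ m * w (⊥ ⊕ i)) (trans (∣p⊕v∣ {p = ⊥} {i} ∉⊥) (cong suc (∣⊥∣≡0 N))) ⟩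
          p * 1ℚ * w (⊥ ⊕ i)
            ≡⟨ cong (_* w (⊥ ⊕ i)) (ℚ.*-identityʳ p) ⟩
          p * w (⊥ ⊕ i)
            ≤⟨ *-monoʳ (dyadic-nonNeg (x (⊥ ⊕ i)) (y (⊥ ⊕ i))) p≤ ⟩
          dyadic a ℓ * w (⊥ ⊕ i)
            ≡⟨ dyadic-* a ℓ (x (⊥ ⊕ i)) (y (⊥ ⊕ i)) ⟩
          dyadic (a ℕ.+ x (⊥ ⊕ i)) (ℓ ℕ.+ y (⊥ ⊕ i))
            ≤⟨ dyadic-mono {a ℕ.+ x (⊥ ⊕ i)} {ℓ ℕ.+ y (⊥ ⊕ i)} {0} {k ℕ.+ e}
                 (subst (ℕ._≤ ℓ ℕ.+ y (⊥ ⊕ i)) (ℕ.+-assoc (a ℕ.+ x (⊥ ⊕ i)) k e) (initial i)) ⟩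
          dyadic 0 (k ℕ.+ e) ∎
        total : ∑ℚ elems (λ i → p ^ ∣ ⊥ ⊕ i ∣ * w (⊥ ⊕ i)) ≤ ½ ^ e
        total = begin
          ∑ℚ elems (λ i → p ^ ∣ ⊥ ⊕ i ∣ * w (⊥ ⊕ i)) ≤⟨ ∑ℚ-mono elems each ⟩
          ∑ℚ (elems {Fin N}) (λ _ → dyadic 0 (k ℕ.+ e)) ≡⟨ ∑ℚ-const (elems {Fin N})
              (dyadic 0 (k ℕ.+ e)) ⟩
          ι (length (elems {Fin N})) * dyadic 0 (k ℕ.+ e) ≡⟨ cong (λ m → ι m * dyadic 0 (k ℕ.+ e))
              (length-tabulate {n = N} id) ⟩
          ι N * dyadic 0 (k ℕ.+ e)                   ≤⟨ *-monoʳ (dyadic-nonNeg 0 (k ℕ.+ e))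
              (ι≤dyadic {k = k} N≤) ⟩
          dyadic k 0 * dyadic 0 (k ℕ.+ e)            ≡⟨ dyadic-* k 0 0 (k ℕ.+ e) ⟩
          dyadic (k ℕ.+ 0) (k ℕ.+ e)                 ≡⟨ cong₂ dyadic (ℕ.+-identityʳ k) (ℕ.+-comm k e) ⟩
          dyadic (0 ℕ.+ k) (e ℕ.+ k)                 ≡⟨ dyadic-shift 0 e k ⟩
          dyadic 0 e                                 ≡⟨ ℚ.*-identityˡ (½ ^ e) ⟩
          ½ ^ e                                      ∎

-- The potential of a partial core and its growth in a step

module Potential where

  open Counting
  open Cores
  open Exploring
  import Data.List.Membership.DecPropositional as DecMembership
  open import Data.List.Membership.Propositional using () renaming (_∈_ to _∈ᴸ_; _∉_ to _∉ᴸ_)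
  open import Data.Nat
  open import Data.Nat.Properties

  inside⊈ : ∀ {n} {p q : Subset n} → ¬ (inside ∷ q ⊆ outside ∷ p)
  inside⊈ h with h Vec.here
  ... | ()

  ∑-⊆ : ∀ {n} (p : Subset n) → # (_⊆? p) ≡ 2 ^ ∣ p ∣
  ∑-⊆ []            = refl
  ∑-⊆ (outside ∷ p) = trans (∑-allSubsets (λ q → 𝟙 (q ⊆? (outside ∷ p)))) (trans
    (cong₂ _+_ (∑-cong λ q → 𝟙-cong ((outside ∷ q) ⊆? (outside ∷ p)) (q ⊆? p) (λ h → drop-∷-⊆ h)
        (λ h → out⊆ h))
               (#-zero (λ q → (inside ∷ q) ⊆? (outside ∷ p)) λ q h → inside⊈ h))
    (trans (+-identityʳ _) (∑-⊆ p)))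
  ∑-⊆ (inside ∷ p)  = trans (∑-allSubsets (λ q → 𝟙 (q ⊆? (inside ∷ p)))) (trans
    (cong₂ _+_ (∑-cong λ q → 𝟙-cong ((outside ∷ q) ⊆? (inside ∷ p)) (q ⊆? p) (λ h → drop-∷-⊆ h)
        (λ h → out⊆ h))
               (∑-cong λ q → 𝟙-cong ((inside ∷ q) ⊆? (inside ∷ p)) (q ⊆? p) (λ h → drop-∷-⊆ h)
                   (λ h → in⊆in h)))
    (cong₂ _+_ (∑-⊆ p) (trans (∑-⊆ p) (sym (+-identityʳ (2 ^ ∣ p ∣))))))

  smallest : ∀ {n} {P : Pred (Subset n) _} (P? : Decidable P) → ∃ P →
    ∃[ ρ ] (P ρ × ∀ {ρ′} → P ρ′ → ∣ ρ ∣ ≤ ∣ ρ′ ∣)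
  smallest {P = P} P? (ρ , Pρ) = go ∣ ρ ∣ ρ Pρ ≤-refl
    where
    go : ∀ k ρ → P ρ → ∣ ρ ∣ ≤ k → ∃[ ρ ] (P ρ × ∀ {ρ′} → P ρ′ → ∣ ρ ∣ ≤ ∣ ρ′ ∣)
    go zero    ρ Pρ ρ≤ = ρ , Pρ , λ _ → ≤-trans ρ≤ z≤n
    go (suc k) ρ Pρ ρ≤ with exists? (λ ρ′ → P? ρ′ ×-dec (∣ ρ′ ∣ ≤? k))
    ... | yes (ρ′ , Pρ′ , ≤k) = go k ρ′ Pρ′ ≤k
    ... | no ∄ = ρ , Pρ , λ {ρ′} Pρ′ → ≤-trans ρ≤ (≰⇒> λ ≤k → ∄ (ρ′ , Pρ′ , ≤k))

  module Potentials (d n N : ℕ) (σ : Fin N → Subset n) (∣simplex∣ : ∀ i → ∣ σ i ∣ ≡ suc d)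
    (simplex-injective : ∀ {i j} → σ i ≡ σ j → i ≡ j)
    (simplex-surjective : ∀ {p} → ∣ p ∣ ≡ suc d → ∃[ i ] σ i ≡ p) where

    open Exploration d n N σ ∣simplex∣ simplex-injective simplex-surjective public

    face? : ∀ S → Decidable (Face S)
    face? S τ = exists? (covers? S τ)

    degree-⊕ : ∀ {S i} → i ∉ S → ∀ τ → degree (S ⊕ i) τ ≡ degree S τ + 𝟙 (τ ⊆? σ i)
    degree-⊕ {S} {i} i∉S τ = begin
      degree (S ⊕ i) τ
        ≡⟨ ∑-cong pointwise ⟩
      ∑ (λ j → 𝟙 (covers? S τ j) + 𝟙 (j == i) * 𝟙 (τ ⊆? σ j))
        ≡⟨ ∑-+ (λ j → 𝟙 (covers? S τ j)) (λ j → 𝟙 (j == i) * 𝟙 (τ ⊆? σ j)) ⟩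
      degree S τ + ∑ (λ j → 𝟙 (j == i) * 𝟙 (τ ⊆? σ j))
        ≡⟨ cong (degree S τ +_) (∑-δ i (λ j → 𝟙 (τ ⊆? σ j))) ⟩
      degree S τ + 𝟙 (τ ⊆? σ i) ∎
      where
      open ≡-Reasoning
      pointwise : ∀ j → 𝟙 (covers? (S ⊕ i) τ j) ≡ 𝟙 (covers? S τ j) + 𝟙 (j == i) * 𝟙 (τ ⊆? σ j)
      pointwise j with j == i
      ... | yes refl = trans (𝟙-cong (covers? (S ⊕ i) τ i) (τ ⊆? σ i) proj₂ (λ h → v∈p⊕v , h))
            (trans (sym (*-identityˡ (𝟙 (τ ⊆? σ i))))
              (cong (_+ 1 * 𝟙 (τ ⊆? σ i)) (sym (𝟙-no (covers? S τ i) (i∉S ∘ proj₁)))))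
      ... | no j≢i = trans (𝟙-cong (covers? (S ⊕ i) τ j) (covers? S τ j)
              (λ (j∈ , h) → inS (∈⊕⁻ j∈) , h) (λ (j∈ , h) → p⊆p⊕v j∈ , h)) (sym (+-identityʳ _))
        where
        inS : j ≡ i ⊎ j ∈ S → j ∈ S
        inS (inj₁ j≡i) = ⊥-elim (j≢i j≡i)
        inS (inj₂ j∈S) = j∈S

    degree-mono : ∀ {S i} → i ∉ S → ∀ τ → degree S τ ≤ degree (S ⊕ i) τ
    degree-mono {S} i∉S τ = subst (degree S τ ≤_) (sym (degree-⊕ i∉S τ)) (m≤m+n (degree S τ) _)

    face-mono : ∀ {S K} → S ⊆ K → ∀ {τ} → Face S τ → Face K τ
    face-mono S⊆K (i , i∈S , τ⊆) = i , S⊆K i∈S , τ⊆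

    -- H stands for the heavy sets with fewer than d vertices.  Covering a light free
    -- face lowers the potential by one but creates at least two light free faces,
    -- unless the new vertex is special.
    module Heavy (H : List (Subset n)) (H-small : ∀ {κ} → κ ∈ᴸ H → ∣ κ ∣ < d) where

      open DecMembership (_≟ˢ_ {n}) using () renaming (_∈?_ to _∈ᴸ?_)

      heavyIn? : ∀ τ → Decidable (λ κ → κ ⊆ τ × κ ∈ᴸ H)
      heavyIn? τ κ = (κ ⊆? τ) ×-dec (κ ∈ᴸ? H)

      Light : Pred (Subset n) _
      Light τ = ¬ (∃[ κ ] (κ ⊆ τ × κ ∈ᴸ H))

      -- Two coincidences in one face: the part of `τ` without `a` contains the heavy `ρ₁`, and `a`
      -- is one of the few vertices that turn the light `ρ₂ ⊖ a` into a heavy set. The comparison of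
      -- sizes ensures that the second coincidence is rarer than heavy sets of the size of `ρ₁` are
      -- frequent.
      Crossing : Subset n → Subset n → Subset n → Fin n → Set
      Crossing τ ρ₁ ρ₂ a = (ρ₁ ⊆ τ × ρ₁ ∈ᴸ H) × (ρ₂ ⊆ τ × ρ₂ ∈ᴸ H) ×
        (a ∈ ρ₂ × a ∉ ρ₁) × ρ₂ ⊖ a ∉ᴸ H × ∣ ρ₂ ∣ ≤ ∣ ρ₁ ∣

      crossing? : ∀ τ ρ₁ ρ₂ → Decidable (Crossing τ ρ₁ ρ₂)
      crossing? τ ρ₁ ρ₂ a = heavyIn? τ ρ₁ ×-dec (heavyIn? τ ρ₂ ×-dec
        (((a ∈? ρ₂) ×-dec ¬? (a ∈? ρ₁)) ×-dec (¬? ((ρ₂ ⊖ a) ∈ᴸ? H) ×-dec (∣ ρ₂ ∣ ≤? ∣ ρ₁ ∣))))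

      Rare : Pred (Subset n) _
      Rare τ = ∃[ ρ₁ ] ∃[ ρ₂ ] ∃[ a ] Crossing τ ρ₁ ρ₂ a

      LightFree RareCovered : Subset N → Pred (Subset n) _
      LightFree S τ   = ∣ τ ∣ ≡ d × Light τ × degree S τ ≡ 1
      RareCovered S τ = ∣ τ ∣ ≡ d × Rare τ × 2 ≤ degree S τ

      abstract
        light? : Decidable Light
        light? τ = ¬? (exists? (heavyIn? τ))

        rare? : Decidable Rare
        rare? τ = exists? λ ρ₁ → exists? λ ρ₂ → exists? (crossing? τ ρ₁ ρ₂)

        lightFree? : ∀ S → Decidable (LightFree S)
        lightFree? S τ = (∣ τ ∣ ≟ d) ×-dec (light? τ ×-dec (degree S τ ≟ 1))

        rareCovered? : ∀ S → Decidable (RareCovered S)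
        rareCovered? S τ = (∣ τ ∣ ≟ d) ×-dec (rare? τ ×-dec (2 ≤? degree S τ))

      -- Free faces count only while they are light and free. A rare face starts to count when it is
      -- covered twice and never stops, so that covering a rare free face is also a gain.
      φ : Subset N → Subset n → ℕ
      φ S τ = 𝟙 (lightFree? S τ) + 𝟙 (rareCovered? S τ)

      Φ : Subset N → ℕ
      Φ S = ∑ (φ S)

      -- The (d-1)-faces of `S` count as heavy, so that a vertex closing up with an existing face is
      -- special too.
      HeavyIn : Subset N → Pred (Subset n) _
      HeavyIn S ρ = ρ ∈ᴸ H ⊎ (∣ ρ ∣ ≡ d × Face S ρ)

      heavyIn-mono : ∀ {S K} → S ⊆ K → ∀ {ρ} → HeavyIn S ρ → HeavyIn K ρ
      heavyIn-mono S⊆K (inj₁ ρ∈H)       = inj₁ ρ∈H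
      heavyIn-mono S⊆K (inj₂ (∣ρ∣ , f)) = inj₂ (∣ρ∣ , face-mono S⊆K f)

      Extension : Subset N → Subset n → Fin n → Set
      Extension S κ v = v ∉ κ × HeavyIn S (κ ⊕ v)

      abstract
        extension? : ∀ S κ → Decidable (Extension S κ)
        extension? S κ v = ¬? (v ∈? κ) ×-dec
          (((κ ⊕ v) ∈ᴸ? H) ⊎-dec ((∣ κ ⊕ v ∣ ≟ d) ×-dec face? S (κ ⊕ v)))

      Becomes : Subset N → Subset n → Fin n → Subset n → Set
      Becomes S τ v κ = κ ⊆ τ × κ ∉ᴸ H × Extension S κ v

      abstract
        becomes? : ∀ S τ v → Decidable (Becomes S τ v)
        becomes? S τ v κ = (κ ⊆? τ) ×-dec (¬? (κ ∈ᴸ? H) ×-dec extension? S κ v)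

      Special : Subset N → Subset n → Fin n → Set
      Special S τ v = v ∉ τ × ∃[ κ ] Becomes S τ v κ

      abstract
        special? : ∀ S τ → Decidable (Special S τ)
        special? S τ v = ¬? (v ∈? τ) ×-dec exists? (becomes? S τ v)

      -- A special vertex extends one of the `2 ^ d` subsets of `τ`. That subset is light and has
      -- fewer than d vertices, and its heavy extensions in `S` remain heavy in `K`, where they are
      -- few.
      special-count : ∀ {S K τ} B X → S ⊆ K → ∣ τ ∣ ≡ d →
        (∀ κ → ∣ κ ∣ < d → κ ∉ᴸ H → B * # (extension? K κ) ≤ X) → B * # (special? S τ) ≤ 2 ^ d * X
      special-count {S} {K} {τ} B X S⊆K ∣τ∣ few = begin
        B * # (special? S τ)
          ≤⟨ *-monoʳ-≤ B (∑-mono λ v → 𝟙≤ (special? S τ v) λ (_ , κ , b) → #-pos (becomes? S τ v) b) ⟩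
        B * ∑ (λ v → ∑ (λ κ → 𝟙 (becomes? S τ v κ)))
          ≡⟨ cong (B *_) (∑-swap (λ v κ → 𝟙 (becomes? S τ v κ))) ⟩
        B * ∑ (λ κ → ∑ (λ v → 𝟙 (becomes? S τ v κ)))
          ≡⟨ sym (∑-* B (λ κ → ∑ (λ v → 𝟙 (becomes? S τ v κ)))) ⟩
        ∑ (λ κ → B * ∑ (λ v → 𝟙 (becomes? S τ v κ)))
          ≤⟨ ∑-mono each ⟩
        ∑ (λ κ → X * 𝟙 (κ ⊆? τ))
          ≡⟨ trans (∑-* X (λ κ → 𝟙 (κ ⊆? τ))) (trans (cong (X *_)
              (trans (∑-⊆ τ) (cong (2 ^_) ∣τ∣))) (*-comm X (2 ^ d))) ⟩
        2 ^ d * X ∎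
        where
        open ≤-Reasoning
        none : ∀ κ → (∀ v → ¬ Becomes S τ v κ) → B * ∑ (λ v → 𝟙 (becomes? S τ v κ)) ≤ X * 𝟙 (κ ⊆? τ)
        none κ h = ≤-trans (≤-reflexive (trans (cong (B *_) (#-zero (λ v → becomes? S τ v κ) h))
            (*-zeroʳ B))) z≤n
        each : ∀ κ → B * ∑ (λ v → 𝟙 (becomes? S τ v κ)) ≤ X * 𝟙 (κ ⊆? τ)
        each κ with κ ∈ᴸ? H | suc ∣ κ ∣ ≤? d
        ... | yes κ∈H | _ = none κ λ { v (_ , κ∉H , _) → κ∉H κ∈H }
        ... | no _ | no κ≮d = none κ λ { v (_ , _ , v∉κ , inj₁ h) → κ≮d (≤-trans (≤-trans (≤-reflexive (sym (∣p⊕v∣ v∉κ))) (n≤1+n _)) (H-small h))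
                                      ; v (_ , _ , v∉κ , inj₂ (eq , _)) → κ≮d
                                          (≤-reflexive (trans (sym (∣p⊕v∣ v∉κ)) eq)) }
        ... | no κ∉H | yes κ<d with κ ⊆? τ
        ...   | yes _ = ≤-trans (*-monoʳ-≤ B (#-mono (λ v → becomes? S τ v κ) (extension? K κ)
                          λ { v (_ , _ , v∉κ , h) → v∉κ , heavyIn-mono S⊆K h }))
                        (≤-trans (few κ κ<d κ∉H) (≤-reflexive (sym (*-identityʳ X))))
        ...   | no κ⊈τ = ≤-trans (≤-reflexive (trans (cong (B *_) (#-zero (λ v → becomes? S τ v κ) λ v (h , _) → κ⊈τ h)) (*-zeroʳ B))) z≤n

      -- A core has no free face, so only the rare faces are left.
      core-potential : ∀ {K} → Core K → Φ K ≤ # (rareCovered? K)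
      core-potential {K} core = ∑-mono λ τ → ≤-reflexive (cong (_+ 𝟙 (rareCovered? K τ))
        (𝟙-no (lightFree? K τ) λ (∣τ∣ , _ , deg) → core-degree core {τ} ∣τ∣ deg))

      rareCovered-mono : ∀ {S i} → i ∉ S → ∀ τ → RareCovered S τ → RareCovered (S ⊕ i) τ
      rareCovered-mono i∉S τ (∣τ∣ , r , deg) = ∣τ∣ , r , ≤-trans deg (degree-mono i∉S τ)

      -- Only the subsets of the new simplex change their degree, and a rare face that is covered
      -- twice remains so.
      potential-drop : ∀ {S i} → i ∉ S → Φ S ≤ Φ (S ⊕ i) + 2 ^ suc d
      potential-drop {S} {i} i∉S = begin
        Φ S
          ≤⟨ ∑-mono pointwise ⟩
        ∑ (λ τ → φ (S ⊕ i) τ + 𝟙 (τ ⊆? σ i))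
          ≡⟨ ∑-+ (φ (S ⊕ i)) (λ τ → 𝟙 (τ ⊆? σ i)) ⟩
        Φ (S ⊕ i) + # (_⊆? σ i)
          ≡⟨ cong (Φ (S ⊕ i) +_) (trans (∑-⊆ (σ i)) (cong (2 ^_) (∣simplex∣ i))) ⟩
        Φ (S ⊕ i) + 2 ^ suc d ∎
        where
        open ≤-Reasoning
        lightFree≤ : ∀ τ → 𝟙 (lightFree? S τ) ≤ 𝟙 (lightFree? (S ⊕ i) τ) + 𝟙 (τ ⊆? σ i)
        lightFree≤ τ with τ ⊆? σ i | degree-⊕ i∉S τ
        ... | yes _ | _  = ≤-trans (𝟙≤1 (lightFree? S τ)) (m≤n+m 1 _)
        ... | no _  | eq = ≤-trans (𝟙-mono (lightFree? S τ) (lightFree? (S ⊕ i) τ)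
                λ (∣τ∣ , l , deg) → ∣τ∣ , l , trans eq (trans (+-identityʳ _) deg)) (m≤m+n _ 0)
        pointwise : ∀ τ → φ S τ ≤ φ (S ⊕ i) τ + 𝟙 (τ ⊆? σ i)
        pointwise τ = ≤-trans
          (+-mono-≤ (lightFree≤ τ) (𝟙-mono (rareCovered? S τ) (rareCovered? (S ⊕ i) τ)
              (rareCovered-mono i∉S τ)))
          (≤-reflexive (trans (+-assoc (𝟙 (lightFree? (S ⊕ i) τ)) _ _)
            (trans (cong (𝟙 (lightFree? (S ⊕ i) τ) +_) (+-comm (𝟙 (τ ⊆? σ i)) _))
              (sym (+-assoc (𝟙 (lightFree? (S ⊕ i) τ)) _ _)))))

      -- Minimality of ρ₂ below makes it cross every heavy set that does not contain it.
      trichotomy : ⊥ ∉ᴸ H → ∀ τ → Light τ ⊎ (¬ Light τ × ∃[ w ] (w ∈ τ × Light (τ ⊖ w))) ⊎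
          (¬ Light τ × Rare τ)
      trichotomy ⊥∉H τ with exists? (heavyIn? τ)
      ... | no light  = inj₁ light
      ... | yes heavy with smallest (heavyIn? τ) heavy
      ...   | ρ₂ , (ρ₂⊆τ , ρ₂∈H) , least with nonempty? ρ₂
      ...     | no empty = ⊥-elim (⊥∉H (subst (_∈ᴸ H) (Empty-unique empty) ρ₂∈H))
      ...     | yes (a , a∈ρ₂) with exists? (heavyIn? (τ ⊖ a))
      ...       | no light = inj₂ (inj₁ ((λ l → l heavy) , a , ρ₂⊆τ a∈ρ₂ , light))
      ...       | yes (ρ₁ , ρ₁⊆ , ρ₁∈H) = inj₂ (inj₂ ((λ l → l heavy) , ρ₁ , ρ₂ , a ,
                    ((λ h → p⊖v⊆p (ρ₁⊆ h)) , ρ₁∈H) , ((λ h → ρ₂⊆τ h) , ρ₂∈H) ,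
                        (a∈ρ₂ , λ a∈ρ₁ → v∉p⊖v (ρ₁⊆ a∈ρ₁)) ,
                    (λ h → 1+n≰n (≤-trans (≤-reflexive (∣p⊖v∣ a∈ρ₂))
                        (least ((λ u → ρ₂⊆τ (p⊖v⊆p u)) , h)))) ,
                    least ((λ h → p⊖v⊆p (ρ₁⊆ h)) , ρ₁∈H)))

      module Step (⊥∉H : ⊥ ∉ᴸ H) (2≤d : 2 ≤ d) {S τ i v} (free : Free S τ) (i∉S : i ∉ S)
        (v∉τ : v ∉ τ) (σi : σ i ≡ τ ⊕ v) (¬special : ¬ Special S τ v) where

        private
          ∣τ∣ : ∣ τ ∣ ≡ d
          ∣τ∣ = proj₁ free

          facet : Fin n → Subset n
          facet w = (τ ⊖ w) ⊕ v

          v∉τ⊖w : ∀ {w} → v ∉ τ ⊖ w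
          v∉τ⊖w h = v∉τ (p⊖v⊆p h)

          ∣facet∣ : ∀ {w} → w ∈ τ → ∣ facet w ∣ ≡ d
          ∣facet∣ w∈τ = trans (∣p⊕v∣ v∉τ⊖w) (trans (∣p⊖v∣ w∈τ) ∣τ∣)

          facet⊆ : ∀ w → facet w ⊆ σ i
          facet⊆ w = subst (facet w ⊆_) (sym σi) (⊕-⊆ (λ h → p⊆p⊕v (p⊖v⊆p h)) v∈p⊕v)

          -- A heavy subset of the facet must use `v`. Without `v` it is a light subset of `τ`, and
          -- then `v` would be special.
          stays-light : ∀ {w} → Light (τ ⊖ w) → Light (facet w)
          stays-light {w} light (κ , κ⊆ , κ∈H) with v ∈? κ
          ... | no v∉κ  = light (κ , (λ {u} u∈κ → without u∈κ (∈⊕⁻ (κ⊆ u∈κ))) , κ∈H)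
            where
            without : ∀ {u} → u ∈ κ → u ≡ v ⊎ u ∈ τ ⊖ w → u ∈ τ ⊖ w
            without u∈κ (inj₁ u≡v) = ⊥-elim (v∉κ (subst (_∈ κ) u≡v u∈κ))
            without u∈κ (inj₂ h)   = h
          ... | yes v∈κ = ¬special (v∉τ , κ ⊖ v , (λ h → p⊖v⊆p (below h)) , (λ h → light (κ ⊖ v , below , h)) ,
                  v∉p⊖v , inj₁ (subst (_∈ᴸ H) (sym (p⊖v⊕v v∈κ)) κ∈H))
            where
            below : κ ⊖ v ⊆ τ ⊖ w
            below {u} h with ∈⊕⁻ (κ⊆ (p⊖v⊆p h))
            ... | inj₁ u≡v = ⊥-elim (∈⊖⇒≢ h u≡v)
            ... | inj₂ u∈  = u∈

          -- If `S` already had this facet, the facet would count as heavy, and adding `v` to the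
          -- light set `τ ⊖ w` would make `v` special.
          new : ∀ {w} → w ∈ τ → Light (τ ⊖ w) → degree S (facet w) ≡ 0
          new {w} w∈τ light = #-zero (covers? S (facet w)) λ j c → ¬special (v∉τ , τ ⊖ w ,
            (λ h → p⊖v⊆p h) , (λ h → light (τ ⊖ w , id , h)) , v∉τ⊖w , inj₂ (∣facet∣ w∈τ , j , c))

          facets : ∀ {τ′} → ∣ τ′ ∣ ≡ d → τ′ ⊆ σ i → τ′ ≡ τ ⊎ ∃[ w ] (w ∈ τ × τ′ ≡ facet w)
          facets {τ′} ∣τ′∣ τ′⊆ with v ∈? τ′
          ... | no v∉τ′  = inj₁ (⊆-size below (≤-reflexive (trans ∣τ∣ (sym ∣τ′∣))))
            where
            below : τ′ ⊆ τ
            below {u} h with ∈⊕⁻ (subst (u ∈_) σi (τ′⊆ h))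
            ... | inj₁ u≡v = ⊥-elim (v∉τ′ (subst (_∈ τ′) u≡v h))
            ... | inj₂ u∈  = u∈
          ... | yes v∈τ′ with ∣p∣<∣q∣⇒∃ {p = τ′ ⊖ v} {τ}
                  (≤-reflexive (trans (∣p⊖v∣ v∈τ′) (trans ∣τ′∣ (sym ∣τ∣))))
          ...   | w , w∈τ , w∉ = inj₂ (w , w∈τ ,
                    ⊆-size below (≤-reflexive (trans (∣facet∣ w∈τ) (sym ∣τ′∣))))
            where
            below : τ′ ⊆ facet w
            below {u} h with ∈⊕⁻ (subst (u ∈_) σi (τ′⊆ h)) | u Fin.≟ v
            ... | _ | yes u≡v        = subst (_∈ facet w) (sym u≡v) v∈p⊕v
            ... | inj₁ u≡v | no u≢v  = ⊥-elim (u≢v u≡v)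
            ... | inj₂ u∈τ | no u≢v  = p⊆p⊕v (∈⊖⁺ u∈τ λ u≡w → w∉ (subst (_∈ τ′ ⊖ v) u≡w (∈⊖⁺ h u≢v)))

          rare≤ : ∀ τ′ → 𝟙 (rareCovered? S τ′) ≤ 𝟙 (rareCovered? (S ⊕ i) τ′)
          rare≤ τ′ = 𝟙-mono (rareCovered? S τ′) (rareCovered? (S ⊕ i) τ′) (rareCovered-mono i∉S τ′)

          light⊖ : ∀ {τ′ w} → Light τ′ → τ ⊖ w ⊆ τ′ → Light (τ ⊖ w)
          light⊖ light h (κ , κ⊆ , κ∈H) = light (κ , (λ u → h (κ⊆ u)) , κ∈H)

          -- Apart from `τ`, a light (d-1)-face of the new simplex is a facet through `v` over a
          -- light `τ ⊖ w`. By `new` it was not a face of `S`, hence it had nothing to lose.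
          elsewhere : ∀ {τ′} → τ′ ≢ τ → φ S τ′ ≤ φ (S ⊕ i) τ′
          elsewhere {τ′} τ′≢τ = +-mono-≤ (𝟙-mono (lightFree? S τ′) (lightFree? (S ⊕ i) τ′) keep)
              (rare≤ τ′)
            where
            keep : LightFree S τ′ → LightFree (S ⊕ i) τ′
            keep (∣τ′∣ , light , deg) with τ′ ⊆? σ i | degree-⊕ i∉S τ′
            ... | no _    | eq = ∣τ′∣ , light , trans eq (trans (+-identityʳ _) deg)
            ... | yes τ′⊆ | _ with facets ∣τ′∣ τ′⊆
            ...   | inj₁ τ′≡τ = ⊥-elim (τ′≢τ τ′≡τ)
            ...   | inj₂ (w , w∈τ , eq) = ⊥-elim (0≢1+n (trans
                      (sym (new w∈τ (light⊖ light (λ h → subst (_ ∈_) (sym eq) (p⊆p⊕v h)))))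
                      (trans (cong (degree S) (sym eq)) deg)))

          gain : ∀ {w} → w ∈ τ → Light (τ ⊖ w) → suc (φ S (facet w)) ≤ φ (S ⊕ i) (facet w)
          gain {w} w∈τ light = ≤-trans
            (≤-reflexive (cong suc (cong₂ _+_
              (𝟙-no (lightFree? S (facet w)) λ (_ , _ , deg) → 0≢1+n (trans (sym (new w∈τ light)) deg))
              (𝟙-no (rareCovered? S (facet w)) λ (_ , _ , deg) → n≮0
                  (subst (2 ≤_) (new w∈τ light) deg)))))
            (≤-trans (1≤𝟙 (lightFree? (S ⊕ i) (facet w))
              (∣facet∣ w∈τ , stays-light light , trans (degree-⊕ i∉S (facet w))
                (cong₂ _+_ (new w∈τ light) (𝟙-yes (facet w ⊆? σ i) (facet⊆ w)))))
              (m≤m+n _ _))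

          at-τ : ¬ Light τ → φ S τ ≤ φ (S ⊕ i) τ
          at-τ heavy = +-mono-≤ (≤-trans (≤-reflexive (𝟙-no (lightFree? S τ) λ (_ , light , _) →
              heavy light)) z≤n) (rare≤ τ)

          facet≢τ : ∀ {w} → facet w ≢ τ
          facet≢τ eq = v∉τ (subst (v ∈_) eq v∈p⊕v)

          sum-gain : ∀ t → (∀ τ′ → 𝟙 (τ′ == t) + φ S τ′ ≤ φ (S ⊕ i) τ′) → suc (Φ S) ≤ Φ (S ⊕ i)
          sum-gain t h = begin
            1 + Φ S                              ≡⟨ cong (_+ Φ S) (sym (count-one t)) ⟩
            ∑ (λ τ′ → 𝟙 (τ′ == t)) + Φ S         ≡⟨ sym (∑-+ (λ τ′ → 𝟙 (τ′ == t)) (φ S)) ⟩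
            ∑ (λ τ′ → 𝟙 (τ′ == t) + φ S τ′)      ≤⟨ ∑-mono h ⟩
            Φ (S ⊕ i)                            ∎
            where open ≤-Reasoning

          light-case : Light τ → ∀ {w₁ w₂} → w₁ ∈ τ → w₂ ∈ τ → w₁ ≢ w₂ → suc (Φ S) ≤ Φ (S ⊕ i)
          light-case light {w₁} {w₂} w₁∈ w₂∈ w₁≢w₂ = s≤s⁻¹ (begin
            2 + Φ S
              ≡⟨ cong₂ (λ a b → a + b + Φ S) (sym (count-one (facet w₁))) (sym (count-one (facet w₂))) ⟩
            ∑ (λ τ′ → 𝟙 (τ′ == facet w₁)) + ∑ (λ τ′ → 𝟙 (τ′ == facet w₂)) + Φ S
              ≡⟨ cong (_+ Φ S) (sym (∑-+ (λ τ′ → 𝟙 (τ′ == facet w₁)) (λ τ′ → 𝟙 (τ′ == facet w₂)))) ⟩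
            ∑ (λ τ′ → 𝟙 (τ′ == facet w₁) + 𝟙 (τ′ == facet w₂)) + Φ S
              ≡⟨ sym (∑-+ (λ τ′ → 𝟙 (τ′ == facet w₁) + 𝟙 (τ′ == facet w₂)) (φ S)) ⟩
            ∑ (λ τ′ → 𝟙 (τ′ == facet w₁) + 𝟙 (τ′ == facet w₂) + φ S τ′)
              ≤⟨ ∑-mono pointwise ⟩
            ∑ (λ τ′ → 𝟙 (τ′ == τ) + φ (S ⊕ i) τ′)
              ≡⟨ ∑-+ (λ τ′ → 𝟙 (τ′ == τ)) (φ (S ⊕ i)) ⟩
            ∑ (λ τ′ → 𝟙 (τ′ == τ)) + Φ (S ⊕ i)
              ≡⟨ cong (_+ Φ (S ⊕ i)) (count-one τ) ⟩
            1 + Φ (S ⊕ i) ∎)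
            where
            open ≤-Reasoning
            light₁ = light⊖ {w = w₁} light p⊖v⊆p
            light₂ = light⊖ {w = w₂} light p⊖v⊆p
            distinct : facet w₁ ≢ facet w₂
            distinct eq with ∈⊕⁻ (subst (w₁ ∈_) (sym eq) (p⊆p⊕v (∈⊖⁺ w₁∈ w₁≢w₂)))
            ... | inj₁ w₁≡v = v∉τ (subst (_∈ τ) w₁≡v w₁∈)
            ... | inj₂ h    = v∉p⊖v h
            pointwise : ∀ τ′ → 𝟙 (τ′ == facet w₁) + 𝟙 (τ′ == facet w₂) + φ S τ′ ≤ 𝟙 (τ′ == τ) + φ
                (S ⊕ i) τ′
            pointwise τ′ with τ′ == facet w₁ | τ′ == facet w₂ | τ′ == τ
            ... | yes e₁ | yes e₂ | _      = ⊥-elim (distinct (trans (sym e₁) e₂))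
            ... | yes e₁ | no _   | yes e  = ⊥-elim (facet≢τ (trans (sym e₁) e))
            ... | no _   | yes e₂ | yes e  = ⊥-elim (facet≢τ (trans (sym e₂) e))
            ... | yes e₁ | no _   | no _   = subst (λ τ′ → suc (φ S τ′) ≤ φ (S ⊕ i) τ′) (sym e₁) (gain w₁∈ light₁)
            ... | no _   | yes e₂ | no _   = subst (λ τ′ → suc (φ S τ′) ≤ φ (S ⊕ i) τ′) (sym e₂) (gain w₂∈ light₂)
            ... | no _   | no _   | no ne  = elsewhere ne
            -- The only loss: `τ` ceases to be free, which the unit at `τ` on the right absorbs.
            ... | no _   | no _   | yes _  = +-mono-≤ (𝟙≤1 (lightFree? S τ′)) (≤-trans (rare≤ τ′) (m≤n+m _ _))

          -- A heavy `τ` did not count as light free, so covering it costs nothing and a single new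
          -- facet is enough.
          semi-case : ¬ Light τ → ∀ {w} → w ∈ τ → Light (τ ⊖ w) → suc (Φ S) ≤ Φ (S ⊕ i)
          semi-case heavy {w} w∈τ light = sum-gain (facet w) pointwise
            where
            pointwise : ∀ τ′ → 𝟙 (τ′ == facet w) + φ S τ′ ≤ φ (S ⊕ i) τ′
            pointwise τ′ with τ′ == facet w | τ′ == τ
            ... | yes e | _     = subst (λ τ′ → suc (φ S τ′) ≤ φ (S ⊕ i) τ′) (sym e) (gain w∈τ light)
            ... | no _  | yes e = subst (λ τ′ → φ S τ′ ≤ φ (S ⊕ i) τ′) (sym e) (at-τ heavy)
            ... | no _  | no ne = elsewhere ne

          -- No new light facet is promised here. The gain is at `τ` itself, whose degree passes
          -- from one to two.
          rare-case : ¬ Light τ → Rare τ → suc (Φ S) ≤ Φ (S ⊕ i)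
          rare-case heavy rare = sum-gain τ pointwise
            where
            gain-τ : suc (φ S τ) ≤ φ (S ⊕ i) τ
            gain-τ = ≤-trans
              (≤-reflexive (cong suc (cong₂ _+_
                (𝟙-no (lightFree? S τ) λ (_ , light , _) → heavy light)
                (𝟙-no (rareCovered? S τ) λ (_ , _ , deg) → 1+n≰n (subst (2 ≤_) (proj₂ free) deg)))))
              (≤-trans (1≤𝟙 (rareCovered? (S ⊕ i) τ) (∣τ∣ , rare , ≤-reflexive (sym
                (trans (degree-⊕ i∉S τ) (cong₂ _+_ (proj₂ free)
                  (𝟙-yes (τ ⊆? σ i) (subst (τ ⊆_) (sym σi) p⊆p⊕v)))))))
                (m≤n+m _ _))
            pointwise : ∀ τ′ → 𝟙 (τ′ == τ) + φ S τ′ ≤ φ (S ⊕ i) τ′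
            pointwise τ′ with τ′ == τ
            ... | yes e = subst (λ τ′ → suc (φ S τ′) ≤ φ (S ⊕ i) τ′) (sym e) gain-τ
            ... | no ne = elsewhere ne

        potential-gain : suc (Φ S) ≤ Φ (S ⊕ i)
        potential-gain with trichotomy ⊥∉H τ
        ... | inj₂ (inj₁ (heavy , w , w∈τ , light)) = semi-case heavy w∈τ light
        ... | inj₂ (inj₂ (heavy , rare))            = rare-case heavy rare
        ... | inj₁ light =
              let w₁ , w₁∈ , _ = ∣p∣<∣q∣⇒∃ {p = ⊥} {τ} (subst₂ _<_ (sym (∣⊥∣≡0 n)) (sym ∣τ∣) (≤-trans (s≤s z≤n) 2≤d))
                  w₂ , w₂∈ , w₂∉ = ∣p∣<∣q∣⇒∃ {p = ⊥ ⊕ w₁} {τ}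
                    (subst₂ _<_ (sym (trans (∣p⊕v∣ {p = ⊥} {w₁} ∉⊥) (cong suc (∣⊥∣≡0 n))))
                        (sym ∣τ∣) 2≤d)
              in light-case light w₁∈ w₂∈ λ w₁≡w₂ → w₂∉ (subst (_∈ ⊥ ⊕ w₁) w₁≡w₂ v∈p⊕v)

-- Heavy sets: their number, their extensions and rare faces

module HeavyFamilies where

  open Counting
  open Cores
  open OuterProbability using (sublists)
  open Potential
  import Data.Fin.Properties as Fin
  open import Data.List.Membership.Propositional using () renaming (_∈_ to _∈ᴸ_; _∉_ to _∉ᴸ_)
  import Data.List.Membership.DecPropositional as DecMembership
  import Data.List.Membership.Propositional.Properties as ∈ᴸ
  import Data.List.Relation.Unary.All as All
  open import Data.List.Relation.Unary.Any as Any using (here; there)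
  open import Data.Nat
  open import Data.Nat.Properties
  open import Data.Nat.Solver using (module +-*-Solver)

  n≤2^n : ∀ n → n ≤ 2 ^ n
  n≤2^n zero    = z≤n
  n≤2^n (suc n) = begin
    1 + n           ≤⟨ +-mono-≤ (m^n>0 2 n) (n≤2^n n) ⟩
    2 ^ n + 2 ^ n   ≡⟨ cong (2 ^ n +_) (sym (+-identityʳ (2 ^ n))) ⟩
    2 ^ suc n       ∎
    where open ≤-Reasoning

  2^-mono-≤ : ∀ {a b} → a ≤ b → 2 ^ a ≤ 2 ^ b
  2^-mono-≤ = ^-monoʳ-≤ 2

  supersets? : ∀ {n} (ρ : Subset n) k → Decidable (λ τ → ∣ τ ∣ ≡ ∣ ρ ∣ + k × ρ ⊆ τ)
  supersets? ρ k τ = (∣ τ ∣ ≟ ∣ ρ ∣ + k) ×-dec (ρ ⊆? τ)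

  #-supersets : ∀ {n} (ρ : Subset n) k → # (supersets? ρ k) ≤ n ^ k
  #-supersets [] zero    = ≤-refl
  #-supersets [] (suc k) = ≤-reflexive refl
  #-supersets {suc n} (inside ∷ ρ) k = begin
    # (supersets? (inside ∷ ρ) k)
      ≡⟨ ∑-allSubsets (λ τ → 𝟙 (supersets? (inside ∷ ρ) k τ)) ⟩
    # (λ τ → supersets? (inside ∷ ρ) k (outside ∷ τ)) + # (λ τ → supersets? (inside ∷ ρ) k (inside ∷ τ))
      ≤⟨ +-mono-≤
           (≤-reflexive (#-zero (λ τ → supersets? (inside ∷ ρ) k (outside ∷ τ)) λ τ (_ , h) →
               inside⊈ h))
           (#-mono (λ τ → supersets? (inside ∷ ρ) k (inside ∷ τ)) (supersets? ρ k)
             λ τ (eq , h) → suc-injective eq , λ {x} → drop-∷-⊆ h {x}) ⟩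
    # (supersets? ρ k)
      ≤⟨ #-supersets ρ k ⟩
    n ^ k
      ≤⟨ ^-monoˡ-≤ k (n≤1+n n) ⟩
    suc n ^ k ∎
    where
    open ≤-Reasoning
  #-supersets {suc n} (outside ∷ ρ) k = begin
    # (supersets? (outside ∷ ρ) k)
      ≡⟨ ∑-allSubsets (λ τ → 𝟙 (supersets? (outside ∷ ρ) k τ)) ⟩
    # (λ τ → supersets? (outside ∷ ρ) k (outside ∷ τ)) + #
        (λ τ → supersets? (outside ∷ ρ) k (inside ∷ τ))
      ≤⟨ +-mono-≤
           (≤-trans (#-mono (λ τ → supersets? (outside ∷ ρ) k (outside ∷ τ)) (supersets? ρ k)
             λ τ (eq , h) → eq , λ {x} → drop-∷-⊆ h {x}) (#-supersets ρ k))
           (with-head k) ⟩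
    n ^ k + head k
      ≤⟨ grow k ⟩
    suc n ^ k ∎
    where
    open ≤-Reasoning
    head : ℕ → ℕ
    head zero    = 0
    head (suc k) = n ^ k
    with-head : ∀ k → # (λ τ → supersets? (outside ∷ ρ) k (inside ∷ τ)) ≤ head k
    with-head zero = ≤-reflexive (#-zero (λ τ → supersets? (outside ∷ ρ) 0 (inside ∷ τ)) λ τ (eq , h) →
      1+n≰n (≤-trans (≤-reflexive (trans eq (+-identityʳ ∣ ρ ∣)))
          (p⊆q⇒∣p∣≤∣q∣ {p = ρ} {τ} λ {x} → drop-∷-⊆ h {x})))
    with-head (suc k) = ≤-trans (#-mono (λ τ → supersets? (outside ∷ ρ) (suc k) (inside ∷ τ)) (supersets? ρ k)
      λ τ (eq , h) → suc-injective (trans eq (+-suc ∣ ρ ∣ k)) , λ {x} → drop-∷-⊆ h {x})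
          (#-supersets ρ k)
    grow : ∀ k → n ^ k + head k ≤ suc n ^ k
    grow zero    = ≤-refl
    grow (suc k) = begin
      n * n ^ k + n ^ k   ≡⟨ +-comm (n * n ^ k) (n ^ k) ⟩
      suc n * n ^ k       ≤⟨ *-monoʳ-≤ (suc n) (^-monoˡ-≤ k (n≤1+n n)) ⟩
      suc n * suc n ^ k   ∎

  #-size : ∀ {n} ℓ k → n ≤ 2 ^ ℓ → # (λ (τ : Subset n) → ∣ τ ∣ ≟ k) ≤ 2 ^ (ℓ * k)
  #-size {n} ℓ k n≤ = begin
    # (λ (τ : Subset n) → ∣ τ ∣ ≟ k)
      ≤⟨ #-mono (λ τ → ∣ τ ∣ ≟ k) (supersets? (⊥ {n}) k)
           (λ τ eq → trans eq (cong (_+ k) (sym (∣⊥∣≡0 n))) , λ {x} → ⊆-min τ {x}) ⟩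
    # (supersets? (⊥ {n}) k)
      ≤⟨ #-supersets (⊥ {n}) k ⟩
    n ^ k
      ≤⟨ ^-monoˡ-≤ k n≤ ⟩
    (2 ^ ℓ) ^ k
      ≡⟨ ^-*-assoc 2 ℓ k ⟩
    2 ^ (ℓ * k) ∎
    where open ≤-Reasoning

  ∑-const : ∀ k c → ∑ (λ (_ : Fin k) → c) ≡ k * c
  ∑-const k c = trans (∑-cong {f = λ (_ : Fin k) → c} λ i → trans (sym (*-identityʳ c))
      (cong (c *_) (sym (𝟙-yes (i ∈? ⊤ {k}) ∈⊤))))
    (trans (∑-* c (λ (i : Fin k) → 𝟙 (i ∈? ⊤))) (trans (cong (c *_)
        (trans (sym (∣p∣≡# (⊤ {k}))) (∣⊤∣≡n k))) (*-comm c k)))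

  ∑-≤ : ∀ k {c} {f : Fin k → ℕ} → (∀ i → f i ≤ c) → ∑ f ≤ k * c
  ∑-≤ k {c} h = ≤-trans (∑-mono h) (≤-reflexive (∑-const k c))

  length-filter≡ : {A : Set} {P : Pred A 0ℓ} (P? : Decidable P) (xs : List A) →
    length (filter P? xs) ≡ ∑ᴸ xs (λ x → 𝟙 (P? x))
  length-filter≡ P? []       = refl
  length-filter≡ P? (x ∷ xs) with P? x
  ... | yes _ = cong suc (length-filter≡ P? xs)
  ... | no _  = length-filter≡ P? xs

  ∑ᴸ-filter-≤ : {A : Set} {P : Pred A 0ℓ} (P? : Decidable P) (xs : List A) {f g : A → ℕ} →
    (∀ {x} → P x → f x ≤ g x) → ∑ᴸ (filter P? xs) f ≤ ∑ᴸ xs g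
  ∑ᴸ-filter-≤ P? []       h = z≤n
  ∑ᴸ-filter-≤ P? (x ∷ xs) {g = g} h with P? x
  ... | yes p = +-mono-≤ (h p) (∑ᴸ-filter-≤ P? xs h)
  ... | no _  = ≤-trans (∑ᴸ-filter-≤ P? xs h) (m≤n+m _ (g x))

  filter∈sublists : {A : Set} {P : Pred A 0ℓ} (P? : Decidable P) (xs : List A) →
    filter P? xs ∈ᴸ sublists xs
  filter∈sublists P? []       = here refl
  filter∈sublists P? (x ∷ xs) with P? x
  ... | yes _ = ∈ᴸ.∈-++⁺ʳ (sublists xs) (∈ᴸ.∈-map⁺ (x ∷_) (filter∈sublists P? xs))
  ... | no _  = ∈ᴸ.∈-++⁺ˡ (filter∈sublists P? xs)

  ∈sublists⇒⊆ : {A : Set} (xs : List A) {ys : List A} → ys ∈ᴸ sublists xs → ∀ {x} → x ∈ᴸ ys → x ∈ᴸ xs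
  ∈sublists⇒⊆ []       (here refl) ()
  ∈sublists⇒⊆ (x ∷ xs) ys∈ x∈ with ∈ᴸ.∈-++⁻ (sublists xs) ys∈
  ... | inj₁ h = there (∈sublists⇒⊆ xs h x∈)
  ... | inj₂ h with ∈ᴸ.∈-map⁻ (x ∷_) h
  ...   | zs , zs∈ , refl with x∈
  ...     | here eq  = here eq
  ...     | there x∈ = there (∈sublists⇒⊆ xs zs∈ x∈)

  smallSubsets : ∀ d n → List (Subset n)
  smallSubsets d n = filter (λ ρ → ∣ ρ ∣ <? d) elems

  ∈smallSubsets⁻ : ∀ {d n} {ρ : Subset n} → ρ ∈ᴸ smallSubsets d n → ∣ ρ ∣ < d
  ∈smallSubsets⁻ {d} {n} h = proj₂ (∈ᴸ.∈-filter⁻ (λ ρ → ∣ ρ ∣ <? d) {xs = elems} h)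

  length-smallSubsets : ∀ d {n} ℓ → n ≤ 2 ^ ℓ → 2 * length (smallSubsets d n) ≤ 2 ^ suc (d + ℓ * d)
  length-smallSubsets d {n} ℓ n≤ = *-monoʳ-≤ 2 (begin
    length (smallSubsets d n)
      ≡⟨ length-filter≡ (λ ρ → ∣ ρ ∣ <? d) (elems {Subset n}) ⟩
    # (λ (ρ : Subset n) → ∣ ρ ∣ <? d)
      ≤⟨ ∑-mono (λ (ρ : Subset n) → 𝟙≤ (∣ ρ ∣ <? d) λ h → #-pos (λ (j : Fin d) → ∣ ρ ∣ ≟ toℕ j)
          (sym (Fin.toℕ-fromℕ< h))) ⟩
    ∑ (λ (ρ : Subset n) → ∑ (λ (j : Fin d) → 𝟙 (∣ ρ ∣ ≟ toℕ j)))
      ≡⟨ ∑-swap (λ (ρ : Subset n) (j : Fin d) → 𝟙 (∣ ρ ∣ ≟ toℕ j)) ⟩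
    ∑ (λ (j : Fin d) → # (λ (ρ : Subset n) → ∣ ρ ∣ ≟ toℕ j))
      ≤⟨ ∑-≤ d (λ j → ≤-trans (#-size ℓ (toℕ j) n≤) (2^-mono-≤ (*-monoʳ-≤ ℓ (<⇒≤ (Fin.toℕ<n j))))) ⟩
    d * 2 ^ (ℓ * d)
      ≤⟨ *-monoˡ-≤ (2 ^ (ℓ * d)) (n≤2^n d) ⟩
    2 ^ d * 2 ^ (ℓ * d)
      ≡⟨ sym (^-distribˡ-+-* 2 d (ℓ * d)) ⟩
    2 ^ (d + ℓ * d) ∎)
    where open ≤-Reasoning

  -- Every (d-1)-face is heavy, and a set with d-1-j vertices is heavy if it has
  -- at least 2^(ℓ - threshold j) heavy extensions by one vertex.
  module Thresholds (d c₀ : ℕ) where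

    -- `total j` is the exponent lost in counting the heavy sets of codimension `j`. A threshold
    -- exceeds it by `c₀`, so that the scarcity of extensions of a light set outweighs the possible
    -- abundance of heavy sets, with `c₀` bits to spare.
    threshold total : ℕ → ℕ
    threshold j = total j + c₀
    total zero    = 0
    total (suc j) = total j + (threshold j + d)

    total-mono : ∀ {j k} → j ≤ k → total j ≤ total k
    total-mono {j} {k} h with ≤⇒≤′ h
    ... | ≤′-refl         = ≤-refl
    ... | ≤′-step {m} h′ = ≤-trans (total-mono (≤′⇒≤ h′)) (m≤m+n (total m) _)

  module HeavySets (d n N : ℕ) (σ : Fin N → Subset n) (∣simplex∣ : ∀ i → ∣ σ i ∣ ≡ suc d)
    (simplex-injective : ∀ {i j} → σ i ≡ σ j → i ≡ j)
    (simplex-surjective : ∀ {p} → ∣ p ∣ ≡ suc d → ∃[ i ] σ i ≡ p) where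

    open Potentials d n N σ ∣simplex∣ simplex-injective simplex-surjective public

    #simplices : ∀ ℓ → n ≤ 2 ^ ℓ → N ≤ 2 ^ (ℓ * suc d)
    #simplices ℓ n≤ = begin
      N                                        ≡⟨ sym (trans (sym (∣p∣≡# (⊤ {N}))) (∣⊤∣≡n N)) ⟩
      # (λ i → i ∈? ⊤ {N})                     ≤⟨ #-inj (λ i → i ∈? ⊤ {N}) (λ τ → ∣ τ ∣ ≟ suc d) σ
                                                    (λ i _ → ∣simplex∣ i)
                                                        (λ _ _ _ _ → simplex-injective) ⟩
      # (λ (τ : Subset n) → ∣ τ ∣ ≟ suc d)     ≤⟨ #-size ℓ (suc d) n≤ ⟩
      2 ^ (ℓ * suc d)                          ∎
      where open ≤-Reasoning

    module Levels (ℓ c₀ : ℕ) (n≤2^ℓ : n ≤ 2 ^ ℓ) (K : Subset N) where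

      open Thresholds d c₀

      mutual
        HeavyAt : ℕ → Pred (Subset n) 0ℓ
        HeavyAt zero    ρ = Face K ρ
        HeavyAt (suc j) ρ = 2 ^ ℓ ≤ 2 ^ threshold j * # (grows? j ρ)

        Grows : ℕ → Subset n → Fin n → Set
        Grows j ρ v = v ∉ ρ × HeavyAt j (ρ ⊕ v)

        heavyAt? : ∀ j → Decidable (HeavyAt j)
        heavyAt? zero    ρ = face? K ρ
        heavyAt? (suc j) ρ = 2 ^ ℓ ≤? 2 ^ threshold j * # (grows? j ρ)

        grows? : ∀ j ρ → Decidable (Grows j ρ)
        grows? j ρ v = ¬? (v ∈? ρ) ×-dec heavyAt? j (ρ ⊕ v)

      Level : ℕ → Pred (Subset n) 0ℓ
      Level j ρ = ∣ ρ ∣ + j ≡ d × HeavyAt j ρ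

      abstract
        level? : ∀ j → Decidable (Level j)
        level? j ρ = (∣ ρ ∣ + j ≟ d) ×-dec heavyAt? j ρ

      count : ℕ → ℕ
      count j = # (level? j)

      -- Pairs of a heavy set and a heavy extension are counted twice: a set one level down has at
      -- least `2 ^ ℓ / 2 ^ threshold j` heavy extensions, while a set at level `j` arises by
      -- deletion of one of at most d vertices, and d is at most `2 ^ d`.
      count-step : ∀ j → count (suc j) * 2 ^ ℓ ≤ 2 ^ (threshold j + d) * count j
      count-step j = begin
        count (suc j) * 2 ^ ℓ
          ≡⟨ trans (*-comm (count (suc j)) (2 ^ ℓ)) (sym (∑-* (2 ^ ℓ) (λ ρ → 𝟙 (level? (suc j) ρ)))) ⟩
        ∑ (λ ρ → 2 ^ ℓ * 𝟙 (level? (suc j) ρ))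
          ≤⟨ ∑-mono each ⟩
        ∑ (λ ρ → 2 ^ t * ∑ (λ v → 𝟙 (up? ρ v)))
          ≡⟨ trans (∑-* (2 ^ t) (λ ρ → ∑ (λ v → 𝟙 (up? ρ v))))
              (cong (2 ^ t *_) (∑-swap (λ ρ v → 𝟙 (up? ρ v)))) ⟩
        2 ^ t * ∑ (λ v → ∑ (λ ρ → 𝟙 (up? ρ v)))
          ≤⟨ *-monoʳ-≤ (2 ^ t) (∑-mono shift) ⟩
        2 ^ t * ∑ (λ v → ∑ (λ ρ → 𝟙 (down? ρ v)))
          ≡⟨ cong (2 ^ t *_) (∑-swap (λ v ρ → 𝟙 (down? ρ v))) ⟩
        2 ^ t * ∑ (λ ρ → ∑ (λ v → 𝟙 (down? ρ v)))
          ≤⟨ *-monoʳ-≤ (2 ^ t) (∑-mono size) ⟩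
        2 ^ t * ∑ (λ ρ → 2 ^ d * 𝟙 (level? j ρ))
          ≡⟨ cong (2 ^ t *_) (∑-* (2 ^ d) (λ ρ → 𝟙 (level? j ρ))) ⟩
        2 ^ t * (2 ^ d * count j)
          ≡⟨ trans (sym (*-assoc (2 ^ t) (2 ^ d) (count j)))
              (cong (_* count j) (sym (^-distribˡ-+-* 2 t d))) ⟩
        2 ^ (t + d) * count j ∎
        where
        open ≤-Reasoning
        t = threshold j
        up? : ∀ ρ v → Dec (v ∉ ρ × Level j (ρ ⊕ v))
        up? ρ v = ¬? (v ∈? ρ) ×-dec level? j (ρ ⊕ v)
        down? : ∀ ρ v → Dec (v ∈ ρ × Level j ρ)
        down? ρ v = (v ∈? ρ) ×-dec level? j ρ
        each : ∀ ρ → 2 ^ ℓ * 𝟙 (level? (suc j) ρ) ≤ 2 ^ t * ∑ (λ v → 𝟙 (up? ρ v))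
        each ρ with level? (suc j) ρ
        ... | no _ = ≤-trans (≤-reflexive (*-zeroʳ (2 ^ ℓ))) z≤n
        ... | yes (∣ρ∣ , heavy) = ≤-trans (≤-reflexive (*-identityʳ (2 ^ ℓ))) (≤-trans heavy
                (*-monoʳ-≤ (2 ^ t) (#-mono (grows? j ρ) (up? ρ) λ v (v∉ρ , h) →
                  v∉ρ , trans (cong (_+ j) (∣p⊕v∣ v∉ρ)) (trans (sym (+-suc ∣ ρ ∣ j)) ∣ρ∣) , h)))
        shift : ∀ v → ∑ (λ ρ → 𝟙 (up? ρ v)) ≤ ∑ (λ ρ → 𝟙 (down? ρ v))
        shift v = #-inj (λ ρ → up? ρ v) (λ ρ → down? ρ v) (_⊕ v) (λ ρ (_ , l) → v∈p⊕v , l)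
          λ ρ ρ′ (v∉ρ , _) (v∉ρ′ , _) eq → trans (sym (p⊕v⊖v v∉ρ)) (trans (cong (_⊖ v) eq) (p⊕v⊖v v∉ρ′))
        size : ∀ ρ → ∑ (λ v → 𝟙 (down? ρ v)) ≤ 2 ^ d * 𝟙 (level? j ρ)
        size ρ with level? j ρ
        ... | no ¬l = ≤-trans (≤-reflexive (#-zero (λ v → (v ∈? ρ) ×-dec no ¬l) (λ v (_ , l) → ¬l l))) z≤n
        ... | yes l = ≤-trans (#-mono (λ v → (v ∈? ρ) ×-dec yes l) (_∈? ρ) (λ v → proj₁))
                (≤-trans (≤-reflexive (sym (∣p∣≡# ρ))) (≤-trans
                    (m+n≤o⇒m≤o ∣ ρ ∣ (≤-reflexive (proj₁ l)))
                  (≤-trans (n≤2^n d) (≤-reflexive (sym (*-identityʳ (2 ^ d)))))))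

      count-zero : count 0 ≤ 2 ^ suc d * ∣ K ∣
      count-zero = begin
        count 0
          ≤⟨ ∑-mono (λ ρ → 𝟙≤ (level? 0 ρ) λ (_ , i , c) → #-pos (covers? K ρ) c) ⟩
        ∑ (λ ρ → ∑ (λ i → 𝟙 (covers? K ρ i)))
          ≡⟨ ∑-swap (λ ρ i → 𝟙 (covers? K ρ i)) ⟩
        ∑ (λ i → ∑ (λ ρ → 𝟙 (covers? K ρ i)))
          ≡⟨ ∑-cong (λ i → trans (∑-cong λ ρ → 𝟙-× (i ∈? K) (ρ ⊆? σ i))
               (trans (∑-* (𝟙 (i ∈? K)) (λ ρ → 𝟙 (ρ ⊆? σ i)))
                 (trans (*-comm (𝟙 (i ∈? K)) _) (cong (_* 𝟙 (i ∈? K))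
                     (trans (∑-⊆ (σ i)) (cong (2 ^_) (∣simplex∣ i))))))) ⟩
        ∑ (λ i → 2 ^ suc d * 𝟙 (i ∈? K))
          ≡⟨ trans (∑-* (2 ^ suc d) (λ i → 𝟙 (i ∈? K))) (cong (2 ^ suc d *_) (sym (∣p∣≡# K))) ⟩
        2 ^ suc d * ∣ K ∣ ∎
        where open ≤-Reasoning

      -- Each level divides the count by `2 ^ ℓ` up to a bounded factor, and these factors
      -- accumulate in `total`.
      count≤ : ∀ j → count j * 2 ^ (j * ℓ) ≤ 2 ^ total j * (2 ^ suc d * ∣ K ∣)
      count≤ zero    = ≤-trans (≤-reflexive (*-identityʳ (count 0)))
        (≤-trans count-zero (≤-reflexive (sym (+-identityʳ _))))
      count≤ (suc j) = begin
        count (suc j) * 2 ^ (ℓ + j * ℓ)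
          ≡⟨ trans (cong (count (suc j) *_) (^-distribˡ-+-* 2 ℓ (j * ℓ)))
              (sym (*-assoc (count (suc j)) (2 ^ ℓ) _)) ⟩
        count (suc j) * 2 ^ ℓ * 2 ^ (j * ℓ)
          ≤⟨ *-monoˡ-≤ (2 ^ (j * ℓ)) (count-step j) ⟩
        2 ^ (threshold j + d) * count j * 2 ^ (j * ℓ)
          ≡⟨ *-assoc (2 ^ (threshold j + d)) (count j) _ ⟩
        2 ^ (threshold j + d) * (count j * 2 ^ (j * ℓ))
          ≤⟨ *-monoʳ-≤ (2 ^ (threshold j + d)) (count≤ j) ⟩
        2 ^ (threshold j + d) * (2 ^ total j * (2 ^ suc d * ∣ K ∣))
          ≡⟨ trans (sym (*-assoc (2 ^ (threshold j + d)) (2 ^ total j) _))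
              (cong (_* (2 ^ suc d * ∣ K ∣))
               (trans (sym (^-distribˡ-+-* 2 (threshold j + d) (total j)))
                   (cong (2 ^_) (+-comm (threshold j + d) (total j))))) ⟩
        2 ^ total (suc j) * (2 ^ suc d * ∣ K ∣) ∎
        where open ≤-Reasoning

      Heavy′ : Pred (Subset n) 0ℓ
      Heavy′ ρ = HeavyAt (d ∸ ∣ ρ ∣) ρ

      abstract
        heavy? : Decidable Heavy′
        heavy? ρ = heavyAt? (d ∸ ∣ ρ ∣) ρ

      H : List (Subset n)
      H = filter heavy? (smallSubsets d n)

      ∈H⁻ : ∀ {ρ} → ρ ∈ᴸ H → ∣ ρ ∣ < d × Heavy′ ρ
      ∈H⁻ h = let p , q = ∈ᴸ.∈-filter⁻ heavy? {xs = smallSubsets d n} h in ∈smallSubsets⁻ p , q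

      ∈H⁺ : ∀ {ρ} → ∣ ρ ∣ < d → Heavy′ ρ → ρ ∈ᴸ H
      ∈H⁺ {ρ} lt h = ∈ᴸ.∈-filter⁺ heavy? (∈ᴸ.∈-filter⁺ (λ ρ → ∣ ρ ∣ <? d) (∈-allSubsets ρ) lt) h

      H-small : All.All (λ κ → ∣ κ ∣ < d) H
      H-small = All.tabulate λ h → proj₁ (∈H⁻ h)

      module WithH = Heavy H (All.lookup H-small)
      open WithH

      codimension : ∀ {ρ : Subset n} → ∣ ρ ∣ < d → ∃[ j ]
          (d ∸ ∣ ρ ∣ ≡ suc (toℕ {d} j) × ∣ ρ ∣ + suc (toℕ j) ≡ d)
      codimension {ρ} lt = Fin.fromℕ< {d ∸ suc ∣ ρ ∣} (∸-monoʳ-< {d} {suc ∣ ρ ∣} {0} (s≤s z≤n) lt) ,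
        trans eq (cong suc (sym (Fin.toℕ-fromℕ< _))) ,
        trans (cong (∣ ρ ∣ +_) (trans (cong suc (Fin.toℕ-fromℕ< _)) (sym eq))) (m+[n∸m]≡n (<⇒≤ lt))
        where
        eq : d ∸ ∣ ρ ∣ ≡ suc (d ∸ suc ∣ ρ ∣)
        eq = trans (sym (suc-pred (d ∸ ∣ ρ ∣) {{>-nonZero (m<n⇒0<n∸m lt)}}))
            (cong suc (pred[m∸n]≡m∸[1+n] d ∣ ρ ∣))

      ∈H⇒level : ∀ {ρ} → ρ ∈ᴸ H → ∃[ j ] Level (suc (toℕ {d} j)) ρ
      ∈H⇒level {ρ} h = let lt , heavy = ∈H⁻ h
                           j , eq , ∣ρ∣ = codimension {ρ} lt
                       in j , ∣ρ∣ , subst (λ k → HeavyAt k ρ) eq heavy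

      light-extensions : ∀ {κ} → ∣ κ ∣ < d → κ ∉ᴸ H → ∀ j → d ∸ ∣ κ ∣ ≡ suc j →
        2 ^ threshold j * # (extension? K κ) ≤ 2 ^ ℓ
      light-extensions {κ} lt κ∉H j eq = <⇒≤ (≤-<-trans
        (*-monoʳ-≤ (2 ^ threshold j) (#-mono (extension? K κ) (grows? j κ) λ v (v∉κ , h) → v∉κ ,
            grow v∉κ h))
        (≰⇒> λ h → κ∉H (∈H⁺ lt (subst (λ k → HeavyAt k κ) (sym eq) h))))
        where
        codim : ∀ {v} → v ∉ κ → d ∸ ∣ κ ⊕ v ∣ ≡ j
        codim v∉κ = trans (cong (d ∸_) (∣p⊕v∣ v∉κ))
          (trans (sym (pred[m∸n]≡m∸[1+n] d ∣ κ ∣)) (cong pred eq))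
        grow : ∀ {v} → v ∉ κ → HeavyIn K (κ ⊕ v) → HeavyAt j (κ ⊕ v)
        grow {v} v∉κ (inj₁ h) = subst (λ k → HeavyAt k (κ ⊕ v)) (codim v∉κ) (proj₂ (∈H⁻ h))
        grow {v} v∉κ (inj₂ (∣κv∣ , f)) = subst (λ k → HeavyAt k (κ ⊕ v))
          (trans (sym (n∸n≡0 d)) (trans (cong (d ∸_) (sym ∣κv∣)) (codim v∉κ))) f

      few-extensions : ∀ κ → ∣ κ ∣ < d → κ ∉ᴸ H → 2 ^ c₀ * # (extension? K κ) ≤ 2 ^ ℓ
      few-extensions κ lt κ∉H = let j , eq , _ = codimension {κ} lt in
        ≤-trans (*-monoˡ-≤ (# (extension? K κ)) (2^-mono-≤ (m≤n+m c₀ (total (toℕ j)))))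
          (light-extensions {κ} lt κ∉H (toℕ j) eq)

      -- A heavy empty set would make the count at level d at least 1, and the level bound would
      -- then force `K` to have order n^d simplices.
      ⊥-light : 2 ^ total d * (2 ^ suc d * ∣ K ∣) < 2 ^ (d * ℓ) → ⊥ ∉ᴸ H
      ⊥-light few h = <⇒≱ few (≤-trans
        (≤-trans (≤-reflexive (sym (*-identityˡ (2 ^ (d * ℓ)))))
            (*-monoˡ-≤ (2 ^ (d * ℓ)) (#-pos (level? d) {⊥}
          (cong (_+ d) (∣⊥∣≡0 n) , subst (λ k → HeavyAt k ⊥) (cong (d ∸_) (∣⊥∣≡0 n)) (proj₂ (∈H⁻ h))))))
        (count≤ d))

      -- One level already saves a factor `2 ^ ℓ`, and deeper levels save more. This is why guessing
      -- the family costs less than the simplices of `K` can pay.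
      length-H : length H * 2 ^ ℓ ≤ d * (2 ^ total d * (2 ^ suc d * ∣ K ∣))
      length-H = begin
        length H * 2 ^ ℓ
          ≤⟨ *-monoˡ-≤ (2 ^ ℓ) (≤-trans (≤-reflexive (length-filter≡ heavy? (smallSubsets d n)))
               (∑ᴸ-filter-≤ (λ ρ → ∣ ρ ∣ <? d) elems λ {ρ} lt → 𝟙≤ (heavy? ρ) λ h →
                 #-pos (λ (j : Fin d) → level? (suc (toℕ j)) ρ) (proj₂ (∈H⇒level (∈H⁺ lt h))))) ⟩
        ∑ (λ ρ → ∑ (λ (j : Fin d) → 𝟙 (level? (suc (toℕ j)) ρ))) * 2 ^ ℓ
          ≡⟨ cong (_* 2 ^ ℓ) (∑-swap (λ ρ (j : Fin d) → 𝟙 (level? (suc (toℕ j)) ρ))) ⟩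
        ∑ (λ (j : Fin d) → count (suc (toℕ j))) * 2 ^ ℓ
          ≡⟨ trans (*-comm _ (2 ^ ℓ)) (sym (∑-* (2 ^ ℓ) (λ (j : Fin d) → count (suc (toℕ j))))) ⟩
        ∑ (λ (j : Fin d) → 2 ^ ℓ * count (suc (toℕ j)))
          ≤⟨ ∑-≤ d (λ j → begin
               2 ^ ℓ * count (suc (toℕ j))
                 ≡⟨ *-comm (2 ^ ℓ) _ ⟩
               count (suc (toℕ j)) * 2 ^ ℓ
                 ≤⟨ *-monoʳ-≤ (count (suc (toℕ j))) (2^-mono-≤ (m≤m+n ℓ (toℕ j * ℓ))) ⟩
               count (suc (toℕ j)) * 2 ^ (suc (toℕ j) * ℓ)
                 ≤⟨ count≤ (suc (toℕ j)) ⟩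
               2 ^ total (suc (toℕ j)) * (2 ^ suc d * ∣ K ∣)
                 ≤⟨ *-monoˡ-≤ (2 ^ suc d * ∣ K ∣) (2^-mono-≤ (total-mono (Fin.toℕ<n j))) ⟩
               2 ^ total d * (2 ^ suc d * ∣ K ∣) ∎) ⟩
        d * (2 ^ total d * (2 ^ suc d * ∣ K ∣)) ∎
        where
        open ≤-Reasoning

      -- What a crossing leaves once `a` is removed from the face: `τ` is the remaining set of d - 1
      -- vertices, `ρ` is the heavy set avoiding `a`, and `κ` is the other heavy set without `a`.
      record Witness (τ : Subset n) (a : Fin n) (ρ κ : Subset n) : Set where
        constructor witness
        field
          ∣τ∣ : suc ∣ τ ∣ ≡ d
          a∉τ : a ∉ τ
          ρ⊆τ : ρ ⊆ τ
          ρ∈H : ρ ∈ᴸ H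
          κ⊆τ : κ ⊆ τ
          κ∉H : κ ∉ᴸ H
          κ<ρ : ∣ κ ∣ < ∣ ρ ∣
          κ+a : κ ⊕ a ∈ᴸ H

      abstract
        _∈H? : Decidable (_∈ᴸ H)
        ρ ∈H? = DecMembership._∈?_ (_≟ˢ_ {n}) ρ H

        witness? : ∀ τ a ρ κ → Dec (Witness τ a ρ κ)
        witness? τ a ρ κ with suc ∣ τ ∣ ≟ d | a ∈? τ | ρ ⊆? τ | ρ ∈H? | κ ⊆? τ | κ ∈H? | ∣ κ ∣ <? ∣ ρ ∣ | (κ ⊕ a) ∈H?
        ... | yes p | no q | yes r | yes s | yes t | no u | yes v | yes w = yes (witness p q r s t u v w)
        ... | no ¬p | _ | _ | _ | _ | _ | _ | _ = no (¬p ∘ Witness.∣τ∣)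
        ... | _ | yes q | _ | _ | _ | _ | _ | _ = no λ w → Witness.a∉τ w q
        ... | _ | _ | no ¬r | _ | _ | _ | _ | _ = no λ w → ¬r (Witness.ρ⊆τ w)
        ... | _ | _ | _ | no ¬s | _ | _ | _ | _ = no (¬s ∘ Witness.ρ∈H)
        ... | _ | _ | _ | _ | no ¬t | _ | _ | _ = no λ w → ¬t (Witness.κ⊆τ w)
        ... | _ | _ | _ | _ | _ | yes u | _ | _ = no λ w → Witness.κ∉H w u
        ... | _ | _ | _ | _ | _ | _ | no ¬v | _ = no (¬v ∘ Witness.κ<ρ)
        ... | _ | _ | _ | _ | _ | _ | _ | no ¬w = no (¬w ∘ Witness.κ+a)

      witnesses : Subset n → ℕ
      witnesses ρ = ∑ (λ τ → ∑ (λ κ → ∑ (λ a → 𝟙 (witness? τ a ρ κ))))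

      -- The vertex `a` together with `τ ⊖ a` determines `τ`, so rare faces are no more numerous
      -- than their witnesses.
      #-rare : # (rareCovered? K) ≤ ∑ witnesses
      #-rare = begin
        # (rareCovered? K)
          ≤⟨ ∑-mono (λ τ → 𝟙≤ (rareCovered? K τ) (removes τ)) ⟩
        ∑ (λ τ → ∑ (λ a → 𝟙 (before? a τ)))
          ≡⟨ ∑-swap (λ τ a → 𝟙 (before? a τ)) ⟩
        ∑ (λ a → ∑ (λ τ → 𝟙 (before? a τ)))
          ≤⟨ ∑-mono (λ a → #-inj (before? a) (after? a) (_⊖ a) (λ _ → proj₂) λ τ τ′ (a∈τ , _)
              (a∈τ′ , _) eq →
               trans (sym (p⊖v⊕v a∈τ)) (trans (cong (_⊕ a) eq) (p⊖v⊕v a∈τ′))) ⟩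
        ∑ (λ a → ∑ (λ τ → 𝟙 (after? a τ)))
          ≤⟨ ∑-mono (λ a → ∑-mono λ τ → 𝟙≤ (after? a τ) λ (ρ , κ , w) →
               ≤-trans (#-pos (witness? τ a ρ) w) (≤∑ ρ (λ ρ → ∑ (λ κ → 𝟙 (witness? τ a ρ κ))))) ⟩
        ∑ (λ a → ∑ (λ τ → ∑ (λ ρ → ∑ (λ κ → 𝟙 (witness? τ a ρ κ)))))
          ≡⟨ ∑-swap (λ a τ → ∑ (λ ρ → ∑ (λ κ → 𝟙 (witness? τ a ρ κ)))) ⟩
        ∑ (λ τ → ∑ (λ a → ∑ (λ ρ → ∑ (λ κ → 𝟙 (witness? τ a ρ κ)))))
          ≡⟨ ∑-cong (λ τ → ∑-swap (λ a ρ → ∑ (λ κ → 𝟙 (witness? τ a ρ κ)))) ⟩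
        ∑ (λ τ → ∑ (λ ρ → ∑ (λ a → ∑ (λ κ → 𝟙 (witness? τ a ρ κ)))))
          ≡⟨ ∑-swap (λ τ ρ → ∑ (λ a → ∑ (λ κ → 𝟙 (witness? τ a ρ κ)))) ⟩
        ∑ (λ ρ → ∑ (λ τ → ∑ (λ a → ∑ (λ κ → 𝟙 (witness? τ a ρ κ)))))
          ≡⟨ ∑-cong (λ ρ → ∑-cong λ τ → ∑-swap (λ a κ → 𝟙 (witness? τ a ρ κ))) ⟩
        ∑ witnesses ∎
        where
        open ≤-Reasoning
        abstract
          after? : ∀ a → Decidable (λ τ → ∃[ ρ ] ∃[ κ ] Witness τ a ρ κ)
          after? a τ = exists? λ ρ → exists? λ κ → witness? τ a ρ κ
          before? : ∀ a → Decidable (λ τ → a ∈ τ × ∃[ ρ ] ∃[ κ ] Witness (τ ⊖ a) a ρ κ)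
          before? a τ = (a ∈? τ) ×-dec after? a (τ ⊖ a)
        removes : ∀ τ → RareCovered K τ → 1 ≤ ∑ (λ a → 𝟙 (before? a τ))
        removes τ (∣τ∣ , (ρ₁ , ρ₂ , a , (ρ₁⊆ , ρ₁∈H) , (ρ₂⊆ , ρ₂∈H) , (a∈ρ₂ , a∉ρ₁) , κ∉H , ρ₂≤ρ₁)
            , _) =
          #-pos (λ a → before? a τ) {a} (ρ₂⊆ a∈ρ₂ , ρ₁ , ρ₂ ⊖ a , witness
            (trans (∣p⊖v∣ (ρ₂⊆ a∈ρ₂)) ∣τ∣) v∉p⊖v
            (λ u∈ → ∈⊖⁺ (ρ₁⊆ u∈) λ u≡a → a∉ρ₁ (subst (_∈ ρ₁) u≡a u∈)) ρ₁∈H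
            (λ u∈ → ∈⊖⁺ (ρ₂⊆ (p⊖v⊆p u∈)) (∈⊖⇒≢ u∈)) κ∉H
            (≤-trans (≤-reflexive (∣p⊖v∣ a∈ρ₂)) ρ₂≤ρ₁)
            (subst (_∈ᴸ H) (sym (p⊖v⊕v a∈ρ₂)) ρ₂∈H))

      threshold-mono : ∀ {j k} → j ≤ k → threshold j ≤ threshold k
      threshold-mono h = +-monoˡ-≤ c₀ (total-mono h)

      -- Given `ρ`, there are at most `2 ^ (j * ℓ)` choices for the `j` further vertices of `τ` and
      -- at most `2 ^ d` subsets `κ`. Then `a` must extend the light set `κ`, whose codimension
      -- exceeds that of `ρ`, so the larger threshold limits it.
      witnesses≤ : ∀ j {ρ} → Level (suc j) ρ → 2 ^ threshold (suc j) * witnesses ρ ≤ 2 ^ (j * ℓ) *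
          (2 ^ d * 2 ^ ℓ)
      witnesses≤ j {ρ} (∣ρ∣ , _) = begin
        2 ^ t * ∑ (λ τ → ∑ (λ κ → ∑ (λ a → 𝟙 (witness? τ a ρ κ))))
          ≡⟨ sym (∑-* (2 ^ t) (λ τ → ∑ (λ κ → ∑ (λ a → 𝟙 (witness? τ a ρ κ))))) ⟩
        ∑ (λ τ → 2 ^ t * ∑ (λ κ → ∑ (λ a → 𝟙 (witness? τ a ρ κ))))
          ≤⟨ ∑-mono eachτ ⟩
        ∑ (λ τ → 2 ^ d * 2 ^ ℓ * 𝟙 (supersets? ρ j τ))
          ≡⟨ trans (∑-* (2 ^ d * 2 ^ ℓ) (λ τ → 𝟙 (supersets? ρ j τ))) (*-comm (2 ^ d * 2 ^ ℓ) _) ⟩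
        # (supersets? ρ j) * (2 ^ d * 2 ^ ℓ)
          ≤⟨ *-monoˡ-≤ (2 ^ d * 2 ^ ℓ) (≤-trans (#-supersets ρ j) (≤-trans (^-monoˡ-≤ j n≤2^ℓ)
               (≤-reflexive (trans (^-*-assoc 2 ℓ j) (cong (2 ^_) (*-comm ℓ j)))))) ⟩
        2 ^ (j * ℓ) * (2 ^ d * 2 ^ ℓ) ∎
        where
        open ≤-Reasoning
        t = threshold (suc j)
        ρ<d : ∣ ρ ∣ < d
        ρ<d = ≤-trans (m≤m+n (suc ∣ ρ ∣) j) (≤-reflexive (trans (sym (+-suc ∣ ρ ∣ j)) ∣ρ∣))
        eachκ : ∀ τ κ → suc ∣ τ ∣ ≡ d → 2 ^ t * ∑ (λ a → 𝟙 (witness? τ a ρ κ)) ≤ 2 ^ ℓ * 𝟙 (κ ⊆? τ)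
        eachκ τ κ ∣τ∣ with exists? (λ a → witness? τ a ρ κ)
        ... | no ∄ = ≤-trans (≤-reflexive (trans (cong (2 ^ t *_) (#-zero (λ a → witness? τ a ρ κ) λ a w → ∄ (a , w))) (*-zeroʳ (2 ^ t)))) z≤n
        ... | yes (a , w) = begin
          2 ^ t * ∑ (λ a → 𝟙 (witness? τ a ρ κ))
            ≤⟨ *-monoʳ-≤ (2 ^ t) (#-mono (λ a → witness? τ a ρ κ) (extension? K κ) λ a w →
                 (λ a∈κ → Witness.a∉τ w (Witness.κ⊆τ w a∈κ)) , inj₁ (Witness.κ+a w)) ⟩
          2 ^ t * # (extension? K κ)
            ≤⟨ *-monoˡ-≤ (# (extension? K κ)) (2^-mono-≤ (threshold-mono deeper)) ⟩
          2 ^ threshold k * # (extension? K κ)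
            ≤⟨ light-extensions {κ} κ<d (Witness.κ∉H w) k (proj₁ (proj₂ codim)) ⟩
          2 ^ ℓ
            ≡⟨ trans (sym (*-identityʳ (2 ^ ℓ))) (cong (2 ^ ℓ *_)
                (sym (𝟙-yes (κ ⊆? τ) (Witness.κ⊆τ w)))) ⟩
          2 ^ ℓ * 𝟙 (κ ⊆? τ) ∎
          where
          κ<d : ∣ κ ∣ < d
          κ<d = <-trans (Witness.κ<ρ w) ρ<d
          codim = codimension {κ} κ<d
          k = toℕ (proj₁ codim)
          -- The size condition of a crossing is used here: `κ` is smaller than `ρ`, so the
          -- threshold governing its extensions has index at least `suc j`.
          deeper : suc j ≤ k
          deeper = s≤s⁻¹ (+-cancelˡ-≤ (∣ κ ∣) (suc (suc j)) (suc k) (begin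
            ∣ κ ∣ + suc (suc j)   ≡⟨ +-suc ∣ κ ∣ (suc j) ⟩
            suc ∣ κ ∣ + suc j     ≤⟨ +-monoˡ-≤ (suc j) (Witness.κ<ρ w) ⟩
            ∣ ρ ∣ + suc j         ≡⟨ trans ∣ρ∣ (sym (proj₂ (proj₂ codim))) ⟩
            ∣ κ ∣ + suc k         ∎))
        eachτ : ∀ τ → 2 ^ t * ∑ (λ κ → ∑ (λ a → 𝟙 (witness? τ a ρ κ))) ≤ 2 ^ d * 2 ^ ℓ * 𝟙
            (supersets? ρ j τ)
        eachτ τ with exists? (λ κ → exists? (λ a → witness? τ a ρ κ))
        ... | no ∄ = ≤-trans (≤-reflexive (trans (cong (2 ^ t *_)
                (trans (∑-cong λ κ → #-zero (λ a → witness? τ a ρ κ) λ a w → ∄ (κ , a , w))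
                    (∑-zero {Subset n}))) (*-zeroʳ (2 ^ t)))) z≤n
        ... | yes (κ , a , w) = begin
          2 ^ t * ∑ (λ κ → ∑ (λ a → 𝟙 (witness? τ a ρ κ)))
            ≡⟨ sym (∑-* (2 ^ t) (λ κ → ∑ (λ a → 𝟙 (witness? τ a ρ κ)))) ⟩
          ∑ (λ κ → 2 ^ t * ∑ (λ a → 𝟙 (witness? τ a ρ κ)))
            ≤⟨ ∑-mono (λ κ → eachκ τ κ (Witness.∣τ∣ w)) ⟩
          ∑ (λ κ → 2 ^ ℓ * 𝟙 (κ ⊆? τ))
            ≡⟨ trans (∑-* (2 ^ ℓ) (λ κ → 𝟙 (κ ⊆? τ))) (cong (2 ^ ℓ *_) (∑-⊆ τ)) ⟩
          2 ^ ℓ * 2 ^ ∣ τ ∣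
            ≤⟨ *-monoʳ-≤ (2 ^ ℓ) (2^-mono-≤ (≤-trans (n≤1+n ∣ τ ∣) (≤-reflexive (Witness.∣τ∣ w)))) ⟩
          2 ^ ℓ * 2 ^ d
            ≡⟨ trans (*-comm (2 ^ ℓ) (2 ^ d)) (trans (sym (*-identityʳ (2 ^ d * 2 ^ ℓ)))
                 (cong (2 ^ d * 2 ^ ℓ *_) (sym (𝟙-yes (supersets? ρ j τ)
                   (suc-injective (trans (Witness.∣τ∣ w) (trans (sym ∣ρ∣) (+-suc ∣ ρ ∣ j))) ,
                       Witness.ρ⊆τ w))))) ⟩
          2 ^ d * 2 ^ ℓ * 𝟙 (supersets? ρ j τ) ∎

      -- The bound for one `ρ` saves `threshold (suc j)` bits, and the count of all `ρ` at this
      -- level loses `total (suc j)` bits. The difference is `c₀` at every level.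
      rare-at : ∀ j → 2 ^ c₀ * ∑ (λ ρ → 𝟙 (level? (suc j) ρ) * witnesses ρ) ≤ 2 ^ d *
          (2 ^ suc d * ∣ K ∣)
      rare-at j = *-cancelˡ-≤ (2 ^ u) {{m^n≢0 2 u}} (begin
        2 ^ u * (2 ^ c₀ * X)
          ≡⟨ trans (sym (*-assoc (2 ^ u) (2 ^ c₀) X)) (cong (_* X) (sym (^-distribˡ-+-* 2 u c₀))) ⟩
        2 ^ threshold (suc j) * X
          ≡⟨ sym (∑-* (2 ^ threshold (suc j)) (λ ρ → 𝟙 (level? (suc j) ρ) * witnesses ρ)) ⟩
        ∑ (λ ρ → 2 ^ threshold (suc j) * (𝟙 (level? (suc j) ρ) * witnesses ρ))
          ≤⟨ ∑-mono each ⟩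
        ∑ (λ ρ → 2 ^ (j * ℓ) * (2 ^ d * 2 ^ ℓ) * 𝟙 (level? (suc j) ρ))
          ≡⟨ ∑-* (2 ^ (j * ℓ) * (2 ^ d * 2 ^ ℓ)) (λ ρ → 𝟙 (level? (suc j) ρ)) ⟩
        2 ^ (j * ℓ) * (2 ^ d * 2 ^ ℓ) * count (suc j)
          ≡⟨ solve 4 (λ a b c e → a :* (b :* c) :* e := b :* (e :* (c :* a))) refl (2 ^ (j * ℓ))
              (2 ^ d) (2 ^ ℓ) (count (suc j)) ⟩
        2 ^ d * (count (suc j) * (2 ^ ℓ * 2 ^ (j * ℓ)))
          ≡⟨ cong (λ z → 2 ^ d * (count (suc j) * z)) (sym (^-distribˡ-+-* 2 ℓ (j * ℓ))) ⟩
        2 ^ d * (count (suc j) * 2 ^ (suc j * ℓ))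
          ≤⟨ *-monoʳ-≤ (2 ^ d) (count≤ (suc j)) ⟩
        2 ^ d * (2 ^ u * (2 ^ suc d * ∣ K ∣))
          ≡⟨ solve 3 (λ a b c → a :* (b :* c) := b :* (a :* c)) refl (2 ^ d) (2 ^ u)
              (2 ^ suc d * ∣ K ∣) ⟩
        2 ^ u * (2 ^ d * (2 ^ suc d * ∣ K ∣)) ∎)
        where
        open ≤-Reasoning
        open +-*-Solver
        u = total (suc j)
        X = ∑ (λ ρ → 𝟙 (level? (suc j) ρ) * witnesses ρ)
        each : ∀ ρ → 2 ^ threshold (suc j) * (𝟙 (level? (suc j) ρ) * witnesses ρ) ≤
                     2 ^ (j * ℓ) * (2 ^ d * 2 ^ ℓ) * 𝟙 (level? (suc j) ρ)
        each ρ with level? (suc j) ρ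
        ... | no _  = ≤-trans (≤-reflexive (*-zeroʳ (2 ^ threshold (suc j)))) z≤n
        ... | yes l = ≤-trans (≤-reflexive (cong (2 ^ threshold (suc j) *_) (*-identityˡ (witnesses ρ))))
                (≤-trans (witnesses≤ j l) (≤-reflexive (sym (*-identityʳ _))))

      few-rare : 2 ^ c₀ * # (rareCovered? K) ≤ d * (2 ^ d * (2 ^ suc d * ∣ K ∣))
      few-rare = begin
        2 ^ c₀ * # (rareCovered? K)
          ≤⟨ *-monoʳ-≤ (2 ^ c₀) (≤-trans #-rare (∑-mono split)) ⟩
        2 ^ c₀ * ∑ (λ ρ → ∑ (λ (j : Fin d) → term ρ j))
          ≡⟨ cong (2 ^ c₀ *_) (∑-swap term) ⟩
        2 ^ c₀ * ∑ (λ j → ∑ (λ ρ → term ρ j))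
          ≡⟨ sym (∑-* (2 ^ c₀) (λ j → ∑ (λ ρ → term ρ j))) ⟩
        ∑ (λ j → 2 ^ c₀ * ∑ (λ ρ → term ρ j))
          ≤⟨ ∑-≤ d (λ j → rare-at (toℕ j)) ⟩
        d * (2 ^ d * (2 ^ suc d * ∣ K ∣)) ∎
        where
        open ≤-Reasoning
        term : Subset n → Fin d → ℕ
        term ρ j = 𝟙 (level? (suc (toℕ j)) ρ) * witnesses ρ
        split : ∀ ρ → witnesses ρ ≤ ∑ (term ρ)
        split ρ with ρ ∈H?
        ... | yes ρ∈H = let j , l = ∈H⇒level ρ∈H in ≤-trans
                (≤-reflexive (sym (trans (cong (_* witnesses ρ)
                    (𝟙-yes (level? (suc (toℕ j)) ρ) l)) (*-identityˡ (witnesses ρ)))))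
                (≤∑ j (term ρ))
        ... | no ρ∉H = ≤-trans (≤-reflexive (trans
                (∑-cong λ τ → trans (∑-cong λ κ → #-zero (λ a → witness? τ a ρ κ) λ a w → ρ∉H
                    (Witness.ρ∈H w)) (∑-zero {Subset n})) (∑-zero {Subset n}))) z≤n

-- Constants, and the first moment for small and large cores

module FirstMoment where

  open Counting
  open Cores
  open OuterProbability
  open Exploring
  open Potential
  open HeavyFamilies
  open import Data.List.Membership.Propositional using () renaming (_∈_ to _∈ᴸ_; _∉_ to _∉ᴸ_)
  import Data.List.Relation.Unary.All as All
  open import Data.List.Relation.Unary.Any as Any using (Any)
  open import Data.Nat
  open import Data.Nat.Properties
  open import Data.Nat.Solver using (module +-*-Solver)
  open import Data.Rational as ℚ using (ℚ; 0ℚ; 1ℚ; ½)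
  import Data.Rational.Properties as ℚ
  open import Algebra.Bundles using (CommutativeRing)
  open import Algebra.Properties.Semiring.Exp (CommutativeRing.semiring ℚ.+-*-commutativeRing)
    using (^-homo-*) renaming (_^_ to _^ℚ_)

  module Constants (d a : ℕ) where

    -- An ordinary step must win `suc a` bits for the branching and, in large cores, 3 bits for the
    -- growth of `x`, hence `a + 4`. `loss` is the largest drop of the potential in bits, and
    -- `light-exponent` lets a special step of a large core balance exactly. Within `c₀`, the first
    -- summand absorbs the constants of `few-rare`, `gain` makes the final potential affordable, and
    -- `light-exponent` serves `few-extensions`. `size-exponent` is the whole loss in counting down
    -- to the empty set.
    gain loss light-exponent c₀ size-exponent : ℕ
    gain           = a + 4
    loss           = gain * 2 ^ suc d
    light-exponent = d + (a + 4 + loss)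
    c₀             = suc (d + d + d) + gain + light-exponent
    size-exponent  = Thresholds.total d c₀ d + suc d

    -- `guesses` lets `K` pay for its heavy family, which is shorter by a factor of order `2 ^ ℓ`.
    -- `2 ^ m` bounds the number of vertices of a small core, while `room` keeps `m` below about ℓ /
    -- (d + 1).
    record Large (ℓ e : ℕ) : Set where
      field
        light≤ℓ : light-exponent ≤ ℓ
        guesses : suc (d + ℓ * d) * (d * 2 ^ size-exponent) ≤ 2 ^ ℓ
        m       : ℕ
        cutoff≤ : a + 3 + ℓ * suc d + e ≤ 2 ^ m
        room    : a + e + (suc a + m + loss) * suc d ≤ ℓ

  module Bounds (d n N : ℕ) (σ : Fin N → Subset n) (∣simplex∣ : ∀ i → ∣ σ i ∣ ≡ suc d)
    (simplex-injective : ∀ {i j} → σ i ≡ σ j → i ≡ j)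
    (simplex-surjective : ∀ {p} → ∣ p ∣ ≡ suc d → ∃[ i ] σ i ≡ p)
    (p : ℚ) (0≤p : 0ℚ ℚ.≤ p) (p≤1 : p ℚ.≤ 1ℚ) (a ℓ : ℕ) (p≤ : p ℚ.≤ dyadic a ℓ)
    (n≤2^ℓ : n ≤ 2 ^ ℓ) (2≤d : 2 ≤ d) (e : ℕ) (large : Constants.Large d a ℓ e) where

    open HeavySets d n N σ ∣simplex∣ simplex-injective simplex-surjective
    open Probability p 0≤p p≤1
    open Constants d a
    open Large large

    cutoff : ℕ
    cutoff = a + 3 + ℓ * suc d + e

    module SmallCores where

      open Heavy [] (λ ())

      Small : Pred (Subset N) 0ℓ
      Small K = MinimalCore K × ∣ K ∣ < cutoff × vertices K < ∣ K ∣

      -- `b` collects the bits a step to an old vertex needs besides the growth of `x`: the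
      -- branching, the choice among `2 ^ m` vertices and the drop of the potential. The remaining
      -- `z` bits are what each such step can yield.
      b z : ℕ
      b = suc a + m + loss
      z = ℓ ∸ b

      b≤ℓ : b ≤ ℓ
      b≤ℓ = ≤-trans (≤-trans (≤-reflexive (sym (*-identityʳ b))) (*-monoʳ-≤ b (s≤s z≤n)))
        (m+n≤o⇒n≤o (a + e) room)

      -- A new vertex costs `z`, just what a simplex returns, so only steps to old vertices make a
      -- net profit. The `suc` in `y` is allowed by the strict inequality in `core-vertices` and
      -- gives the start one more `z`.
      x y : Subset N → ℕ
      x S = z * ∣ S ∣
      y S = z * suc (vertices S) + gain * Φ S

      final : ∀ {K} → Small K → y K ≤ x K
      final {K} ((core , _) , _ , few) = begin
        z * suc (vertices K) + gain * Φ K ≡⟨ cong (λ k → z * suc (vertices K) + gain * k) Φ≡0 ⟩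
        z * suc (vertices K) + gain * 0   ≡⟨ cong (z * suc (vertices K) +_) (*-zeroʳ gain) ⟩
        z * suc (vertices K) + 0          ≡⟨ +-identityʳ _ ⟩
        z * suc (vertices K)              ≤⟨ *-monoʳ-≤ z few ⟩
        z * ∣ K ∣                         ∎
        where
        open ≤-Reasoning
        Φ≡0 : Φ K ≡ 0
        Φ≡0 = n≤0⇒n≡0 (≤-trans (core-potential core)
          (≤-reflexive (#-zero (rareCovered? K) λ { τ (_ , (_ , _ , _ , (_ , ()) , _) , _) })))

      vertices-mono : ∀ {S T} → S ⊆ T → vertices S ≤ vertices T
      vertices-mono {S} {T} S⊆T = #-mono (vertex? S) (vertex? T) λ v (i , i∈S , v∈) → i , S⊆T i∈S , v∈

      step : Branching a ℓ Small x y
      step S τ free with vertices S ≤? 2 ^ m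
      -- A small core has fewer vertices than simplices and fewer simplices than `cutoff ≤ 2 ^ m`,
      -- so none extends this `S`.
      ... | no many = inj₁ λ { (K , (_ , K<M , few) , S⊆K) → many
            (≤-trans (vertices-mono S⊆K) (≤-trans (<⇒≤ (<-trans few K<M)) cutoff≤)) }
      ... | yes few = inj₂ (_ , vertex? S , m , few , λ v i v∉τ i∉S eq → ordinary v i v∉τ i∉S eq , λ _ → special i i∉S)
        where
        open +-*-Solver
        open ≤-Reasoning
        V = vertices S
        ordinary : ∀ v i → v ∉ τ → i ∉ S → σ i ≡ τ ⊕ v → ¬ (∃[ j ] (j ∈ S × v ∈ σ j)) →
          suc a + x (S ⊕ i) + y S ≤ x S + y (S ⊕ i)
        ordinary v i v∉τ i∉S eq new = begin
          suc a + z * ∣ S ⊕ i ∣ + (z * suc V + gain * Φ S)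
            ≡⟨ cong (λ k → suc a + z * k + (z * suc V + gain * Φ S)) (∣p⊕v∣ i∉S) ⟩
          suc a + z * suc ∣ S ∣ + (z * suc V + gain * Φ S)
            ≤⟨ +-monoˡ-≤ (z * suc V + gain * Φ S) (+-monoˡ-≤ (z * suc ∣ S ∣) sa≤) ⟩
          gain + z * suc ∣ S ∣ + (z * suc V + gain * Φ S)
            ≡⟨ solve 5 (λ g z k v f → g :+ z :* (con 1 :+ k) :+ (z :* v :+ g :* f) := z :* k :+
                (z :* (con 1 :+ v) :+ g :* (con 1 :+ f)))
                 refl gain z ∣ S ∣ (suc V) (Φ S) ⟩
          z * ∣ S ∣ + (z * suc (suc V) + gain * suc (Φ S))
            ≤⟨ +-monoʳ-≤ (z * ∣ S ∣) (+-mono-≤ (*-monoʳ-≤ z (s≤s more)) (*-monoʳ-≤ gain Φ<)) ⟩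
          z * ∣ S ∣ + (z * suc (vertices (S ⊕ i)) + gain * Φ (S ⊕ i)) ∎
          where
          sa≤ : suc a ≤ gain
          sa≤ = ≤-trans (≤-reflexive (+-comm 1 a)) (+-monoʳ-≤ a (s≤s z≤n))
          more : suc V ≤ vertices (S ⊕ i)
          more = #-insert (vertex? S) (vertex? (S ⊕ i)) v (λ u (j , j∈S , u∈) → j , p⊆p⊕v j∈S , u∈)
            (i , v∈p⊕v , subst (v ∈_) (sym eq) v∈p⊕v) new
          Φ< : suc (Φ S) ≤ Φ (S ⊕ i)
          Φ< = Step.potential-gain (λ ()) 2≤d free i∉S v∉τ eq
            λ { (_ , κ , _ , _ , _ , inj₂ (_ , j , j∈S , κv⊆)) → new (j , j∈S , κv⊆ v∈p⊕v) }
        special : ∀ i → i ∉ S → suc a + m + x (S ⊕ i) + y S ≤ ℓ + x S + y (S ⊕ i)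
        special i i∉S = begin
          suc a + m + z * ∣ S ⊕ i ∣ + (z * suc V + gain * Φ S)
            ≡⟨ cong (λ k → suc a + m + z * k + (z * suc V + gain * Φ S)) (∣p⊕v∣ i∉S) ⟩
          suc a + m + z * suc ∣ S ∣ + (z * suc V + gain * Φ S)
            ≤⟨ +-monoʳ-≤ (suc a + m + z * suc ∣ S ∣) (+-mono-≤
                (*-monoʳ-≤ z (s≤s (vertices-mono {S} {S ⊕ i} p⊆p⊕v)))
                 (*-monoʳ-≤ gain (potential-drop i∉S))) ⟩
          suc a + m + z * suc ∣ S ∣ + (z * suc V′ + gain * (Φ (S ⊕ i) + 2 ^ suc d))
            ≡⟨ solve 8 (λ a m z k v g f w → a :+ m :+ z :* (con 1 :+ k) :+ (z :* v :+ g :* (f :+ w))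
                 := (a :+ m :+ g :* w :+ z) :+ z :* k :+ (z :* v :+ g :* f))
                 refl (suc a) m z ∣ S ∣ (suc V′) gain (Φ (S ⊕ i)) (2 ^ suc d) ⟩
          (b + z) + z * ∣ S ∣ + (z * suc V′ + gain * Φ (S ⊕ i))
            ≡⟨ cong (λ k → k + z * ∣ S ∣ + (z * suc V′ + gain * Φ (S ⊕ i))) (m+[n∸m]≡n b≤ℓ) ⟩
          ℓ + z * ∣ S ∣ + (z * suc V′ + gain * Φ (S ⊕ i)) ∎
          where V′ = vertices (S ⊕ i)

      open Explore p 0≤p p≤1 a ℓ p≤ n≤2^ℓ Small proj₁ x y final step using (occurs; Occurs) public

      occurs-bound : Occurs ≼ ½ ^ℚ e
      occurs-bound = occurs (ℓ * suc d) e (#simplices ℓ n≤2^ℓ) λ i → begin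
        a + z * ∣ ⊥ ⊕ i ∣ + ℓ * suc d + e
          ≡⟨ cong (λ k → a + z * k + ℓ * suc d + e) (trans (∣p⊕v∣ {p = ⊥} {i} ∉⊥)
              (cong suc (∣⊥∣≡0 N))) ⟩
        a + z * 1 + ℓ * suc d + e
          ≡⟨ solve 5 (λ a z l d e → a :+ z :* con 1 :+ l :* (con 1 :+ d) :+ e := l :+
              (z :+ (a :+ e :+ l :* d))) refl a z ℓ d e ⟩
        ℓ + (z + (a + e + ℓ * d))
          ≤⟨ +-monoʳ-≤ ℓ (+-monoʳ-≤ z start≤) ⟩
        ℓ + (z + z * suc d)
          ≡⟨ cong (ℓ +_) (sym (*-suc z (suc d))) ⟩
        ℓ + z * suc (suc d)
          ≤⟨ +-monoʳ-≤ ℓ (≤-trans (*-monoʳ-≤ z (s≤s (first i))) (m≤m+n _ _)) ⟩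
        ℓ + y (⊥ ⊕ i) ∎
        where
        open ≤-Reasoning
        open +-*-Solver
        -- With ℓ written as `b + z` this is exactly `room`: net of `x`, the start has `z * suc d`
        -- bits to pay for the choice of the first simplex.
        start≤ : a + e + ℓ * d ≤ z * suc d
        start≤ = +-cancelˡ-≤ (b * suc d) (a + e + ℓ * d) (z * suc d) (begin
          b * suc d + (a + e + ℓ * d)     ≡⟨ solve 3 (λ u v w → u :+ (v :+ w) := (v :+ u) :+ w)
              refl (b * suc d) (a + e) (ℓ * d) ⟩
          a + e + b * suc d + ℓ * d       ≤⟨ +-monoˡ-≤ (ℓ * d) room ⟩
          ℓ + ℓ * d                       ≡⟨ sym (*-suc ℓ d) ⟩
          ℓ * suc d                       ≡⟨ cong (_* suc d) (sym (m+[n∸m]≡n b≤ℓ)) ⟩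
          (b + z) * suc d                 ≡⟨ *-distribʳ-+ (suc d) b z ⟩
          b * suc d + z * suc d           ∎)
        first : ∀ i → suc d ≤ vertices (⊥ ⊕ i)
        first i = ≤-trans (≤-reflexive (trans (sym (∣simplex∣ i)) (∣p∣≡# (σ i))))
          (#-mono (_∈? σ i) (vertex? (⊥ ⊕ i)) λ v v∈ → i , v∈p⊕v , v∈)

    -- `2 ^ guess` is at least twice the number of candidate sets, as `∑ℚ-sublists` requires, so
    -- each guessed set costs `guess` bits.
    guess : ℕ
    guess = suc (d + ℓ * d)

    module LargeCores (H : List (Subset n)) (small : All.All (λ κ → ∣ κ ∣ < d) H) where

      open Heavy H (All.lookup small)

      Big : Pred (Subset N) 0ℓ
      Big K = MinimalCore K × cutoff ≤ ∣ K ∣ × gain * Φ K ≤ ∣ K ∣ × guess * length H ≤ ∣ K ∣ ×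
        ⊥ ∉ᴸ H × (∀ κ → ∣ κ ∣ < d → κ ∉ᴸ H → 2 ^ light-exponent * # (extension? K κ) ≤ 2 ^ ℓ)

      C : ℕ
      C = cutoff + guess * length H

      -- The core repays `∣ K ∣` bits three times: for `cutoff`, which covers the first simplex and
      -- the accuracy, for the guess of `H`, and for the potential of the rare faces that remains at
      -- the end.
      x y : Subset N → ℕ
      x S = 3 * ∣ S ∣
      y S = C + gain * Φ S

      final : ∀ {K} → Big K → y K ≤ x K
      final {K} (_ , h₁ , h₂ , h₃ , _) = begin
        C + gain * Φ K                ≤⟨ +-mono-≤ (+-mono-≤ h₁ h₃) h₂ ⟩
        ∣ K ∣ + ∣ K ∣ + ∣ K ∣         ≡⟨ solve 1 (λ k → k :+ k :+ k := con 3 :* k) refl ∣ K ∣ ⟩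
        3 * ∣ K ∣                     ∎
        where
        open ≤-Reasoning
        open +-*-Solver

      -- Chosen so that `light-exponent + t` is `d + ℓ`, the exponent delivered by `special-count`.
      t : ℕ
      t = d + (ℓ ∸ light-exponent)

      step : Branching a ℓ Big x y
      -- The search for `κ` only decides whether the empty set is in `H`. If either test fails, no
      -- core in question extends `S`.
      step S τ free with # (special? S τ) ≤? 2 ^ t | exists? (λ κ → κ ≟ˢ ⊥ ×-dec All.all? (λ ρ → ¬? (κ ≟ˢ ρ)) H)
      ... | no many | _ = inj₁ λ { (K , (_ , _ , _ , _ , _ , few) , S⊆K) → many
            (*-cancelˡ-≤ (2 ^ light-exponent) {{m^n≢0 2 light-exponent}} (begin
              2 ^ light-exponent * # (special? S τ) ≤⟨ special-count (2 ^ light-exponent) (2 ^ ℓ)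
                  S⊆K (proj₁ free) few ⟩
              2 ^ d * 2 ^ ℓ                         ≡⟨ sym (^-distribˡ-+-* 2 d ℓ) ⟩
              2 ^ (d + ℓ)                           ≡⟨ cong (2 ^_) (sym t-eq) ⟩
              2 ^ (light-exponent + t)              ≡⟨ ^-distribˡ-+-* 2 light-exponent t ⟩
              2 ^ light-exponent * 2 ^ t            ∎)) }
        where
        open ≤-Reasoning
        t-eq : light-exponent + t ≡ d + ℓ
        t-eq = trans (sym (+-assoc light-exponent d _))
            (trans (cong (_+ (ℓ ∸ light-exponent)) (+-comm light-exponent d))
          (trans (+-assoc d light-exponent _) (cong (d +_) (m+[n∸m]≡n light≤ℓ))))
      ... | yes _ | no ∄ = inj₁ λ { (K , (_ , _ , _ , _ , ⊥∉H , _) , _) → ∄ (⊥ , refl ,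
            All.tabulate λ ρ∈H ⊥≡ρ → ⊥∉H (subst (_∈ᴸ H) (sym ⊥≡ρ) ρ∈H)) }
      ... | yes few | yes (_ , refl , ⊥∉) = inj₂ (_ , special? S τ , t , few ,
            λ v i v∉τ i∉S eq → ordinary v i v∉τ i∉S eq , λ _ → special i i∉S)
        where
        open +-*-Solver
        open ≤-Reasoning
        ordinary : ∀ v i → v ∉ τ → i ∉ S → σ i ≡ τ ⊕ v → ¬ Special S τ v →
          suc a + x (S ⊕ i) + y S ≤ x S + y (S ⊕ i)
        ordinary v i v∉τ i∉S eq ¬special = begin
          suc a + 3 * ∣ S ⊕ i ∣ + (C + gain * Φ S)
            ≡⟨ cong (λ k → suc a + 3 * k + (C + gain * Φ S)) (∣p⊕v∣ i∉S) ⟩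
          suc a + 3 * suc ∣ S ∣ + (C + gain * Φ S)
            ≡⟨ solve 4 (λ a k c f → con 1 :+ a :+ con 3 :* (con 1 :+ k) :+ (c :+ (a :+ con 4) :* f)
                 := con 3 :* k :+ (c :+ (a :+ con 4) :* (con 1 :+ f))) refl a ∣ S ∣ C (Φ S) ⟩
          3 * ∣ S ∣ + (C + gain * suc (Φ S))
            ≤⟨ +-monoʳ-≤ (3 * ∣ S ∣) (+-monoʳ-≤ C (*-monoʳ-≤ gain
                 (Step.potential-gain (λ h → All.lookup ⊥∉ h refl) 2≤d free i∉S v∉τ eq ¬special))) ⟩
          3 * ∣ S ∣ + (C + gain * Φ (S ⊕ i)) ∎
        special : ∀ i → i ∉ S → suc a + t + x (S ⊕ i) + y S ≤ ℓ + x S + y (S ⊕ i)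
        special i i∉S = begin
          suc a + t + 3 * ∣ S ⊕ i ∣ + (C + gain * Φ S)
            ≡⟨ cong (λ k → suc a + t + 3 * k + (C + gain * Φ S)) (∣p⊕v∣ i∉S) ⟩
          suc a + t + 3 * suc ∣ S ∣ + (C + gain * Φ S)
            ≤⟨ +-monoʳ-≤ (suc a + t + 3 * suc ∣ S ∣) (+-monoʳ-≤ C
                (*-monoʳ-≤ gain (potential-drop i∉S))) ⟩
          suc a + t + 3 * suc ∣ S ∣ + (C + gain * (Φ (S ⊕ i) + 2 ^ suc d))
            ≡⟨ solve 8 (λ a d r k c g f w → con 1 :+ a :+ (d :+ r) :+ con 3 :* (con 1 :+ k) :+
                (c :+ g :* (f :+ w))
                 := (d :+ (a :+ con 4 :+ g :* w) :+ r) :+ con 3 :* k :+ (c :+ g :* f))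
                 refl a d (ℓ ∸ light-exponent) ∣ S ∣ C gain (Φ (S ⊕ i)) (2 ^ suc d) ⟩
          (light-exponent + (ℓ ∸ light-exponent)) + 3 * ∣ S ∣ + (C + gain * Φ (S ⊕ i))
            ≡⟨ cong (λ k → k + 3 * ∣ S ∣ + (C + gain * Φ (S ⊕ i))) (m+[n∸m]≡n light≤ℓ) ⟩
          ℓ + 3 * ∣ S ∣ + (C + gain * Φ (S ⊕ i)) ∎

      open Explore p 0≤p p≤1 a ℓ p≤ n≤2^ℓ Big proj₁ x y final step using (occurs; Occurs) public

      occurs-bound : Occurs ≼ ½ ^ℚ (e + guess * length H)
      occurs-bound = occurs (ℓ * suc d) (e + guess * length H) (#simplices ℓ n≤2^ℓ) λ i → begin
        a + 3 * ∣ ⊥ ⊕ i ∣ + ℓ * suc d + (e + guess * length H)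
          ≡⟨ cong (λ k → a + 3 * k + ℓ * suc d + (e + guess * length H))
              (trans (∣p⊕v∣ {p = ⊥} {i} ∉⊥) (cong suc (∣⊥∣≡0 N))) ⟩
        a + 3 + ℓ * suc d + (e + guess * length H)
          ≡⟨ sym (+-assoc (a + 3 + ℓ * suc d) e _) ⟩
        C
          ≤⟨ ≤-trans (m≤m+n C _) (m≤n+m _ ℓ) ⟩
        ℓ + y (⊥ ⊕ i) ∎
        where open ≤-Reasoning

    BigFor : List (Subset n) → Pred (Subset N) 0ℓ
    BigFor H Y = Σ[ small ∈ All.All (λ κ → ∣ κ ∣ < d) H ] LargeCores.Occurs H small Y

    -- For each guessed family the exploration gains the factor `½ ^ (guess * length H)` on top of
    -- the accuracy, and over all families these factors sum to at most 2.
    big-bound : (λ Y → Any (λ H → BigFor H Y) (sublists (smallSubsets d n))) ≼ ½ ^ℚ e ℚ.* 2ℚ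
    big-bound = ≼-weaken id total (≼-⋃ (sublists (smallSubsets d n)) each)
      where
      each : ∀ H → BigFor H ≼ ½ ^ℚ e ℚ.* ½ ^ℚ (guess * length H)
      each H with All.all? (λ κ → ∣ κ ∣ <? d) H
      ... | no ¬small = ≼-weaken id
            (*-nonNeg (^-nonNeg e (ℚ.nonNegative⁻¹ ½)) (^-nonNeg (guess * length H)
                (ℚ.nonNegative⁻¹ ½)))
            (≼-empty λ (small , _) → ¬small small)
      ... | yes small = ≼-weaken {E = LargeCores.Occurs H small}
            (λ {Y} (small′ , o) → subst (λ s → LargeCores.Occurs H s Y)
                (All.irrelevant ≤-irrelevant small′ small) o)
            (ℚ.≤-reflexive (^-homo-* ½ e (guess * length H))) (LargeCores.occurs-bound H small)
      total : ∑ℚ (sublists (smallSubsets d n)) (λ H → ½ ^ℚ e ℚ.* ½ ^ℚ (guess * length H)) ℚ.≤ ½ ^ℚ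
          e ℚ.* 2ℚ
      total = ℚ.≤-trans
        (ℚ.≤-reflexive (∑ℚ-*ˡ (sublists (smallSubsets d n)) (λ H → ½ ^ℚ (guess * length H)) (½ ^ℚ e)))
        (*-monoˡ (^-nonNeg e (ℚ.nonNegative⁻¹ ½))
          (∑ℚ-sublists (smallSubsets d n) guess (length-smallSubsets d ℓ n≤2^ℓ)))

    Bad : Pred (Subset N) 0ℓ
    Bad Y = ∃[ K ] (K ⊆ Y × MinimalCore K × 2 ^ suc size-exponent * ∣ K ∣ ≤ n ^ d × ¬ Boundary K)

    module _ {K : Subset N} (minimal : MinimalCore K) (small : 2 ^ suc size-exponent * ∣ K ∣ ≤ n ^ d)
      (big : cutoff ≤ ∣ K ∣) where

      open Levels ℓ c₀ n≤2^ℓ K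
      open WithH

      private
        u : ℕ
        u = Thresholds.total d c₀ d

        size≡ : ∀ k → 2 ^ u * (2 ^ suc d * k) ≡ 2 ^ size-exponent * k
        size≡ k = trans (sym (*-assoc (2 ^ u) (2 ^ suc d) k))
            (cong (_* k) (sym (^-distribˡ-+-* 2 u (suc d))))

        -- The `suc` in the exponent of `small` doubles the quantity to be bounded, which yields the
        -- strict inequality needed for a light empty set.
        few : 2 ^ u * (2 ^ suc d * ∣ K ∣) < 2 ^ (d * ℓ)
        few = begin-strict
          2 ^ u * (2 ^ suc d * ∣ K ∣)  ≡⟨ size≡ ∣ K ∣ ⟩
          X                            <⟨ m<m+n X (*-mono-< (m^n>0 2 size-exponent) 0<∣K∣) ⟩
          X + X                        ≡⟨ solve 2 (λ x k → x :* k :+ x :* k := (con 2 :* x) :* k)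
              refl (2 ^ size-exponent) ∣ K ∣ ⟩
          2 ^ suc size-exponent * ∣ K ∣ ≤⟨ small ⟩
          n ^ d                        ≤⟨ ^-monoˡ-≤ d n≤2^ℓ ⟩
          (2 ^ ℓ) ^ d                  ≡⟨ trans (^-*-assoc 2 ℓ d) (cong (2 ^_) (*-comm ℓ d)) ⟩
          2 ^ (d * ℓ)                  ∎
          where
          open ≤-Reasoning
          open +-*-Solver
          X = 2 ^ size-exponent * ∣ K ∣
          0<∣K∣ : 0 < ∣ K ∣
          0<∣K∣ = ≤-trans (≤-trans (s≤s z≤n) (≤-reflexive (sym (trans (+-assoc (a + 3) (ℓ * suc d) e)
            (trans (cong (_+ (ℓ * suc d + e)) (+-comm a 3)) refl))))) big

        -- In a core only rare faces contribute. The factors d, `2 ^ d` and `2 ^ suc d` of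
        -- `few-rare` amount to at most 3d + 1 bits, and `c₀` contains these and another `gain`
        -- bits.
        low-potential : gain * Φ K ≤ ∣ K ∣
        low-potential = *-cancelˡ-≤ (2 ^ suc (d + d + d)) {{m^n≢0 2 (suc (d + d + d))}} (begin
          2 ^ suc (d + d + d) * (gain * Φ K)
            ≤⟨ *-monoʳ-≤ (2 ^ suc (d + d + d)) (*-mono-≤ (n≤2^n gain)
                (core-potential (proj₁ minimal))) ⟩
          2 ^ suc (d + d + d) * (2 ^ gain * # (rareCovered? K))
            ≡⟨ trans (sym (*-assoc (2 ^ suc (d + d + d)) (2 ^ gain) _))
                (cong (_* # (rareCovered? K)) (sym (^-distribˡ-+-* 2 (suc (d + d + d)) gain))) ⟩
          2 ^ (suc (d + d + d) + gain) * # (rareCovered? K)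
            ≤⟨ *-monoˡ-≤ (# (rareCovered? K)) (2^-mono-≤
                (m≤m+n (suc (d + d + d) + gain) light-exponent)) ⟩
          2 ^ c₀ * # (rareCovered? K)
            ≤⟨ few-rare ⟩
          d * (2 ^ d * (2 ^ suc d * ∣ K ∣))
            ≤⟨ *-monoˡ-≤ (2 ^ d * (2 ^ suc d * ∣ K ∣)) (n≤2^n d) ⟩
          2 ^ d * (2 ^ d * (2 ^ suc d * ∣ K ∣))
            ≡⟨ solve 2 (λ x k → x :* (x :* (con 2 :* x :* k)) := con 2 :* (x :* x :* x) :* k) refl
                (2 ^ d) ∣ K ∣ ⟩
          2 * (2 ^ d * 2 ^ d * 2 ^ d) * ∣ K ∣
            ≡⟨ cong (λ k → 2 * k * ∣ K ∣) (sym (trans (^-distribˡ-+-* 2 (d + d) d)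
                (cong (_* 2 ^ d) (^-distribˡ-+-* 2 d d)))) ⟩
          2 ^ suc (d + d + d) * ∣ K ∣ ∎)
          where
          open ≤-Reasoning
          open +-*-Solver

        -- `guess` is only linear in ℓ, whereas `H` is shorter than `K` by the factor `2 ^ ℓ` up to
        -- a constant.
        few-heavy : guess * length H ≤ ∣ K ∣
        few-heavy = *-cancelʳ-≤ (guess * length H) ∣ K ∣ (2 ^ ℓ) {{m^n≢0 2 ℓ}} (begin
          guess * length H * 2 ^ ℓ                      ≡⟨ *-assoc guess (length H) (2 ^ ℓ) ⟩
          guess * (length H * 2 ^ ℓ)                    ≤⟨ *-monoʳ-≤ guess length-H ⟩
          guess * (d * (2 ^ u * (2 ^ suc d * ∣ K ∣)))   ≡⟨ cong (λ k → guess * (d * k)) (size≡ ∣ K ∣) ⟩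
          guess * (d * (2 ^ size-exponent * ∣ K ∣))     ≡⟨ solve 4
              (λ g d x k → g :* (d :* (x :* k)) := k :* (g :* (d :* x))) refl
                                                              guess d (2 ^ size-exponent) ∣ K ∣ ⟩
          ∣ K ∣ * (guess * (d * 2 ^ size-exponent))     ≤⟨ *-monoʳ-≤ ∣ K ∣ guesses ⟩
          ∣ K ∣ * 2 ^ ℓ                                 ∎)
          where
          open ≤-Reasoning
          open +-*-Solver

      -- The heavy family of `K` is itself a sublist of the candidates, so `K` is caught under that
      -- guess.
      heavy-guess : ∀ {Y} → K ⊆ Y → Any (λ H → BigFor H Y) (sublists (smallSubsets d n))
      heavy-guess {Y} K⊆Y = Any.map {P = H ≡_} {Q = λ H → BigFor H Y}
          (λ { refl → H-small , K , (minimal , big , low-potential , few-heavy , ⊥-light few ,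
          λ κ κ<d κ∉H → ≤-trans (*-monoˡ-≤ (# (extension? K κ))
              (2^-mono-≤ (m≤n+m light-exponent (suc (d + d + d) + gain))))
            (few-extensions κ κ<d κ∉H)) , K⊆Y })
        (filter∈sublists heavy? (smallSubsets d n))

    bad-bound : Bad ≼ ½ ^ℚ e ℚ.* 2ℚ ℚ.+ ½ ^ℚ e
    bad-bound = ≼-∪ big-bound SmallCores.occurs-bound split
      where
      split : ∀ {Y} → Bad Y → Any (λ H → BigFor H Y) (sublists (smallSubsets d n)) ⊎ SmallCores.Occurs Y
      split (K , K⊆Y , minimal , small , ¬boundary) with cutoff ≤? ∣ K ∣
      ... | yes big = inj₁ (heavy-guess minimal small big K⊆Y)
      ... | no ¬big = inj₂ (K , (minimal , ≰⇒> ¬big , core-vertices 2≤d (proj₁ minimal) ¬boundary) , K⊆Y)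

-- Asymptotics and the passage to real probabilities

module AlmostSurely where

  open Counting
  open Cores
  open OuterProbability
  open HeavyFamilies
  open FirstMoment
  import Defs
  open Defs
    using (ℝ; seq; cauchy; fromℚ; fromℕ; 0ℝ; 1ℝ; _/ₙ_; allSubsets; simplices; simplex; Complex;
        IsMinimalCore; ContainsSimplexBoundary; AAS; Tendsto; Pr)
  open import Data.Integer as ℤ using (-[1+_]) renaming (+_ to pos)
  import Data.Integer.Properties as ℤ
  open import Data.Nat as ℕ using (ℕ; zero; suc; s≤s; z≤n; NonZero)
  open import Data.Nat.DivMod using (_/_; m/n*n≤m; m≡m%n+[m/n]*n; m%n<n; /-monoˡ-≤; m*n/n≡m)
  import Data.Nat.Properties as ℕ
  import Data.Nat.Solver as ℕ
  open import Data.Rational as ℚ using (ℚ; mkℚ; 0ℚ; 1ℚ; ½; _+_; _*_; _-_; -_; _≤_; _<_)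
  open import Data.Rational.Properties as ℚ using (≤-refl; ≤-trans; ≤-reflexive; +-*-commutativeRing)
  open import Data.Rational.Solver using (module +-*-Solver)
  import Data.Rational.Unnormalised as ℚᵘ
  import Data.Rational.Unnormalised.Properties as ℚᵘ
  open import Algebra.Bundles using (CommutativeRing)
  open import Algebra.Properties.Semiring.Exp (CommutativeRing.semiring +-*-commutativeRing)
    using (_^_)

  -- The exponent is split as q + (m - q) with q above A + D. The first power absorbs the
  -- coefficients, the second absorbs m, since m ≥ 2q leaves at least half of m in m - q.
  exponential-beats-linear : ∀ A D → ∃[ m₀ ] (∀ m → m₀ ℕ.≤ m → A ℕ.+ D ℕ.* m ℕ.≤ 2 ℕ.^ m)
  exponential-beats-linear A D = q ℕ.+ q , λ m q+q≤m → ℕ.*-cancelˡ-≤ 2 (begin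
      2 ℕ.* (A ℕ.+ D ℕ.* m)
        ≤⟨ ℕ.*-monoʳ-≤ 2 (ℕ.+-monoˡ-≤ (D ℕ.* m) (ℕ.≤-trans (ℕ.≤-reflexive (sym (ℕ.*-identityʳ A)))
            (ℕ.*-monoʳ-≤ A (s≤s (z≤n {m}))))) ⟩
      2 ℕ.* (A ℕ.* suc m ℕ.+ D ℕ.* m)
        ≤⟨ ℕ.*-monoʳ-≤ 2 (ℕ.+-monoʳ-≤ (A ℕ.* suc m) (ℕ.*-monoʳ-≤ D (ℕ.n≤1+n m))) ⟩
      2 ℕ.* (A ℕ.* suc m ℕ.+ D ℕ.* suc m)
        ≡⟨ solve 3 (λ a e k → con 2 :* (a :* k :+ e :* k) := con 2 :* (a :+ e) :* k) refl A D (suc m) ⟩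
      2 ℕ.* (A ℕ.+ D) ℕ.* suc m
        ≤⟨ ℕ.*-mono-≤ (ℕ.*-monoʳ-≤ 2 (n≤2^n (A ℕ.+ D))) (half q+q≤m) ⟩
      2 ℕ.^ q ℕ.* (2 ℕ.* suc (m ℕ.∸ q))
        ≤⟨ ℕ.*-monoʳ-≤ (2 ℕ.^ q) (ℕ.*-monoʳ-≤ 2 (suc≤2^ (m ℕ.∸ q))) ⟩
      2 ℕ.^ q ℕ.* (2 ℕ.* 2 ℕ.^ (m ℕ.∸ q))
        ≡⟨ solve 2 (λ x y → x :* (con 2 :* y) := con 2 :* (x :* y)) refl (2 ℕ.^ q) (2 ℕ.^ (m ℕ.∸ q)) ⟩
      2 ℕ.* (2 ℕ.^ q ℕ.* 2 ℕ.^ (m ℕ.∸ q))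
        ≡⟨ cong (2 ℕ.*_) (trans (sym (ℕ.^-distribˡ-+-* 2 q (m ℕ.∸ q)))
            (cong (2 ℕ.^_) (ℕ.m+[n∸m]≡n (ℕ.m+n≤o⇒m≤o q q+q≤m)))) ⟩
      2 ℕ.* 2 ℕ.^ m ∎)
    where
    open ℕ.≤-Reasoning
    open ℕ.+-*-Solver
    q = suc (A ℕ.+ D)
    suc≤2^ : ∀ k → suc k ℕ.≤ 2 ℕ.^ k
    suc≤2^ zero    = ℕ.≤-refl
    suc≤2^ (suc k) = ℕ.+-mono-≤ (ℕ.m^n>0 2 k) (ℕ.≤-trans (suc≤2^ k)
        (ℕ.≤-reflexive (sym (ℕ.+-identityʳ (2 ℕ.^ k)))))
    half : ∀ {m} → q ℕ.+ q ℕ.≤ m → suc m ℕ.≤ 2 ℕ.* suc (m ℕ.∸ q)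
    half {m} h = begin
      suc m                         ≡⟨ cong suc (sym (ℕ.m+[n∸m]≡n (ℕ.m+n≤o⇒m≤o q h))) ⟩
      suc (q ℕ.+ (m ℕ.∸ q))         ≤⟨ s≤s (ℕ.+-monoˡ-≤ (m ℕ.∸ q) (ℕ.m+n≤o⇒m≤o∸n q h)) ⟩
      suc (m ℕ.∸ q ℕ.+ (m ℕ.∸ q))   ≤⟨ ℕ.n≤1+n _ ⟩
      suc (suc (m ℕ.∸ q ℕ.+ (m ℕ.∸ q))) ≡⟨ solve 1 (λ x → con 2 :+ (x :+ x) := con 2 :*
          (con 1 :+ x)) refl (m ℕ.∸ q) ⟩
      2 ℕ.* suc (m ℕ.∸ q)           ∎

  eventually-large : ∀ d a e → ∃[ ℓ₀ ] (∀ ℓ → ℓ₀ ℕ.≤ ℓ → Constants.Large d a ℓ e)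
  eventually-large d a e = ℓ₀ , large
    where
    open Constants d a
    X E A₁ A₂ : ℕ
    X  = d ℕ.* 2 ℕ.^ size-exponent
    E  = a ℕ.+ e ℕ.+ (suc a ℕ.+ loss) ℕ.* suc d
    A₁ = suc d ℕ.* X
    A₂ = a ℕ.+ 3 ℕ.+ e ℕ.+ (E ℕ.+ suc d) ℕ.* suc d
    growth₁ = exponential-beats-linear A₁ (d ℕ.* X)
    growth₂ = exponential-beats-linear A₂ (suc d ℕ.* suc d)
    m₀ = proj₁ growth₂
    ℓ₀ = light-exponent ℕ.+ proj₁ growth₁ ℕ.+ (E ℕ.+ m₀ ℕ.* suc d)
    large : ∀ ℓ → ℓ₀ ℕ.≤ ℓ → Large ℓ e
    large ℓ ℓ₀≤ℓ = record
      { light≤ℓ = ℕ.m+n≤o⇒m≤o light-exponent (ℕ.m+n≤o⇒m≤o (light-exponent ℕ.+ proj₁ growth₁) ℓ₀≤ℓ)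
      ; guesses = ℕ.≤-trans (ℕ.≤-reflexive (solve 3 (λ d l x → (con 1 :+ (d :+ l :* d)) :* x :=
          (con 1 :+ d) :* x :+ d :* x :* l) refl d ℓ X))
                    (proj₂ growth₁ ℓ (ℕ.m+n≤o⇒n≤o light-exponent
                        (ℕ.m+n≤o⇒m≤o (light-exponent ℕ.+ proj₁ growth₁) ℓ₀≤ℓ)))
      ; m       = m
      ; cutoff≤ = ℕ.≤-trans cutoff (proj₂ growth₂ m m₀≤m)
      ; room    = begin
          a ℕ.+ e ℕ.+ (suc a ℕ.+ m ℕ.+ loss) ℕ.* suc d
            ≡⟨ solve 5 (λ a e m l d → a :+ e :+ (con 1 :+ a :+ m :+ l) :* d := a :+ e :+
                (con 1 :+ a :+ l) :* d :+ m :* d)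
                 refl a e m loss (suc d) ⟩
          E ℕ.+ m ℕ.* suc d
            ≤⟨ ℕ.+-monoʳ-≤ E (m/n*n≤m (ℓ ℕ.∸ E) (suc d)) ⟩
          E ℕ.+ (ℓ ℕ.∸ E)
            ≡⟨ ℕ.m+[n∸m]≡n E≤ℓ ⟩
          ℓ ∎ }
      where
      open ℕ.≤-Reasoning
      open ℕ.+-*-Solver
      E+≤ℓ : E ℕ.+ m₀ ℕ.* suc d ℕ.≤ ℓ
      E+≤ℓ = ℕ.m+n≤o⇒n≤o (light-exponent ℕ.+ proj₁ growth₁) ℓ₀≤ℓ
      E≤ℓ : E ℕ.≤ ℓ
      E≤ℓ = ℕ.m+n≤o⇒m≤o E E+≤ℓ
      m : ℕ
      -- The largest value that `room` admits. It is linear in ℓ up to rounding, so its power of two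
      -- overtakes `cutoff`, which is itself linear in ℓ.
      m = (ℓ ℕ.∸ E) / suc d
      m₀≤m : m₀ ℕ.≤ m
      m₀≤m = ℕ.≤-trans (ℕ.≤-reflexive (sym (m*n/n≡m m₀ (suc d))))
        (/-monoˡ-≤ (suc d) (ℕ.m+n≤o⇒m≤o∸n (m₀ ℕ.* suc d)
            (ℕ.≤-trans (ℕ.≤-reflexive (ℕ.+-comm (m₀ ℕ.* suc d) E)) E+≤ℓ)))
      cutoff : a ℕ.+ 3 ℕ.+ ℓ ℕ.* suc d ℕ.+ e ℕ.≤ A₂ ℕ.+ suc d ℕ.* suc d ℕ.* m
      cutoff = begin
        a ℕ.+ 3 ℕ.+ ℓ ℕ.* suc d ℕ.+ e
          ≡⟨ cong (λ k → a ℕ.+ 3 ℕ.+ k ℕ.* suc d ℕ.+ e) (sym (ℕ.m+[n∸m]≡n E≤ℓ)) ⟩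
        a ℕ.+ 3 ℕ.+ (E ℕ.+ (ℓ ℕ.∸ E)) ℕ.* suc d ℕ.+ e
          ≤⟨ ℕ.+-monoˡ-≤ e (ℕ.+-monoʳ-≤ (a ℕ.+ 3) (ℕ.*-monoˡ-≤ (suc d)
              (ℕ.+-monoʳ-≤ E (ℕ.≤-trans (ℕ.≤-reflexive (m≡m%n+[m/n]*n (ℓ ℕ.∸ E) (suc d)))
               (ℕ.+-monoˡ-≤ (m ℕ.* suc d) (ℕ.<⇒≤ (m%n<n (ℓ ℕ.∸ E) (suc d)))))))) ⟩
        a ℕ.+ 3 ℕ.+ (E ℕ.+ suc m ℕ.* suc d) ℕ.* suc d ℕ.+ e
          ≡⟨ solve 5 (λ a E m d e → a :+ con 3 :+ (E :+ (con 1 :+ m) :* d) :* d :+ e := a :+ con 3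
              :+ e :+ (E :+ d) :* d :+ d :* d :* m)
               refl a E m (suc d) e ⟩
        A₂ ℕ.+ suc d ℕ.* suc d ℕ.* m ∎

  -- Both sides matter: `n ≤ 2 ^ ℓ` bounds the numbers of choices, and `2 ^ ℓ ≤ 2 * n` bounds 1/n by
  -- two over `2 ^ ℓ`.
  binary-length : ∀ n → 1 ℕ.≤ n → ∃[ ℓ ] ((n ℕ.≤ 2 ℕ.^ ℓ) × (2 ℕ.^ ℓ ℕ.≤ 2 ℕ.* n))
  binary-length (suc zero)    _ = 0 , ℕ.≤-refl , s≤s z≤n
  binary-length (suc (suc n)) _ with binary-length (suc n) (s≤s z≤n)
  ... | ℓ , n≤ , ≤2n with suc (suc n) ℕ.≤? 2 ℕ.^ ℓ
  ...   | yes h = ℓ , h , ℕ.≤-trans ≤2n (ℕ.*-monoʳ-≤ 2 (ℕ.n≤1+n (suc n)))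
  ...   | no h  = suc ℓ , ℕ.≤-trans (ℕ.≤-trans (ℕ.m≤n+m (suc (suc n)) n) (ℕ.≤-reflexive (solve 1 (λ n → n :+ (con 2 :+ n) := con 2 :* (con 1 :+ n)) refl n))) (ℕ.*-monoʳ-≤ 2 n≤) ,
                  ℕ.*-monoʳ-≤ 2 (ℕ.≤-trans (ℕ.s≤s⁻¹ (ℕ.≰⇒> h)) (ℕ.n≤1+n (suc n)))
    where open ℕ.+-*-Solver

  ι≡/1 : ∀ m → pos m ℚ./ 1 ≡ ι m
  ι≡/1 zero    = refl
  ι≡/1 (suc m) = trans (ℚ.toℚᵘ-injective (begin
      ℚ.toℚᵘ (pos (suc m) ℚ./ 1)                       ≈⟨ ℚ.toℚᵘ-fromℚᵘ (ℚᵘ.mkℚᵘ (pos (suc m)) 0) ⟩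
      ℚᵘ.mkℚᵘ (pos (suc m)) 0                          ≈⟨ ℚᵘ.*≡*
          (cong (λ z → (pos 1 ℤ.+ z) ℤ.* pos 1) (sym (ℤ.*-identityʳ (pos m)))) ⟩
      ℚ.toℚᵘ 1ℚ ℚᵘ.+ ℚᵘ.mkℚᵘ (pos m) 0               ≈⟨ ℚᵘ.+-congʳ (ℚ.toℚᵘ 1ℚ)
          (ℚᵘ.≃-sym (ℚ.toℚᵘ-fromℚᵘ (ℚᵘ.mkℚᵘ (pos m) 0))) ⟩
      ℚ.toℚᵘ 1ℚ ℚᵘ.+ ℚ.toℚᵘ (pos m ℚ./ 1)            ≈⟨ ℚᵘ.≃-sym (ℚ.toℚᵘ-homo-+ 1ℚ (pos m ℚ./ 1)) ⟩
      ℚ.toℚᵘ (1ℚ + (pos m ℚ./ 1))                    ∎))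
    (cong (1ℚ +_) (ι≡/1 m))
    where open import Relation.Binary.Reasoning.Setoid ℚᵘ.≃-setoid

  ι*1/n : ∀ n .{{_ : NonZero n}} → ι n * (pos 1 ℚ./ n) ≡ 1ℚ
  ι*1/n (suc n) = trans (cong (_* (pos 1 ℚ./ suc n)) (sym (ι≡/1 (suc n)))) (ℚ.toℚᵘ-injective (begin
      ℚ.toℚᵘ ((pos (suc n) ℚ./ 1) * (pos 1 ℚ./ suc n))
        ≈⟨ ℚ.toℚᵘ-homo-* (pos (suc n) ℚ./ 1) (pos 1 ℚ./ suc n) ⟩
      ℚ.toℚᵘ (pos (suc n) ℚ./ 1) ℚᵘ.* ℚ.toℚᵘ (pos 1 ℚ./ suc n)
        ≈⟨ ℚᵘ.*-cong (ℚ.toℚᵘ-fromℚᵘ (ℚᵘ.mkℚᵘ (pos (suc n)) 0)) (ℚ.toℚᵘ-fromℚᵘ (ℚᵘ.mkℚᵘ (pos 1) n)) ⟩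
      ℚᵘ.mkℚᵘ (pos (suc n)) 0 ℚᵘ.* ℚᵘ.mkℚᵘ (pos 1) n
        ≈⟨ ℚᵘ.*≡* (trans (trans (ℤ.*-identityʳ (pos (suc n) ℤ.* pos 1)) (ℤ.*-identityʳ (pos (suc n))))
             (trans (cong (pos ∘ suc) (sym (ℕ.+-identityʳ n)))
                 (sym (ℤ.*-identityˡ (pos (suc (n ℕ.+ 0))))))) ⟩
      ℚ.toℚᵘ 1ℚ ∎))
    where open import Relation.Binary.Reasoning.Setoid ℚᵘ.≃-setoid

  archimedean : ∀ q → ∃[ m ] q ≤ ι m
  archimedean q = m , ℚ.toℚᵘ-cancel-≤ (subst (λ z → ℚ.toℚᵘ q ℚᵘ.≤ ℚ.toℚᵘ z) (ι≡/1 m)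
        (ℚᵘ.≤-respʳ-≃ (ℚᵘ.≃-sym (ℚ.toℚᵘ-fromℚᵘ (ℚᵘ.mkℚᵘ (pos m) 0))) (below q)))
    where
    m = ℤ.∣ ℚ.↥ q ∣
    below : ∀ q → ℚ.toℚᵘ q ℚᵘ.≤ ℚᵘ.mkℚᵘ (pos ℤ.∣ ℚ.↥ q ∣) 0
    below (mkℚ (pos k) j _)      = ℚᵘ.*≤* (ℤ.*-monoˡ-≤-nonNeg (pos k) {pos 1} {pos (suc j)}
        (ℤ.+≤+ (s≤s z≤n)))
    below (mkℚ -[1+ k ] j _)   = ℚᵘ.*≤* ℤ.-≤+

  ι≤2^ : ∀ m → ι m ≤ 2ℚ ^ m
  ι≤2^ m = ≤-trans (ι-mono (n≤2^n m)) (≤-reflexive (ι-2^ m))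

  ½^≤ : ∀ q → 0ℚ < q → ∃[ m ] ½ ^ m ≤ q
  ½^≤ q 0<q = m , (begin
      ½ ^ m                   ≡⟨ sym (ℚ.*-identityʳ (½ ^ m)) ⟩
      ½ ^ m * 1ℚ              ≡⟨ cong (½ ^ m *_) (sym (ℚ.*-inverseˡ q {{q≢0}})) ⟩
      ½ ^ m * (r * q)         ≤⟨ *-monoˡ (^-nonNeg m (ℚ.nonNegative⁻¹ ½))
          (*-monoʳ (ℚ.<⇒≤ 0<q) (≤-trans (proj₂ (archimedean r)) (ι≤2^ m))) ⟩
      ½ ^ m * (2ℚ ^ m * q)    ≡⟨ solve 3 (λ x y z → x :* (y :* z) := (y :* x) :* z) refl (½ ^ m)
          (2ℚ ^ m) q ⟩
      dyadic m m * q          ≡⟨ cong (_* q) (dyadic-diag m) ⟩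
      1ℚ * q                  ≡⟨ ℚ.*-identityˡ q ⟩
      q                       ∎)
    where
    open ℚ.≤-Reasoning
    open +-*-Solver
    q≢0 : ℚ.NonZero q
    q≢0 = ℚ.pos⇒nonZero q {{ℚ.positive 0<q}}
    r : ℚ
    r = (ℚ.1/ q) {{q≢0}}
    m : ℕ
    m = proj₁ (archimedean r)

  ≤-approx : ∀ {x y} → (∀ q → 0ℚ < q → x ≤ y + q) → x ≤ y
  ≤-approx {x} {y} h with x ℚ.≤? y
  ... | yes x≤y = x≤y
  ... | no x≰y  = let z , y<z , z<x = ℚ.<-dense (ℚ.≰⇒> x≰y)
                  in ⊥-elim (ℚ.<-irrefl refl (ℚ.<-≤-trans z<x
                      (subst (x ≤_) (solve 2 (λ y z → y :+ (z :- y) := z) refl y z)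
                       (h (z - y) (subst (_< z - y) (ℚ.+-inverseʳ y) (ℚ.+-monoˡ-< (- y) y<z))))))
    where open +-*-Solver

  weightℚ : ∀ {N} → ℚ → Subset N → ℚ
  weightℚ p Y = p ^ ∣ Y ∣ * (1ℚ - p) ^ ∣ ∁ Y ∣

  seq-^ : ∀ (x : ℝ) m k → seq (x Defs.^ m) k ≡ seq x k ^ m
  seq-^ x zero    k = refl
  seq-^ x (suc m) k = cong (seq x k *_) (seq-^ x m k)

  seq-sum : ∀ {A : Set} (f : A → ℝ) xs k → seq (Defs.sum (map f xs)) k ≡ ∑ℚ xs (λ x → seq (f x) k)
  seq-sum f []       k = refl
  seq-sum f (x ∷ xs) k = cong (seq (f x) k +_) (seq-sum f xs k)

  ∑ℚ-cong : {A : Set} (xs : List A) {f g : A → ℚ} → (∀ x → f x ≡ g x) → ∑ℚ xs f ≡ ∑ℚ xs g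
  ∑ℚ-cong []       h = refl
  ∑ℚ-cong (x ∷ xs) h = cong₂ _+_ (h x) (∑ℚ-cong xs h)

  -- Real operations act pointwise, so the k-th approximation of the probability is the exact
  -- probability for the k-th rational approximation of `p`. All estimates can thus be made over the
  -- rationals.
  seq-Pr : ∀ d n p {E : Pred (Complex d n) 0ℓ} (E? : Decidable E) k →
    seq (Pr d n p E?) k ≡ ∑ℚ (filter E? (allSubsets (length (simplices d n)))) (weightℚ (seq p k))
  seq-Pr d n p E? k = trans (seq-sum (Defs.weight d n p)
      (filter E? (allSubsets (length (simplices d n)))) k)
    (∑ℚ-cong (filter E? (allSubsets (length (simplices d n)))) λ Y →
      cong₂ _*_ (seq-^ p ∣ Y ∣ k) (seq-^ (1ℝ Defs.- p) ∣ ∁ Y ∣ k))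

  module _ (p : ℚ) (0≤p : 0ℚ ≤ p) (p≤1 : p ≤ 1ℚ) where

    open Probability p 0≤p p≤1

    𝔼-∑ℚ : ∀ {N} (f : Subset N → ℚ) → ∑ℚ (allSubsets N) (λ Y → weightℚ p Y * f Y) ≡ 𝔼 f
    𝔼-∑ℚ {zero}  f = trans (ℚ.+-identityʳ _) (trans (cong (_* f []) (ℚ.*-identityˡ 1ℚ))
        (ℚ.*-identityˡ (f [])))
    𝔼-∑ℚ {suc N} f = begin
      ∑ℚ (map (outside ∷_) (allSubsets N) ++ map (inside ∷_) (allSubsets N)) F
        ≡⟨ ∑ℚ-++ (map (outside ∷_) (allSubsets N)) _ F ⟩
      ∑ℚ (map (outside ∷_) (allSubsets N)) F + ∑ℚ (map (inside ∷_) (allSubsets N)) F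
        ≡⟨ cong₂ _+_ (∑ℚ-map (outside ∷_) (allSubsets N) F) (∑ℚ-map (inside ∷_) (allSubsets N) F) ⟩
      ∑ℚ (allSubsets N) (F ∘ (outside ∷_)) + ∑ℚ (allSubsets N) (F ∘ (inside ∷_))
        ≡⟨ cong₂ _+_
             (trans (∑ℚ-cong (allSubsets N) λ Y → solve 4
                 (λ x r y z → x :* (r :* y) :* z := r :* (x :* y :* z)) refl
               (p ^ ∣ Y ∣) (1ℚ - p) ((1ℚ - p) ^ ∣ ∁ Y ∣) (f (outside ∷ Y)))
                   (∑ℚ-*ˡ (allSubsets N) _ (1ℚ - p)))
             (trans (∑ℚ-cong (allSubsets N) λ Y → solve 4
                 (λ r x y z → r :* x :* y :* z := r :* (x :* y :* z)) refl
               p (p ^ ∣ Y ∣) ((1ℚ - p) ^ ∣ ∁ Y ∣) (f (inside ∷ Y))) (∑ℚ-*ˡ (allSubsets N) _ p)) ⟩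
      (1ℚ - p) * ∑ℚ (allSubsets N) (λ Y → weightℚ p Y * f (outside ∷ Y)) + p * ∑ℚ (allSubsets N)
          (λ Y → weightℚ p Y * f (inside ∷ Y))
        ≡⟨ cong₂ (λ x y → (1ℚ - p) * x + p * y) (𝔼-∑ℚ (f ∘ (outside ∷_))) (𝔼-∑ℚ (f ∘ (inside ∷_))) ⟩
      𝔼 f ∎
      where
      open ≡-Reasoning
      open +-*-Solver
      F : Subset (suc N) → ℚ
      F Y = weightℚ p Y * f Y

    indicator : ∀ {N} {E : Pred (Subset N) 0ℓ} → Decidable E → Subset N → ℚ
    indicator E? Y = ι (𝟙 (E? Y))

    ∑ℚ-filter : ∀ {A : Set} {E : Pred A 0ℓ} (E? : Decidable E) xs (f : A → ℚ) →
      ∑ℚ (filter E? xs) f ≡ ∑ℚ xs (λ x → f x * ι (𝟙 (E? x)))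
    ∑ℚ-filter E? []       f = refl
    ∑ℚ-filter E? (x ∷ xs) f with E? x
    ... | yes _ = cong₂ _+_ (sym (trans (cong (f x *_) (ℚ.+-identityʳ 1ℚ)) (ℚ.*-identityʳ (f x)))) (∑ℚ-filter E? xs f)
    ... | no _  = trans (∑ℚ-filter E? xs f) (sym (trans (cong (_+ _) (ℚ.*-zeroʳ (f x))) (ℚ.+-identityˡ _)))

    probability : ∀ {N} {E : Pred (Subset N) 0ℓ} (E? : Decidable E) →
      ∑ℚ (filter E? (allSubsets N)) (weightℚ p) ≡ 𝔼 (indicator E?)
    probability {N} E? = trans (∑ℚ-filter E? (allSubsets N) (weightℚ p)) (𝔼-∑ℚ (indicator E?))

    probability≤1 : ∀ {N} {E : Pred (Subset N) 0ℓ} (E? : Decidable E) →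
      ∑ℚ (filter E? (allSubsets N)) (weightℚ p) ≤ 1ℚ
    probability≤1 {N} E? = ≤-trans (≤-reflexive (probability E?))
      (≤-trans (𝔼-mono {g = λ _ → 1ℚ} λ Y → ι-mono {k = 1} (𝟙≤1 (E? Y))) (≤-reflexive (𝔼-const N 1ℚ)))

    -- Pointwise, the indicator of the decidable event and the dominating weight of its complement
    -- add up to at least 1.
    probability≥ : ∀ {N b} {E F : Pred (Subset N) 0ℓ} (E? : Decidable E) → F ≼ b →
        (∀ {Y} → ¬ E Y → F Y) →
      1ℚ ≤ ∑ℚ (filter E? (allSubsets N)) (weightℚ p) + b
    probability≥ {N} {b} E? c ¬E⊆F = begin
      1ℚ                                        ≡⟨ sym (𝔼-const N 1ℚ) ⟩
      𝔼 {N} (λ _ → 1ℚ)                          ≤⟨ 𝔼-mono covered ⟩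
      𝔼 (λ Y → indicator E? Y + weight c Y)     ≡⟨ 𝔼-+ (indicator E?) (weight c) ⟩
      𝔼 (indicator E?) + 𝔼 (weight c)           ≤⟨ ℚ.+-monoʳ-≤ (𝔼 (indicator E?)) (bound c) ⟩
      𝔼 (indicator E?) + b                      ≡⟨ cong (_+ b) (sym (probability E?)) ⟩
      ∑ℚ (filter E? (allSubsets N)) (weightℚ p) + b ∎
      where
      open ℚ.≤-Reasoning
      covered : ∀ Y → 1ℚ ≤ indicator E? Y + weight c Y
      covered Y with E? Y
      ... | yes _ = subst (_≤ 1ℚ + 0ℚ + weight c Y) (ℚ.+-identityʳ 1ℚ) (ℚ.+-monoʳ-≤ 1ℚ (nonNeg c Y))
      ... | no ¬e = subst (1ℚ ≤_) (sym (ℚ.+-identityˡ (weight c Y))) (dominates c (¬E⊆F ¬e))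

  ι-* : ∀ m k → ι (m ℕ.* k) ≡ ι m * ι k
  ι-* zero    k = sym (ℚ.*-zeroˡ (ι k))
  ι-* (suc m) k = trans (ι-+ k (m ℕ.* k)) (trans (cong (ι k +_) (ι-* m k))
    (solve 2 (λ x y → y :+ x :* y := (con 1ℚ :+ x) :* y) refl (ι m) (ι k)))
    where open +-*-Solver

  ι-cancel : ∀ {m k} → ι m ≤ ι k → m ℕ.≤ k
  ι-cancel {m} {k} h with m ℕ.≤? k
  ... | yes m≤k = m≤k
  ... | no m≰k  = ⊥-elim (ℚ.<-irrefl refl (ℚ.<-≤-trans
        (subst (_< ι (suc k)) (ℚ.+-identityˡ (ι k)) (ℚ.+-monoˡ-< (ι k) (ℚ.positive⁻¹ 1ℚ)))
        (≤-trans (ι-mono (ℕ.≰⇒> m≰k)) h)))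

  forall? : {A : Set} {{_ : Finite A}} {P : Pred A 0ℓ} → Decidable P → Dec (∀ x → P x)
  forall? P? with exists? (λ x → ¬? (P? x))
  ... | yes (x , ¬p) = no λ h → ¬p (h x)
  ... | no ∄         = yes λ x → decidable-stable (P? x) λ ¬p → ∄ (x , ¬p)

  module Event (d n N : ℕ) (σ : Fin N → Subset n) (∣simplex∣ : ∀ i → ∣ σ i ∣ ≡ suc d)
    (simplex-injective : ∀ {i j} → σ i ≡ σ j → i ≡ j)
    (simplex-surjective : ∀ {p} → ∣ p ∣ ≡ suc d → ∃[ i ] σ i ≡ p) (D : ℕ) where

    open Simplices d n N σ ∣simplex∣ simplex-injective simplex-surjective

    Small : Pred (Subset N) 0ℓ
    Small K = fromℕ ∣ K ∣ Defs.≤ fromℚ (½ ^ D) Defs.* fromℕ (n ℕ.^ d)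

    Good : Pred (Subset N) 0ℓ
    Good Y = ∀ K → K ⊆ Y → MinimalCore K → Small K → Boundary K

    private
      -- With a rational δ both sides of the size condition are constant sequences, so the real
      -- inequality amounts to this decidable one.
      ℚ-small : Subset N → Set
      ℚ-small K = pos ∣ K ∣ ℚ./ 1 ≤ ½ ^ D * (pos (n ℕ.^ d) ℚ./ 1)

      small⇒ : ∀ {K} → Small K → ℚ-small K
      small⇒ h = ≤-approx λ q 0<q → let M , below = h q 0<q in below M ℕ.≤-refl

      ⇒small : ∀ {K} → ℚ-small K → Small K
      ⇒small {K} h q 0<q = 0 , λ _ _ → ≤-trans h
        (subst (_≤ r + q) (ℚ.+-identityʳ r) (ℚ.+-monoʳ-≤ r (ℚ.<⇒≤ 0<q)))
        where
        r : ℚ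
        r = ½ ^ D * (pos (n ℕ.^ d) ℚ./ 1)

    small⇒2^ : ∀ {K} → Small K → 2 ℕ.^ D ℕ.* ∣ K ∣ ℕ.≤ n ℕ.^ d
    small⇒2^ {K} h = ι-cancel (begin
      ι (2 ℕ.^ D ℕ.* ∣ K ∣)            ≡⟨ trans (ι-* (2 ℕ.^ D) ∣ K ∣)
          (cong₂ _*_ (ι-2^ D) (sym (ι≡/1 ∣ K ∣))) ⟩
      2ℚ ^ D * (pos ∣ K ∣ ℚ./ 1)       ≤⟨ *-monoˡ (^-nonNeg D (ℚ.nonNegative⁻¹ 2ℚ)) (small⇒ {K} h) ⟩
      2ℚ ^ D * (½ ^ D * (pos (n ℕ.^ d) ℚ./ 1)) ≡⟨ sym (ℚ.*-assoc (2ℚ ^ D) (½ ^ D) _) ⟩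
      dyadic D D * (pos (n ℕ.^ d) ℚ./ 1) ≡⟨ cong₂ _*_ (dyadic-diag D) (ι≡/1 (n ℕ.^ d)) ⟩
      1ℚ * ι (n ℕ.^ d)                 ≡⟨ ℚ.*-identityˡ (ι (n ℕ.^ d)) ⟩
      ι (n ℕ.^ d)                      ∎)
      where open ℚ.≤-Reasoning

    private abstract
      small? : Decidable Small
      small? K = map′ (⇒small {K}) (small⇒ {K}) (_ ℚ.≤? _)

      face? : ∀ K → Decidable (Face K)
      face? K τ = exists? λ i → (i ∈? K) ×-dec (τ ⊆? σ i)

      core? : Decidable Core
      core? K = nonempty? K ×-dec forall? λ τ → (∣ τ ∣ ℕ.≟ d) →-dec (face? K τ →-dec
        exists? λ i → exists? λ j → ¬? (i Fin.≟ j) ×-dec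
            ((i ∈? K) ×-dec ((j ∈? K) ×-dec ((τ ⊆? σ i) ×-dec (τ ⊆? σ j)))))

      minimalCore? : Decidable MinimalCore
      minimalCore? K = core? K ×-dec forall? λ K′ → (K′ ⊂? K) →-dec ¬? (core? K′)

      boundary? : Decidable Boundary
      boundary? K = exists? λ ρ → (∣ ρ ∣ ℕ.≟ suc (suc d)) ×-dec forall? λ τ → (τ ⊂? ρ) →-dec face? K τ

    good? : Decidable Good
    good? Y = forall? λ K → (K ⊆? Y) →-dec (minimalCore? K →-dec (small? K →-dec boundary? K))

    bad : ∀ {Y} → ¬ Good Y →
      ∃[ K ] (K ⊆ Y × MinimalCore K × 2 ℕ.^ D ℕ.* ∣ K ∣ ℕ.≤ n ℕ.^ d × ¬ Boundary K)
    bad {Y} ¬good with exists? (λ K → (K ⊆? Y) ×-dec (minimalCore? K ×-dec (small? K ×-dec ¬? (boundary? K))))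
    ... | yes (K , K⊆Y , minimal , small , ¬boundary) = K , (λ h → K⊆Y h) , minimal , small⇒2^ {K} small , ¬boundary
    ... | no ∄ = ⊥-elim (¬good λ K K⊆Y minimal small →
            decidable-stable (boundary? K) λ ¬boundary → ∄
                (K , (λ h → K⊆Y h) , minimal , small , ¬boundary))

  module Limit (d : ℕ) (2≤d : 2 ℕ.≤ d) (c : ℝ) (0<c : 0ℝ Defs.< c) where

    private
      near : ∃[ M ] (∀ j k → M ℕ.≤ j → M ℕ.≤ k → ℚ.∣ seq c j - seq c k ∣ ≤ 1ℚ)
      near = cauchy c 1ℚ (ℚ.positive⁻¹ 1ℚ)

      k₁ : ℕ
      k₁ = proj₁ near

      -- From this index on the approximations of `c` are positive and within 1 of a fixed one, so
      -- the rational estimates apply to each of them with the same `a`.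
      k₀ : ℕ
      k₀ = k₁ ℕ.⊔ proj₁ (proj₂ (proj₂ 0<c))

      a : ℕ
      a = proj₁ (archimedean (seq c k₁ + 1ℚ))

      0≤c : ∀ k → k₀ ℕ.≤ k → 0ℚ ≤ seq c k
      0≤c k h = let q , 0<q , M , above = 0<c in
        ≤-trans (ℚ.<⇒≤ 0<q) (subst (_≤ seq c k) (ℚ.+-identityˡ q) (above k (ℕ.m⊔n≤o⇒n≤o k₁ M h)))

      c≤ : ∀ k → k₀ ℕ.≤ k → seq c k ≤ dyadic a 0
      c≤ k h = begin
        seq c k                          ≡⟨ solve 2 (λ x y → x := y :+ (x :- y)) refl (seq c k)
            (seq c k₁) ⟩
        seq c k₁ + (seq c k - seq c k₁)  ≤⟨ ℚ.+-monoʳ-≤ (seq c k₁) (≤-trans (p≤∣p∣ _)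
                                              (proj₂ near k k₁ (ℕ.m⊔n≤o⇒m≤o k₁ _ h) ℕ.≤-refl)) ⟩
        seq c k₁ + 1ℚ                    ≤⟨ proj₂ (archimedean (seq c k₁ + 1ℚ)) ⟩
        ι a                              ≤⟨ ι≤dyadic {k = a} (n≤2^n a) ⟩
        dyadic a 0                       ∎
        where
        open ℚ.≤-Reasoning
        open +-*-Solver
        p≤∣p∣ : ∀ q → q ≤ ℚ.∣ q ∣
        p≤∣p∣ q with ℚ.≤-total 0ℚ q
        ... | inj₁ 0≤q = ≤-reflexive (sym (ℚ.0≤p⇒∣p∣≡p 0≤q))
        ... | inj₂ q≤0 = ≤-trans q≤0 (ℚ.0≤∣p∣ q)

    -- The constants are taken at `suc a` because replacing 1/n by a power of two costs a factor of
    -- two. The outer `suc` is the doubling that keeps the empty set light.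
    D : ℕ
    D = suc (Constants.size-exponent d (suc a))

    δ : ℝ
    δ = fromℚ (½ ^ D)

    0<δ : 0ℝ Defs.< δ
    0<δ = ½ ^ D , ℚ.<-≤-trans (0<½^ D) ≤-refl , 0 , λ _ _ → ≤-reflexive (ℚ.+-identityˡ (½ ^ D))
      where
      0<½^ : ∀ k → 0ℚ < ½ ^ k
      0<½^ zero    = ℚ.positive⁻¹ 1ℚ
      0<½^ (suc k) = ℚ.positive⁻¹ (½ * ½ ^ k) {{ℚ.pos*pos⇒pos ½ (½ ^ k) {{ℚ.positive (0<½^ k)}}}}

    GoodComplex : ∀ n → Pred (Complex d n) 0ℓ
    GoodComplex n = Event.Good d n (length (simplices d n)) (simplex d n) (∣simplex∣ {d} {n})
        (simplex-injective {d} {n}) (simplex-surjective {d} {n}) D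

    goodComplex? : ∀ n → Decidable (GoodComplex n)
    goodComplex? n = Event.good? d n (length (simplices d n)) (simplex d n) (∣simplex∣ {d} {n})
        (simplex-injective {d} {n}) (simplex-surjective {d} {n}) D

    module _ (n : ℕ) .{{_ : NonZero n}} (ℓ e : ℕ) (n≤2^ℓ : n ℕ.≤ 2 ℕ.^ ℓ) (2^ℓ≤2n : 2 ℕ.^ ℓ ℕ.≤ 2 ℕ.* n)
      (a<ℓ : suc a ℕ.≤ ℓ) (large : Constants.Large d (suc a) ℓ e) (k : ℕ) (k₀≤k : k₀ ℕ.≤ k) where

      private
        p : ℚ
        p = seq (c /ₙ n) k

        0≤1/n : 0ℚ ≤ pos 1 ℚ./ n
        0≤1/n = ℚ.nonNegative⁻¹ (pos 1 ℚ./ n) {{ℚ.normalize-nonNeg 1 n}}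

        0≤p : 0ℚ ≤ p
        0≤p = *-nonNeg (0≤c k k₀≤k) 0≤1/n

        1/n≤ : pos 1 ℚ./ n ≤ dyadic 1 ℓ
        1/n≤ = begin
          pos 1 ℚ./ n                              ≡⟨ sym
              (trans (cong ((pos 1 ℚ./ n) *_) (dyadic-diag ℓ)) (ℚ.*-identityʳ _)) ⟩
          (pos 1 ℚ./ n) * (2ℚ ^ ℓ * ½ ^ ℓ)         ≡⟨ cong (λ z → (pos 1 ℚ./ n) * (z * ½ ^ ℓ))
              (sym (ι-2^ ℓ)) ⟩
          (pos 1 ℚ./ n) * (ι (2 ℕ.^ ℓ) * ½ ^ ℓ)    ≤⟨ *-monoˡ 0≤1/n
              (*-monoʳ (^-nonNeg ℓ (ℚ.nonNegative⁻¹ ½)) (ι-mono 2^ℓ≤2n)) ⟩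
          (pos 1 ℚ./ n) * (ι (2 ℕ.* n) * ½ ^ ℓ)    ≡⟨ cong (λ z → (pos 1 ℚ./ n) * (z * ½ ^ ℓ))
              (ι-* 2 n) ⟩
          (pos 1 ℚ./ n) * (ι 2 * ι n * ½ ^ ℓ)      ≡⟨ solve 4
              (λ x t y h → x :* (t :* y :* h) := (y :* x) :* (t :* h)) refl
                                                        (pos 1 ℚ./ n) (ι 2) (ι n) (½ ^ ℓ) ⟩
          ι n * (pos 1 ℚ./ n) * (ι 2 * ½ ^ ℓ)      ≡⟨ trans (cong (_* (ι 2 * ½ ^ ℓ)) (ι*1/n n))
              (ℚ.*-identityˡ _) ⟩
          dyadic 1 ℓ                               ∎
          where
          open ℚ.≤-Reasoning
          open +-*-Solver

        p≤ : p ≤ dyadic (suc a) ℓ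
        p≤ = begin
          seq c k * (pos 1 ℚ./ n)      ≤⟨ *-mono (0≤c k k₀≤k) (dyadic-nonNeg 1 ℓ) (c≤ k k₀≤k) 1/n≤ ⟩
          dyadic a 0 * dyadic 1 ℓ      ≡⟨ dyadic-* a 0 1 ℓ ⟩
          dyadic (a ℕ.+ 1) ℓ           ≡⟨ cong (λ z → dyadic z ℓ) (ℕ.+-comm a 1) ⟩
          dyadic (suc a) ℓ             ∎
          where open ℚ.≤-Reasoning

        p≤1 : p ≤ 1ℚ
        p≤1 = ≤-trans p≤ (≤-trans (dyadic-mono {suc a} {ℓ} {0} {0}
            (ℕ.≤-trans (ℕ.≤-reflexive (ℕ.+-identityʳ (suc a))) a<ℓ))
          (≤-reflexive (dyadic-diag 0)))

      Pr≤1 : seq (Pr d n (c /ₙ n) (goodComplex? n)) k ≤ 1ℚ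
      Pr≤1 = ≤-trans (≤-reflexive (seq-Pr d n (c /ₙ n) (goodComplex? n) k))
        (probability≤1 p 0≤p p≤1 (goodComplex? n))

      Pr≥ : 1ℚ ≤ seq (Pr d n (c /ₙ n) (goodComplex? n)) k + (½ ^ e * 2ℚ + ½ ^ e)
      Pr≥ = ≤-trans
        (probability≥ p 0≤p p≤1 (goodComplex? n)
          (Bounds.bad-bound d n (length (simplices d n)) (simplex d n) (∣simplex∣ {d} {n})
              (simplex-injective {d} {n}) (simplex-surjective {d} {n})
            p 0≤p p≤1 (suc a) ℓ p≤ n≤2^ℓ 2≤d e large)
          (Event.bad d n (length (simplices d n)) (simplex d n) (∣simplex∣ {d} {n})
              (simplex-injective {d} {n}) (simplex-surjective {d} {n}) D))
        (≤-reflexive (cong (_+ (½ ^ e * 2ℚ + ½ ^ e)) (sym (seq-Pr d n (c /ₙ n) (goodComplex? n) k))))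

    tends : Tendsto (λ n → Pr d n (c /ₙ n) (goodComplex? n)) 1ℝ
    tends ε (q , 0<q , k₂ , q≤ε) = 2 ℕ.^ ℓ₀ , λ n n≥ →
        let ℓ , n≤ , ≤2n = binary-length n (ℕ.≤-trans (ℕ.m^n>0 2 ℓ₀) n≥)
            ℓ₀≤ℓ = 2^-cancel (ℕ.≤-trans n≥ n≤)
            a<ℓ = ℕ.m⊔n≤o⇒m≤o (suc a) (proj₁ threshold) ℓ₀≤ℓ
            large = proj₂ threshold ℓ (ℕ.m⊔n≤o⇒n≤o (suc a) (proj₁ threshold) ℓ₀≤ℓ)
        -- One half of `q` is the margin of the strict inequality, the other half is left for the
        -- failure probability.
        in (q * ½ , ℚ.*-monoˡ-<-pos ½ 0<q , k₀ ℕ.⊔ k₂ , λ k k≥ →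
              lower (seq ε k) (seq (Pr d n (c /ₙ n) (goodComplex? n)) k) (q≤ k (ℕ.m⊔n≤o⇒n≤o k₀ k₂ k≥))
                (Pr≥ n ℓ e n≤ ≤2n a<ℓ large k (ℕ.m⊔n≤o⇒m≤o k₀ k₂ k≥))) ,
           (q , 0<q , k₀ ℕ.⊔ k₂ , λ k k≥ → ℚ.+-mono-≤
              (Pr≤1 n ℓ e n≤ ≤2n a<ℓ large k (ℕ.m⊔n≤o⇒m≤o k₀ k₂ k≥))
              (q≤ k (ℕ.m⊔n≤o⇒n≤o k₀ k₂ k≥)))
      where
      q≤ : ∀ k → k₂ ℕ.≤ k → q ≤ seq ε k
      q≤ k h = subst (_≤ seq ε k) (ℚ.+-identityˡ q) (q≤ε k h)
      accuracy = ½^≤ (q * ½) (ℚ.*-monoˡ-<-pos ½ 0<q)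
      e : ℕ
      -- Two further halvings reduce the three terms `½ ^ e` of the failure bound to three quarters
      -- of the permitted error.
      e = suc (suc (proj₁ accuracy))
      threshold = eventually-large d (suc a) e
      ℓ₀ : ℕ
      ℓ₀ = suc a ℕ.⊔ proj₁ threshold
      2^-cancel : ∀ {i j} → 2 ℕ.^ i ℕ.≤ 2 ℕ.^ j → i ℕ.≤ j
      2^-cancel {i} {j} h with i ℕ.≤? j
      ... | yes i≤j = i≤j
      ... | no i≰j  = ⊥-elim (ℕ.<⇒≱ (ℕ.^-monoʳ-< 2 (s≤s (s≤s z≤n)) (ℕ.≰⇒> i≰j)) h)
      error≤ : ½ ^ e * 2ℚ + ½ ^ e ≤ q * ½
      error≤ = begin
        ½ ^ e * 2ℚ + ½ ^ e   ≡⟨ solve 1 (λ x → con ½ :* (con ½ :* x) :* (con 1ℚ :+ con 1ℚ) :+ con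
            ½ :* (con ½ :* x)
                                  := x :* (con ½ :+ con ½ :* con ½)) refl (½ ^ proj₁ accuracy) ⟩
        ½ ^ proj₁ accuracy * (½ + ½ * ½)
                             ≤⟨ *-monoˡ (^-nonNeg (proj₁ accuracy) (ℚ.nonNegative⁻¹ ½))
                                 (toWitness {a? = (½ + ½ * ½) ℚ.≤? 1ℚ} _) ⟩
        ½ ^ proj₁ accuracy * 1ℚ ≡⟨ ℚ.*-identityʳ _ ⟩
        ½ ^ proj₁ accuracy   ≤⟨ proj₂ accuracy ⟩
        q * ½                ∎
        where
        open ℚ.≤-Reasoning
        open +-*-Solver
      lower : ∀ x P → q ≤ x → 1ℚ ≤ P + (½ ^ e * 2ℚ + ½ ^ e) → 1ℚ + (- x) + q * ½ ≤ P
      lower x P q≤x h = begin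
        1ℚ + (- x) + q * ½                ≤⟨ ℚ.+-monoˡ-≤ (q * ½)
            (ℚ.+-mono-≤ (≤-trans h (ℚ.+-monoʳ-≤ P error≤)) (ℚ.neg-antimono-≤ q≤x)) ⟩
        P + q * ½ + (- q) + q * ½         ≡⟨ solve 2 (λ P q → P :+ q :* con ½ :+ (:- q) :+ q :*
            con ½ := P) refl P q ⟩
        P                                 ∎
        where
        open ℚ.≤-Reasoning
        open +-*-Solver

open import Defs
open import Data.Nat as ℕ using (ℕ)
open AlmostSurely using (module Limit)

theorem7 : (d : ℕ) → 2 ℕ.≤ d → (c : ℝ) → 0ℝ < c →
    ∃[ δ ] ((0ℝ < δ) ×
    AAS d (λ n → c /ₙ n) (λ n Y →
    ∀ K → K ⊆ Y → IsMinimalCore d n K →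
    fromℕ ∣ K ∣ ≤ δ * fromℕ (n ℕ.^ d) →
    ContainsSimplexBoundary d n K))
theorem7 d 2≤d c 0<c = δ , 0<δ , goodComplex? , tends
  where open Limit d 2≤d c 0<c
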